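{- Let $n\ge 2$ and let $\lambda$ be a strict partition with at most $n$ parts. There is a unique $\mathfrak{q}^+_n$-crystal structure on $\textsf{DecTab}^+_n(\lambda)$ for which $\mathsf{revrow}:\textsf{DecTab}^+_n(\lambda)\to(\mathbb{B}^+_n)^{\otimes|\lambda|}$ is a $\mathfrak{q}^+_n$-crystal embedding. This structure restricts to a $\mathfrak{q}_n$-crystal structure on $\textsf{DecTab}_n(\lambda)$ (that is, the maps $\mathsf{wt}$, $e_i,f_i$ for $i\in\{\overline1,1,\dots,n-1\}$ send $\textsf{DecTab}_n(\lambda)$ into $\textsf{DecTab}_n(\lambda)\sqcup\{0\}$ and form a $\mathfrak{q}_n$-crystal) for which $\mathsf{revrow}:\textsf{DecTab}_n(\lambda)\to\mathbb{B}_n^{\otimes|\lambda|}$ is a $\mathfrak{q}_n$-crystal embedding.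
   Context: Abstract crystals. Let $\mathbf{e}_1,\dots,\mathbf{e}_n$ be the standard basis of $\mathbb{Z}^n$ and $0$ an auxiliary element. A $\mathfrak{gl}_n$-crystal is a set $\mathcal B$ with $\mathsf{wt}:\mathcal B\to\mathbb{Z}^n$ and maps $e_i,f_i:\mathcal B\to\mathcal B\sqcup\{0\}$ ($i\in[n-1]$) such that $e_i(b)=c$ iff $f_i(c)=b$, in which case $\mathsf{wt}(c)=\mathsf{wt}(b)+\mathbf e_i-\mathbf e_{i+1}$. String lengths: $\varepsilon_i(b)=\sup\{k\ge0:e_i^k(b)\ne0\}$, $\varphi_i(b)=\sup\{k\ge0:f_i^k(b)\ne0\}$. A map $\phi$ preserves a map $\eta$ if $\eta(\phi(b))=\eta(b)$ whenever $\phi(b)\neq0$. A $\mathfrak q_n$-crystal is a $\mathfrak{gl}_n$-crystal with extra maps $e_{\overline1},f_{\overline1}:\mathcal B\to\mathcal B\sqcup\{0\}$ such that (a) $e_{\overline1},f_{\overline1}$ commute with $e_i,f_i$ and preserve $\varepsilon_i,\varphi_i$ for $3\le i\le n-1$; (b) $e_{\overline1}(b)=c$ iff $f_{\overline1}(c)=b$, in which case $\mathsf{wt}(c)=\mathsf{wt}(b)+\mathbf e_1-\mathbf e_2$. A $\mathfrak q^+_n$-crystal is a $\mathfrak q_n$-crystal with extra maps $e_0,f_0$ such that (a) $e_0,f_0$ commute with $e_i,f_i$ for $2\le i\le n-1$ and preserve $\mathsf{wt}$ and $\varepsilon_i,\varphi_i$ for all $i\neq0$; (b) $e_0(b)=c$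 iff $f_0(c)=b$; (c) $\varepsilon_0(b)+\varphi_0(b)\le1$, and $=0$ whenever $\varepsilon_{\overline1}(b)+\varphi_{\overline1}(b)=0$. All operators send $0$ to $0$. A crystal embedding is a weight-preserving injective map $\phi$ with $\phi(e_i(b))=e_i(\phi(b))$ and $\phi(f_i(b))=f_i(\phi(b))$ for all $b$ and all indices $i$ (setting $\phi(0)=0$). Primed words. For $i\in\mathbb Z$ put $i':=i-\tfrac12$; the letters are ordered $1'<1<2'<2<\cdots$; adding or subtracting $1$ keeps prime status. For a word $w=w_1\cdots w_m$ in $\{1'<1<\dots<n'<n\}$, $\mathsf{wt}(w)_i$ is the number of letters in $\{i',i\}$, and: for $i\in[n-1]$, mark letters in $\{i',i\}$ by ")" and letters in $\{(i+1)',i+1\}$ by "("; the $i$-unpaired letters are those not matched in the usual parenthesis matching; $e_i(w)=0$ if no $i$-unpaired letter is in $\{(i+1)',i+1\}$, else subtract 1 from the first such letter; $f_i(w)=0$ if no $i$-unpaired letter is in $\{i',i\}$, else add 1 to the last such letter. $e_0(w)=0$ if $w$ has no $1'$ or a $1$ occurs before the first $1'$, else change the first $1'$ to $1$; $f_0(w)=0$ if $w$ has no $1$ or a $1'$ occurs before the first $1$, else change the first $1$ to $1'$. $e_{\overline1}$: let $j,k$ be minimal with $w_j\in\{2',2\}$, $w_k\in\{1',1\}$; if $j$ does not exist or $j>k$ then $e_{\overline1}(w)=0$; if $j$ exists and $k$ does not, subtract 1 from $w_j$; otherwise replace $w_j$ by $w_k$ and $w_k$ by $w_j-1$. $f_{\overline1}$: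 let $j<k$ be the two smallest indices with $w_j,w_k\in\{1',1\}$; if $j$ does not exist or some letter before position $j$ lies in $\{2',2\}$ then $f_{\overline1}(w)=0$; if $j$ exists and $k$ does not, add 1 to $w_j$; otherwise replace $w_j$ by $w_k+1$ and $w_k$ by $w_j$. The set of such words of length $m$ with these maps is the $\mathfrak q^+_n$-crystal $(\mathbb B^+_n)^{\otimes m}$; the subset of unprimed words with $\mathsf{wt}$ and $e_i,f_i$ ($i\in\{\overline1,1,\dots,n-1\}$) is the $\mathfrak q_n$-crystal $\mathbb B_n^{\otimes m}$. Decomposition tableaux. For a strict partition $\lambda=(\lambda_1>\dots>\lambda_\ell>0)$, $\ell(\lambda)=\ell$, $|\lambda|=\sum\lambda_i$, the shifted diagram is $\{(i,i+j-1):i\in[\ell],j\in[\lambda_i]\}$; row $i$ consists of the boxes $(i,\cdot)$. A shifted tableau of shape $\lambda$ assigns a primed number to each box. A hook word is a sequence of positive integers $w_1\cdots w_k$ with $w_1\ge\dots\ge w_p<w_{p+1}<\dots<w_k$ for some $p\in[k]$; $w_1\cdots w_p$ is its weakly decreasing part, $w_{p+1}\cdots w_k$ its increasing part, and $w_p$ its middle element. A decomposition tableau of shape $\lambda$ is a shifted tableau with positive integer entries whose rows $\rho_i$ (read left to right) are hook words, with $\rho_i$ a hook subword of maximal length in $\rho_{i+1}\rho_i$ for each $i\in[\ell-1]$. A primed decomposition tableau is obtained from a decomposition tableau by adding a prime to the middle element in some subset of rows. $\textsf{DecTab}_n(\lambda)$ and $\textsf{DecTab}^+_n(\lambda)$ are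 the sets of decomposition tableaux and primed decomposition tableaux of shape $\lambda$ with all entries in $\{1'<1<\dots<n'<n\}$. $\mathsf{revrow}(T)$ is the word reading row 1 from right to left, then row 2 from right to left, and so on. -}

module Defs where

open import Data.Nat using (ℕ; zero; suc; _+_; _∸_; _≤_; _<_; _>_; _≥_; _≡ᵇ_; _<ᵇ_)
open import Data.Integer using (ℤ; +_; -_) renaming (_+_ to _+ℤ_)
open import Data.Fin using (Fin; toℕ)
open import Data.Bool using (Bool; true; false; if_then_else_; _∧_; not)
open import Data.List using (List; []; _∷_; _++_; _∷ʳ_; map; reverse; concat; length)
open import Data.List.Relation.Unary.All using (All)
open import Data.List.Relation.Unary.Linked using (Linked)
open import Data.List.Relation.Binary.Pointwise using (Pointwise; []; _∷_)
open import Data.List.Relation.Binary.Sublist.Propositional using (_⊆_)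
open import Data.Maybe using (Maybe; just; nothing; is-just; _>>=_)
open import Data.Product using (Σ; _×_; _,_; proj₁; proj₂; ∃)
open import Data.Sum using (_⊎_; inj₁)
open import Function using (_∘_)
open import Relation.Binary.PropositionalEquality using (_≡_; refl)

-- Primed letters.  pl i false = i,  pl i true = i'  (i' = i - 1/2).
-- Order 1' < 1 < 2' < 2 < ... ; adding/subtracting 1 keeps prime status.

record PLetter : Set where
  constructor pl
  field
    num    : ℕ
    primed : Bool
open PLetter public

unp : ℕ → PLetter
unp i = pl i false

incr : PLetter → PLetter
incr (pl k p) = pl (suc k) p

decr : PLetter → PLetter
decr (pl k p) = pl (k ∸ 1) p

Word : Set
Word = List PLetter

inBlock : ℕ → PLetter → Bool
inBlock i x = num x ≡ᵇ i

-- Weights.  Weights live in ℤ^n = Fin n → ℤ;  coordinate j (0-based)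
-- is the coordinate  j+1  of the paper.

Wt : ℕ → Set
Wt n = Fin n → ℤ

δ : ℕ → ℕ → ℤ
δ a b = if a ≡ᵇ b then + 1 else + 0

-- the vector  e_i - e_{i+1}  (i is 1-based as in the paper)
simpleRoot : (n : ℕ) → ℕ → Wt n
simpleRoot n i j = δ (suc (toℕ j)) i +ℤ (- δ (suc (toℕ j)) (suc i))

count : (PLetter → Bool) → Word → ℕ
count p [] = 0
count p (x ∷ w) = if p x then suc (count p w) else count p w

wtW : (n : ℕ) → Word → Wt n
wtW n w j = + count (inBlock (suc (toℕ j))) w

-- Crystal operators on words  (the q^+_n-crystal (B^+_n)^{⊗m}).

data Br : Set where
  opn cls nb : Br

br : ℕ → PLetter → Br
br i x = if num x ≡ᵇ i then cls else (if num x ≡ᵇ suc i then opn else nb)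

-- Usual parenthesis matching.  A ")" is unpaired iff, scanning left to
-- right, no earlier "(" is still pending; a "(" is unpaired iff, scanning
-- right to left, no later ")" is still pending.  (The usual matching is
-- independent of the scanning direction.)
clsFlags : ℕ → List Br → List Bool
clsFlags c [] = []
clsFlags c (opn ∷ bs) = false ∷ clsFlags (suc c) bs
clsFlags zero (cls ∷ bs) = true ∷ clsFlags zero bs
clsFlags (suc c) (cls ∷ bs) = false ∷ clsFlags c bs
clsFlags c (nb ∷ bs) = false ∷ clsFlags c bs

opnFlagsR : ℕ → List Br → List Bool
opnFlagsR c [] = []
opnFlagsR c (cls ∷ bs) = false ∷ opnFlagsR (suc c) bs
opnFlagsR zero (opn ∷ bs) = true ∷ opnFlagsR zero bs
opnFlagsR (suc c) (opn ∷ bs) = false ∷ opnFlagsR c bs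
opnFlagsR c (nb ∷ bs) = false ∷ opnFlagsR c bs

unpairedCls : ℕ → Word → List Bool
unpairedCls i w = clsFlags 0 (map (br i) w)

unpairedOpn : ℕ → Word → List Bool
unpairedOpn i w = reverse (opnFlagsR 0 (reverse (map (br i) w)))

zipB : Word → List Bool → List (PLetter × Bool)
zipB [] _ = []
zipB (x ∷ w) [] = (x , false) ∷ zipB w []
zipB (x ∷ w) (b ∷ bs) = (x , b) ∷ zipB w bs

applyFirst : (PLetter → PLetter) → List (PLetter × Bool) → Maybe Word
applyFirst g [] = nothing
applyFirst g ((x , true) ∷ r) = just (g x ∷ map proj₁ r)
applyFirst g ((x , false) ∷ r) = Data.Maybe.map (x ∷_) (applyFirst g r)

applyLast : (PLetter → PLetter) → List (PLetter × Bool) → Maybe Word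
applyLast g l = Data.Maybe.map reverse (applyFirst g (reverse l))

eW : ℕ → Word → Maybe Word
eW i w = applyFirst decr (zipB w (unpairedOpn i w))

fW : ℕ → Word → Maybe Word
fW i w = applyLast incr (zipB w (unpairedCls i w))

is1' is1 : PLetter → Bool
is1' x = (num x ≡ᵇ 1) ∧ primed x
is1  x = (num x ≡ᵇ 1) ∧ not (primed x)

e0W : Word → Maybe Word
e0W [] = nothing
e0W (x ∷ w) = if is1' x then just (unp 1 ∷ w)
              else (if is1 x then nothing else Data.Maybe.map (x ∷_) (e0W w))

f0W : Word → Maybe Word
f0W [] = nothing
f0W (x ∷ w) = if is1 x then just (pl 1 true ∷ w)
              else (if is1' x then nothing else Data.Maybe.map (x ∷_) (f0W w))

replaceFirst1 : PLetter → Word → Maybe (PLetter × Word)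
replaceFirst1 y [] = nothing
replaceFirst1 y (x ∷ w) = if inBlock 1 x then just (x , y ∷ w)
  else Data.Maybe.map (λ p → proj₁ p , x ∷ proj₂ p) (replaceFirst1 y w)

-- e_{1bar}: j = first position in {2',2}, k = first position in {1',1}.
-- 0 if j does not exist or j > k; if k does not exist subtract 1 from w_j;
-- otherwise w_j := w_k, w_k := w_j - 1.
ebarW : Word → Maybe Word
ebarW [] = nothing
ebarW (x ∷ w) with inBlock 1 x | inBlock 2 x
... | true  | _     = nothing
... | false | true  with replaceFirst1 (decr x) w
...   | nothing       = just (decr x ∷ w)
...   | just (y , w') = just (y ∷ w')
ebarW (x ∷ w) | false | false = Data.Maybe.map (x ∷_) (ebarW w)

-- f_{1bar}: j < k the two first positions in {1',1}.  0 if j does not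
-- exist or a letter in {2',2} occurs before j; if k does not exist add 1
-- to w_j; otherwise w_j := w_k + 1, w_k := w_j.
fbarW : Word → Maybe Word
fbarW [] = nothing
fbarW (x ∷ w) with inBlock 2 x | inBlock 1 x
... | true  | _     = nothing
... | false | true  with replaceFirst1 x w
...   | nothing       = just (incr x ∷ w)
...   | just (y , w') = just (incr y ∷ w')
fbarW (x ∷ w) | false | false = Data.Maybe.map (x ∷_) (fbarW w)

-- Abstract crystals.  Operators are maps B → Maybe B (nothing = 0).
-- Indices i ∈ [n-1] are natural numbers with 1 ≤ i < n; the values of
-- e, f at other naturals are irrelevant (never constrained/compared).

record QStr (n : ℕ) (B : Set) : Set where
  field
    wt   : B → Wt n
    e f  : ℕ → B → Maybe B
    ebar fbar : B → Maybe B

record QPlusStr (n : ℕ) (B : Set) : Set where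
  field
    q     : QStr n B
    e0 f0 : B → Maybe B
  open QStr q public

module _ {B : Set} where

  iter : ℕ → (B → Maybe B) → B → Maybe B
  iter zero g b = just b
  iter (suc k) g b = iter k g b >>= g

  -- "ε_g(b) ≥ k", i.e. g^k(b) ≠ 0.  So ε_g(b) = sup {k : Reaches g b k}.
  Reaches : (B → Maybe B) → B → ℕ → Set
  Reaches g b k = is-just (iter k g b) ≡ true

  -- ε_g(b) = ε_g(c)  (as elements of ℕ ∪ {∞})
  SameString : (B → Maybe B) → B → B → Set
  SameString g b c = ∀ k → is-just (iter k g b) ≡ is-just (iter k g c)

  -- ε_g(b) + ε_h(b) ≤ N  (sups in ℕ ∪ {∞})
  SumLe : (B → Maybe B) → (B → Maybe B) → B → ℕ → Set
  SumLe g h b N = ∀ k l → Reaches g b k → Reaches h b l → k + l ≤ N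

  PreservesStr : (B → Maybe B) → (B → Maybe B) → Set
  PreservesStr φ g = ∀ b c → φ b ≡ just c → SameString g c b

  Preserves : {A : Set} → (B → Maybe B) → (B → A) → Set
  Preserves φ η = ∀ b c → φ b ≡ just c → η c ≡ η b

  Commute : (B → Maybe B) → (B → Maybe B) → Set
  Commute φ ψ = ∀ b → (ψ b >>= φ) ≡ (φ b >>= ψ)

  Inverse : (B → Maybe B) → (B → Maybe B) → Set
  Inverse e f = ∀ b c → (e b ≡ just c → f c ≡ just b) × (f c ≡ just b → e b ≡ just c)

  WtShift : {n : ℕ} → (B → Wt n) → (B → Maybe B) → Wt n → Set
  WtShift wt e α = ∀ b c → e b ≡ just c → ∀ j → wt c j ≡ wt b j +ℤ α j

ValidIdx : ℕ → ℕ → Set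
ValidIdx n i = 1 ≤ i × i < n

IsGlCrystal : {n : ℕ} {B : Set} → QStr n B → Set
IsGlCrystal {n} S =
  ∀ i → ValidIdx n i → Inverse (e i) (f i) × WtShift wt (e i) (simpleRoot n i)
  where open QStr S

IsQCrystal : {n : ℕ} {B : Set} → QStr n B → Set
IsQCrystal {n} S =
  IsGlCrystal S
  × (∀ i → 3 ≤ i → i < n →
       Commute ebar (e i) × Commute ebar (f i) × Commute fbar (e i) × Commute fbar (f i)
       × PreservesStr ebar (e i) × PreservesStr ebar (f i)
       × PreservesStr fbar (e i) × PreservesStr fbar (f i))
  × Inverse ebar fbar × WtShift wt ebar (simpleRoot n 1)
  where open QStr S

IsQPlusCrystal : {n : ℕ} {B : Set} → QPlusStr n B → Set
IsQPlusCrystal {n} S =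
  IsQCrystal q
  × (∀ i → 2 ≤ i → i < n →
       Commute e0 (e i) × Commute e0 (f i) × Commute f0 (e i) × Commute f0 (f i))
  × Preserves e0 wt × Preserves f0 wt
  × (∀ i → ValidIdx n i →
       PreservesStr e0 (e i) × PreservesStr e0 (f i)
       × PreservesStr f0 (e i) × PreservesStr f0 (f i))
  × PreservesStr e0 ebar × PreservesStr e0 fbar
  × PreservesStr f0 ebar × PreservesStr f0 fbar
  × Inverse e0 f0
  × (∀ b → SumLe e0 f0 b 1)
  × (∀ b → SumLe ebar fbar b 0 → SumLe e0 f0 b 0)
  where open QPlusStr S

-- Crystal embeddings into words (the target crystal is the word crystal
-- with the operators eW, fW, ebarW, fbarW, e0W, f0W, wtW above).

Injective : {A C : Set} → (A → C) → Set
Injective φ = ∀ a b → φ a ≡ φ b → a ≡ b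

IsQEmbedding : {n : ℕ} {B : Set} → QStr n B → (B → Word) → Set
IsQEmbedding {n} S φ =
  (∀ b j → wtW n (φ b) j ≡ wt b j)
  × Injective φ
  × (∀ i → ValidIdx n i → ∀ b →
       Data.Maybe.map φ (e i b) ≡ eW i (φ b) × Data.Maybe.map φ (f i b) ≡ fW i (φ b))
  × (∀ b → Data.Maybe.map φ (ebar b) ≡ ebarW (φ b))
  × (∀ b → Data.Maybe.map φ (fbar b) ≡ fbarW (φ b))
  where open QStr S

IsQPlusEmbedding : {n : ℕ} {B : Set} → QPlusStr n B → (B → Word) → Set
IsQPlusEmbedding S φ =
  IsQEmbedding q φ
  × (∀ b → Data.Maybe.map φ (e0 b) ≡ e0W (φ b))
  × (∀ b → Data.Maybe.map φ (f0 b) ≡ f0W (φ b))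
  where open QPlusStr S

SameQPlus : {n : ℕ} {B : Set} → QPlusStr n B → QPlusStr n B → Set
SameQPlus {n} S T =
  (∀ b j → S.wt b j ≡ T.wt b j)
  × (∀ i → ValidIdx n i → ∀ b → S.e i b ≡ T.e i b × S.f i b ≡ T.f i b)
  × (∀ b → S.ebar b ≡ T.ebar b) × (∀ b → S.fbar b ≡ T.fbar b)
  × (∀ b → S.e0 b ≡ T.e0 b) × (∀ b → S.f0 b ≡ T.f0 b)
  where
    module S = QPlusStr S
    module T = QPlusStr T

-- the q_n-structure S₀ on A is the restriction of S along ι : A → B
-- (so in particular the operators of S send ι(A) into ι(A) ⊔ {0})
Restricts : {n : ℕ} {A B : Set} → QPlusStr n B → (A → B) → QStr n A → Set
Restricts {n} S ι S₀ =
  (∀ a j → S₀.wt a j ≡ S.wt (ι a) j)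
  × (∀ i → ValidIdx n i → ∀ a →
       Data.Maybe.map ι (S₀.e i a) ≡ S.e i (ι a) × Data.Maybe.map ι (S₀.f i a) ≡ S.f i (ι a))
  × (∀ a → Data.Maybe.map ι (S₀.ebar a) ≡ S.ebar (ι a))
  × (∀ a → Data.Maybe.map ι (S₀.fbar a) ≡ S.fbar (ι a))
  where
    module S = QPlusStr S
    module S₀ = QStr S₀

StrictPartition : List ℕ → Set
StrictPartition la = Linked _>_ la × All (λ k → 1 ≤ k) la

-- hook word: w₁ ≥ ... ≥ w_p < w_{p+1} < ... < w_k  (k ≥ 1), written
-- w = u ++ m ∷ v with m = w_p the middle element
IsHookSplit : List ℕ → List ℕ → ℕ → List ℕ → Set
IsHookSplit w u m v = w ≡ u ++ (m ∷ v) × Linked _≥_ (u ∷ʳ m) × Linked _<_ (m ∷ v)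

IsHook : List ℕ → Set
IsHook w = Σ (List ℕ) λ u → Σ ℕ λ m → Σ (List ℕ) λ v → IsHookSplit w u m v

MaxHookSubword : List ℕ → List ℕ → Set
MaxHookSubword ρ σ = ρ ⊆ σ × IsHook ρ × (∀ u → u ⊆ σ → IsHook u → length u ≤ length ρ)

RowCond : List ℕ → List ℕ → Set
RowCond ρi ρi+1 = MaxHookSubword ρi (ρi+1 ++ ρi)

InRange : ℕ → ℕ → Set
InRange n k = 1 ≤ k × k ≤ n

-- a shifted tableau of shape λ is represented by its list of rows
-- (row 1 first), each read left to right
IsDecTab : ℕ → List ℕ → List (List ℕ) → Set
IsDecTab n la rows =
  map length rows ≡ la
  × All (All (InRange n)) rows
  × All IsHook rows
  × Linked RowCond rows

PrimeRow : List ℕ → List PLetter → Set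
PrimeRow ρ r =
  r ≡ map unp ρ
  ⊎ Σ (List ℕ) λ u → Σ ℕ λ m → Σ (List ℕ) λ v →
      IsHookSplit ρ u m v × r ≡ map unp u ++ (pl m true ∷ map unp v)

IsDecTabPlus : ℕ → List ℕ → List (List PLetter) → Set
IsDecTabPlus n la rows =
  Σ (List (List ℕ)) λ D → IsDecTab n la D × Pointwise PrimeRow D rows

-- DecTab_n(λ) and DecTab^+_n(λ); the validity proof is irrelevant, so
-- two elements are equal iff their rows are equal.
record DecTab (n : ℕ) (la : List ℕ) : Set where
  constructor dt
  field
    rows   : List (List ℕ)
    .valid : IsDecTab n la rows

record DecTabPlus (n : ℕ) (la : List ℕ) : Set where
  constructor dtp
  field
    rows   : List (List PLetter)
    .valid : IsDecTabPlus n la rows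

unprimedRows : (D : List (List ℕ)) → Pointwise PrimeRow D (map (map unp) D)
unprimedRows [] = []
unprimedRows (ρ ∷ D) = inj₁ refl ∷ unprimedRows D

inclDT : {n : ℕ} {la : List ℕ} → DecTab n la → DecTabPlus n la
inclDT (dt rows v) = dtp (map (map unp) rows) (rows , v , unprimedRows rows)

revrow : {n : ℕ} {la : List ℕ} → DecTabPlus n la → Word
revrow T = concat (map reverse (DecTabPlus.rows T))

{-# OPTIONS --safe #-}
module Submission where

-- An operator e_i, f_i, e_1bar or f_1bar changes the numbers of a word in one
-- letter, from i to i + 1 or back, and this does not change the maximal length
-- of a hook subword (of the word read from right to left): a hook subword
-- through the changed letter is repaired by trading some of its letters i and
-- i + 1 for others that bracket matching provides.  The change restricts to a
-- change of the same kind on every factor, so applying this to single rows and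
-- to pairs of consecutive rows shows that the operators preserve decomposition
-- tableaux.  Read backwards, the middle element of a row is the first
-- occurrence of its minimum, and primes stay there.  All crystal axioms are
-- inherited from words along the injective map revrow.

open import Defs
open import Data.Bool using (Bool; true; false; if_then_else_)
open import Data.Empty using (⊥; ⊥-elim)
open import Data.Fin using (toℕ)
open import Data.Integer using (+_; -_) renaming (_+_ to _+ℤ_)
import Data.Integer.Properties as ℤₚ
open import Data.List using (List; []; _∷_; _++_; _∷ʳ_; map; reverse; length; foldl; replicate; take; drop; concat)
import Data.List.Properties as Lₚ
open import Data.List.Relation.Binary.Permutation.Propositional using (↭-sym)
open import Data.List.Relation.Binary.Permutation.Propositional.Properties using (All-resp-↭; ↭-reverse)
open import Data.List.Relation.Binary.Pointwise as PW using (Pointwise; []; _∷_)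
import Data.List.Relation.Binary.Sublist.Heterogeneous.Properties as HSubₚ
open import Data.List.Relation.Binary.Sublist.Propositional using (_⊆_; []; _∷_; ⊆-refl; minimum) renaming (_∷ʳ_ to _∷ˢ_)
import Data.List.Relation.Binary.Sublist.Propositional.Properties as Subₚ
open import Data.List.Relation.Unary.All as All using (All; []; _∷_)
import Data.List.Relation.Unary.All.Properties as Allₚ
open import Data.List.Relation.Unary.AllPairs using (AllPairs; []; _∷_)
open import Data.List.Relation.Unary.Any using (Any; here; there)
open import Data.List.Relation.Unary.Linked as Linked using (Linked; []; [-]; _∷_)
import Data.List.Relation.Unary.Linked.Properties as Linkedₚ
import Data.Maybe as Maybe
open import Data.Maybe using (Maybe; just; nothing; is-just; _>>=_)
import Data.Maybe.Properties as Maybeₚ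
import Data.Maybe.Relation.Binary.Pointwise as MP
open import Data.Nat using (ℕ; zero; suc; _+_; _∸_; _≤_; _<_; _≥_; _⊔_; z≤n; s≤s; _≡ᵇ_; _≟_; _≤?_; _<?_)
open import Data.Nat.ListAction using (sum)
import Data.Nat.Properties as ℕₚ
open import Data.Product using (Σ; _×_; _,_; proj₁; proj₂; ∃-syntax)
open import Data.Sum using (_⊎_; inj₁; inj₂)
open import Data.Unit using (⊤; tt)
open import Function using (_∘_; _⇔_; mk⇔; Equivalence)
open import Relation.Binary.Definitions using (Symmetric)
open import Relation.Binary.PropositionalEquality hiding (J)
open import Relation.Nullary using (¬_; Dec; yes; no; contradiction; recompute)
open import Relation.Nullary.Decidable using (_×-dec_)

-- Bracket matching

-- The obstacle is the maximality in `RowCond`: it concerns all hook subwords of two rows at once,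
-- so following a single hook through an operator is not enough. Hook subwords are therefore carried
-- in both directions. Forwards, each changed row stays a hook; backwards, every hook subword of the
-- new pair comes from one at least as long in the old pair. The pair that `RowCond` looks at, lower
-- row followed by upper row, is exactly the segment of the two rows in `revrow` read backwards, so
-- it is again a factor on which the operator acts. The letters available for trading come from
-- ballot conditions. In the row direction, every suffix of the part before the changed letter has
-- at least as many letters i + 1 as i, and every prefix of the part after it has at least as many i
-- as i + 1. The second difficulty is that f_1bar may change letters in two different rows and
-- exchange their primes. The relation followed through factors thus has to contain the two halves
-- of such a step, which are not themselves values of f_1bar.

next : ℕ → Br → ℕ
next c opn = suc c
next c cls = c ∸ 1
next c nb  = c

pending : ℕ → List Br → ℕ
pending = foldl next

AllMatched : ℕ → List Br → Set
AllMatched c       []         = ⊤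
AllMatched c       (opn ∷ bs) = AllMatched (suc c) bs
AllMatched zero    (cls ∷ bs) = ⊥
AllMatched (suc c) (cls ∷ bs) = AllMatched c bs
AllMatched c       (nb ∷ bs)  = AllMatched c bs

swap : Br → Br
swap opn = cls
swap cls = opn
swap nb  = nb

swap-involutive : ∀ bs → map swap (map swap bs) ≡ bs
swap-involutive []         = refl
swap-involutive (opn ∷ bs) = cong (opn ∷_) (swap-involutive bs)
swap-involutive (cls ∷ bs) = cong (cls ∷_) (swap-involutive bs)
swap-involutive (nb ∷ bs)  = cong (nb ∷_) (swap-involutive bs)

opnFlagsR≡clsFlags : ∀ c bs → opnFlagsR c bs ≡ clsFlags c (map swap bs)
opnFlagsR≡clsFlags c       []         = refl
opnFlagsR≡clsFlags zero    (opn ∷ bs) = cong (true ∷_) (opnFlagsR≡clsFlags zero bs)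
opnFlagsR≡clsFlags (suc c) (opn ∷ bs) = cong (false ∷_) (opnFlagsR≡clsFlags c bs)
opnFlagsR≡clsFlags c       (cls ∷ bs) = cong (false ∷_) (opnFlagsR≡clsFlags (suc c) bs)
opnFlagsR≡clsFlags c       (nb ∷ bs)  = cong (false ∷_) (opnFlagsR≡clsFlags c bs)

length-clsFlags : ∀ c bs → length (clsFlags c bs) ≡ length bs
length-clsFlags c       []         = refl
length-clsFlags c       (opn ∷ bs) = cong suc (length-clsFlags (suc c) bs)
length-clsFlags zero    (cls ∷ bs) = cong suc (length-clsFlags zero bs)
length-clsFlags (suc c) (cls ∷ bs) = cong suc (length-clsFlags c bs)
length-clsFlags c       (nb ∷ bs)  = cong suc (length-clsFlags c bs)

pending-reverse-∷ : ∀ b r → pending 0 (reverse (b ∷ r)) ≡ next (pending 0 (reverse r)) b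
pending-reverse-∷ b r =
  trans (cong (pending 0) (Lₚ.unfold-reverse b r)) (Lₚ.foldl-++ next 0 (reverse r) (b ∷ []))

-- The head of `r` is the last bracket of `reverse r`, so reading `r` forwards with roles exchanged
-- undoes the scan of `reverse r` one bracket at a time. This is the independence of the matching
-- from the scanning direction, and it puts e_i and f_i on the same footing.
allMatched-mirror : ∀ k r → AllMatched k (map swap r) ⇔ (pending 0 (reverse r) ≤ k)
allMatched-mirror k r = mk⇔ (to k r) (from k r)
  where
  to : ∀ k r → AllMatched k (map swap r) → pending 0 (reverse r) ≤ k
  to k [] _ = z≤n
  to (suc k) (opn ∷ r) m rewrite pending-reverse-∷ opn r = s≤s (to k r m)
  to k (cls ∷ r) m rewrite pending-reverse-∷ cls r = ℕₚ.∸-monoˡ-≤ 1 (to (suc k) r m)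
  to k (nb ∷ r) m rewrite pending-reverse-∷ nb r = to k r m
  from : ∀ k r → pending 0 (reverse r) ≤ k → AllMatched k (map swap r)
  from k [] _ = tt
  from k (opn ∷ r) le rewrite pending-reverse-∷ opn r with k | le
  ... | suc k' | s≤s le' = from k' r le'
  from k (cls ∷ r) le rewrite pending-reverse-∷ cls r =
    from (suc k) r (ℕₚ.≤-trans (ℕₚ.m≤n+m∸n _ 1) (s≤s le))
  from k (nb ∷ r) le rewrite pending-reverse-∷ nb r = from k r le

-- The rightmost unpaired closing bracket

zipB-proj₁ : ∀ w F → map proj₁ (zipB w F) ≡ w
zipB-proj₁ []      F       = refl
zipB-proj₁ (x ∷ w) []      = cong (x ∷_) (zipB-proj₁ w [])
zipB-proj₁ (x ∷ w) (b ∷ F) = cong (x ∷_) (zipB-proj₁ w F)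

zipB-∷ʳ : ∀ w F x b → length F ≡ length w → zipB (w ∷ʳ x) (F ∷ʳ b) ≡ zipB w F ∷ʳ (x , b)
zipB-∷ʳ []      []      x b _ = refl
zipB-∷ʳ (y ∷ w) (c ∷ F) x b p = cong ((y , c) ∷_) (zipB-∷ʳ w F x b (ℕₚ.suc-injective p))

zipB-reverse : ∀ w F → length F ≡ length w → zipB (reverse w) (reverse F) ≡ reverse (zipB w F)
zipB-reverse []      []      _ = refl
zipB-reverse (x ∷ w) (b ∷ F) p
  rewrite Lₚ.unfold-reverse x w | Lₚ.unfold-reverse b F | Lₚ.unfold-reverse (x , b) (zipB w F)
  = trans (zipB-∷ʳ (reverse w) (reverse F) x b
            (trans (Lₚ.length-reverse F) (trans (ℕₚ.suc-injective p) (sym (Lₚ.length-reverse w)))))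
          (cong (_∷ʳ (x , b)) (zipB-reverse w F (ℕₚ.suc-injective p)))

module _ (g : PLetter → PLetter) where

  applyFirst-∷ʳ-just : ∀ l x b {v} → applyFirst g l ≡ just v →
                       applyFirst g (l ∷ʳ (x , b)) ≡ just (v ∷ʳ x)
  applyFirst-∷ʳ-just ((y , true) ∷ l) x b refl = cong (just ∘ (g y ∷_)) (Lₚ.map-++ proj₁ l ((x , b) ∷ []))
  applyFirst-∷ʳ-just ((y , false) ∷ l) x b eq with applyFirst g l in h
  applyFirst-∷ʳ-just ((y , false) ∷ l) x b refl | just u = cong (Maybe.map (y ∷_)) (applyFirst-∷ʳ-just l x b h)

  applyFirst-∷ʳ-true : ∀ l x → applyFirst g l ≡ nothing →
                       applyFirst g (l ∷ʳ (x , true)) ≡ just (map proj₁ l ∷ʳ g x)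
  applyFirst-∷ʳ-true [] x _ = refl
  applyFirst-∷ʳ-true ((y , false) ∷ l) x eq with applyFirst g l in h
  ... | nothing = cong (Maybe.map (y ∷_)) (applyFirst-∷ʳ-true l x h)

  applyFirst-∷ʳ-false : ∀ l x → applyFirst g l ≡ nothing → applyFirst g (l ∷ʳ (x , false)) ≡ nothing
  applyFirst-∷ʳ-false [] x _ = refl
  applyFirst-∷ʳ-false ((y , false) ∷ l) x eq with applyFirst g l in h
  ... | nothing = cong (Maybe.map (y ∷_)) (applyFirst-∷ʳ-false l x h)

  applyLast-just : ∀ l x b {v} → applyLast g l ≡ just v → applyLast g ((x , b) ∷ l) ≡ just (x ∷ v)
  applyLast-just l x b eq with applyFirst g (reverse l) in h
  applyLast-just l x b refl | just u
    rewrite Lₚ.unfold-reverse (x , b) l | applyFirst-∷ʳ-just (reverse l) x b h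
    = cong just (Lₚ.reverse-++ u (x ∷ []))

  applyLast-true : ∀ l x → applyLast g l ≡ nothing →
                   applyLast g ((x , true) ∷ l) ≡ just (g x ∷ map proj₁ l)
  applyLast-true l x eq with applyFirst g (reverse l) in h
  ... | nothing
    rewrite Lₚ.unfold-reverse (x , true) l | applyFirst-∷ʳ-true (reverse l) x h
          | Lₚ.reverse-map proj₁ l
    = cong just (trans (Lₚ.reverse-++ (reverse (map proj₁ l)) (g x ∷ []))
                       (cong (g x ∷_) (Lₚ.reverse-involutive (map proj₁ l))))

  applyLast-false : ∀ l x → applyLast g l ≡ nothing → applyLast g ((x , false) ∷ l) ≡ nothing
  applyLast-false l x eq with applyFirst g (reverse l) in h
  ... | nothing
    rewrite Lₚ.unfold-reverse (x , false) l | applyFirst-∷ʳ-false (reverse l) x h = refl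

  applyFirst≡reverse-applyLast : ∀ l → applyFirst g (reverse l) ≡ Maybe.map reverse (applyLast g l)
  applyFirst≡reverse-applyLast l with applyFirst g (reverse l)
  ... | nothing = refl
  ... | just u  = cong just (sym (Lₚ.reverse-involutive u))

  -- Stated for any classification `cl` since it is used twice: f_i is the instance `incr`, `br i`,
  -- and e_i is the instance `decr`, `swap ∘ br i` on the reversed word.
  module Scan (cl : PLetter → Br) where

    pairs : ℕ → Word → List (PLetter × Bool)
    pairs c w = zipB w (clsFlags c (map cl w))

    scan : ℕ → Word → Maybe Word
    scan c w = applyLast g (pairs c w)

    scan-nothing : ∀ c w → AllMatched c (map cl w) → scan c w ≡ nothing
    scan-nothing c [] _ = refl
    scan-nothing c (x ∷ w) m with cl x
    scan-nothing c (x ∷ w) m       | opn = applyLast-false (pairs (suc c) w) x (scan-nothing (suc c) w m)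
    scan-nothing (suc c) (x ∷ w) m | cls = applyLast-false (pairs c w) x (scan-nothing c w m)
    scan-nothing c (x ∷ w) m       | nb  = applyLast-false (pairs c w) x (scan-nothing c w m)

    scan-just : ∀ c a x b → pending c (map cl a) ≡ 0 → cl x ≡ cls → AllMatched 0 (map cl b) →
                scan c (a ++ x ∷ b) ≡ just (a ++ g x ∷ b)
    scan-just .0 [] x b refl h m rewrite h =
      trans (applyLast-true (pairs 0 b) x (scan-nothing 0 b m))
            (cong (just ∘ (g x ∷_)) (zipB-proj₁ b _))
    scan-just c (y ∷ a) x b p h m with cl y
    ... | opn = applyLast-just (pairs (suc c) (a ++ x ∷ b)) y false (scan-just (suc c) a x b p h m)
    ... | nb  = applyLast-just (pairs c (a ++ x ∷ b)) y false (scan-just c a x b p h m)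
    scan-just zero    (y ∷ a) x b p h m | cls = applyLast-just (pairs 0 (a ++ x ∷ b)) y true (scan-just 0 a x b p h m)
    scan-just (suc c) (y ∷ a) x b p h m | cls = applyLast-just (pairs c (a ++ x ∷ b)) y false (scan-just c a x b p h m)

    RightmostUnpaired : ℕ → Word → Set
    RightmostUnpaired c w = ∃[ a ] ∃[ x ] ∃[ b ]
      (w ≡ a ++ x ∷ b × pending c (map cl a) ≡ 0 × cl x ≡ cls × AllMatched 0 (map cl b))

    -- The tail is searched first, so the bracket found is the rightmost; the head is a candidate
    -- only once all closing brackets of the tail are known to be matched.
    rightmostUnpaired? : ∀ c w → AllMatched c (map cl w) ⊎ RightmostUnpaired c w
    rightmostUnpaired? c [] = inj₁ tt
    rightmostUnpaired? c (y ∷ w) with rightmostUnpaired? (next c (cl y)) w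
    ... | inj₂ (a , x , b , refl , p , h , m) = inj₂ (y ∷ a , x , b , refl , p , h , m)
    ... | inj₁ m with cl y in h
    ... | opn = inj₁ m
    ... | nb  = inj₁ m
    rightmostUnpaired? zero    (y ∷ w) | inj₁ m | cls = inj₂ ([] , y , w , refl , refl , h , m)
    rightmostUnpaired? (suc c) (y ∷ w) | inj₁ m | cls = inj₁ m

    scan-inv : ∀ c w {w'} → scan c w ≡ just w' → ∃[ a ] ∃[ x ] ∃[ b ]
      (w ≡ a ++ x ∷ b × w' ≡ a ++ g x ∷ b
       × pending c (map cl a) ≡ 0 × cl x ≡ cls × AllMatched 0 (map cl b))
    scan-inv c w eq with rightmostUnpaired? c w
    ... | inj₁ m = contradiction (trans (sym (scan-nothing c w m)) eq) λ ()
    ... | inj₂ (a , x , b , refl , p , h , m)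
      with trans (sym (scan-just c a x b p h m)) eq
    ... | refl = a , x , b , refl , refl , p , h , m

-- The operators e_i and f_i

-- Flip i w v: f_i w = v.  The changed letter is the last unpaired closing
-- bracket since a leaves no opening bracket pending and every closing bracket
-- of b is matched inside b.
data Flip (i : ℕ) : Word → Word → Set where
  flip : ∀ a p b → pending 0 (map (br i) a) ≡ 0 → AllMatched 0 (map (br i) b) →
         Flip i (a ++ pl i p ∷ b) (a ++ pl (suc i) p ∷ b)

≡ᵇ-refl : ∀ k → (k ≡ᵇ k) ≡ true
≡ᵇ-refl zero    = refl
≡ᵇ-refl (suc k) = ≡ᵇ-refl k

≡ᵇ-true : ∀ k l → (k ≡ᵇ l) ≡ true → k ≡ l
≡ᵇ-true zero    zero    _ = refl
≡ᵇ-true (suc k) (suc l) p = cong suc (≡ᵇ-true k l p)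

≢⇒≡ᵇ-false : ∀ k l → k ≢ l → (k ≡ᵇ l) ≡ false
≢⇒≡ᵇ-false k l k≢l with k ≡ᵇ l in h
... | false = refl
... | true  = contradiction (≡ᵇ-true k l h) k≢l

br-cls : ∀ i p → br i (pl i p) ≡ cls
br-cls i p rewrite ≡ᵇ-refl i = refl

br-opn : ∀ i p → br i (pl (suc i) p) ≡ opn
br-opn i p rewrite ≢⇒≡ᵇ-false (suc i) i ℕₚ.1+n≢n | ≡ᵇ-refl i = refl

br-nb : ∀ i x → num x ≢ i → num x ≢ suc i → br i x ≡ nb
br-nb i x h₁ h₂ rewrite ≢⇒≡ᵇ-false (num x) i h₁ | ≢⇒≡ᵇ-false (num x) (suc i) h₂ = refl

br-cls⁻¹ : ∀ i x → br i x ≡ cls → num x ≡ i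
br-cls⁻¹ i x h with num x ≡ᵇ i in e
... | true = ≡ᵇ-true _ _ e
... | false with num x ≡ᵇ suc i
br-cls⁻¹ i x () | false | true
br-cls⁻¹ i x () | false | false

br-opn⁻¹ : ∀ i x → br i x ≡ opn → num x ≡ suc i
br-opn⁻¹ i x h with num x ≡ᵇ i
br-opn⁻¹ i x () | true
... | false with num x ≡ᵇ suc i in e
... | true = ≡ᵇ-true _ _ e
br-opn⁻¹ i x () | false | false

fW⇔Flip : ∀ i w v → fW i w ≡ just v ⇔ Flip i w v
fW⇔Flip i w v = mk⇔ to from
  where
  open Scan incr (br i)
  to : fW i w ≡ just v → Flip i w v
  to eq with scan-inv 0 w eq
  ... | a , pl k p , b , refl , refl , h , hx , m with br-cls⁻¹ i (pl k p) hx
  ... | refl = flip a p b h m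
  from : Flip i w v → fW i w ≡ just v
  from (flip a p b h m) = scan-just 0 a (pl i p) b h (br-cls i p) m

reverse-middle : ∀ {A : Set} (a : List A) x b → reverse (a ++ x ∷ b) ≡ reverse b ++ x ∷ reverse a
reverse-middle a x b = begin
  reverse (a ++ x ∷ b)          ≡⟨ Lₚ.reverse-++ a (x ∷ b) ⟩
  reverse (x ∷ b) ++ reverse a  ≡⟨ cong (_++ reverse a) (Lₚ.unfold-reverse x b) ⟩
  (reverse b ∷ʳ x) ++ reverse a ≡⟨ Lₚ.∷ʳ-++ (reverse b) x (reverse a) ⟩
  reverse b ++ x ∷ reverse a    ∎
  where open ≡-Reasoning

module EScan (i : ℕ) = Scan decr (swap ∘ br i)

eW≡scan : ∀ i w → eW i w ≡ Maybe.map reverse (EScan.scan i 0 (reverse w))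
eW≡scan i w = begin
  applyFirst decr (zipB w (reverse (opnFlagsR 0 (reverse (map (br i) w)))))
    ≡⟨ cong (λ bs → applyFirst decr (zipB w (reverse bs))) flags ⟩
  applyFirst decr (zipB w (reverse F))
    ≡⟨ cong (λ u → applyFirst decr (zipB u (reverse F))) (Lₚ.reverse-involutive w) ⟨
  applyFirst decr (zipB (reverse (reverse w)) (reverse F))
    ≡⟨ cong (applyFirst decr) (zipB-reverse (reverse w) F len) ⟩
  applyFirst decr (reverse (zipB (reverse w) F))
    ≡⟨ applyFirst≡reverse-applyLast decr (zipB (reverse w) F) ⟩
  Maybe.map reverse (EScan.scan i 0 (reverse w)) ∎
  where
  open ≡-Reasoning
  F = clsFlags 0 (map (swap ∘ br i) (reverse w))
  flags : opnFlagsR 0 (reverse (map (br i) w)) ≡ F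
  flags = trans (opnFlagsR≡clsFlags 0 _)
            (cong (clsFlags 0) (trans (cong (map swap) (sym (Lₚ.reverse-map (br i) w)))
                                      (sym (Lₚ.map-∘ (reverse w)))))
  len : length F ≡ length (reverse w)
  len = trans (length-clsFlags 0 (map (swap ∘ br i) (reverse w))) (Lₚ.length-map _ (reverse w))

map-swap-br : ∀ i w → map (swap ∘ br i) w ≡ map swap (map (br i) w)
map-swap-br i w = Lₚ.map-∘ w

pending≡0⇔ : ∀ i a → pending 0 (map (br i) a) ≡ 0 ⇔ AllMatched 0 (map (swap ∘ br i) (reverse a))
pending≡0⇔ i a
  rewrite map-swap-br i (reverse a) | Lₚ.reverse-map (br i) a
  = mk⇔ (λ p → M.from (ℕₚ.≤-reflexive (trans (cong (pending 0) (Lₚ.reverse-involutive (map (br i) a))) p)))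
        (λ m → trans (cong (pending 0) (sym (Lₚ.reverse-involutive (map (br i) a)))) (ℕₚ.n≤0⇒n≡0 (M.to m)))
  where module M = Equivalence (allMatched-mirror 0 (reverse (map (br i) a)))

allMatched⇔ : ∀ i b → AllMatched 0 (map (br i) b) ⇔ pending 0 (map (swap ∘ br i) (reverse b)) ≡ 0
allMatched⇔ i b = mk⇔
  (λ m → trans (cong (pending 0) eq) (ℕₚ.n≤0⇒n≡0 (M.to (subst (AllMatched 0) (sym (swap-involutive (map (br i) b))) m))))
  (λ p → subst (AllMatched 0) (swap-involutive (map (br i) b)) (M.from (ℕₚ.≤-reflexive (trans (cong (pending 0) (sym eq)) p))))
  where
  module M = Equivalence (allMatched-mirror 0 (map swap (map (br i) b)))
  eq : map (swap ∘ br i) (reverse b) ≡ reverse (map swap (map (br i) b))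
  eq = trans (Lₚ.reverse-map _ b) (cong reverse (map-swap-br i b))

-- Reversing the word exchanges the two conditions of `Flip`: nothing pending after `a` becomes
-- everything matched in `reverse a`, and conversely for `b`. Thus e_i and f_i are the two
-- directions of one relation, and being mutually inverse needs no further argument.
eW⇔Flip : ∀ i w v → eW i v ≡ just w ⇔ Flip i w v
eW⇔Flip i w v = mk⇔ to from
  where
  open EScan i
  open Equivalence using () renaming (to to ⟶; from to ⟵)
  to : eW i v ≡ just w → Flip i w v
  to eq with scan 0 (reverse v) in h | trans (sym (eW≡scan i v)) eq
  ... | just u | refl with scan-inv 0 (reverse v) h
  ... | a , pl k p , b , eqv , refl , hp , hx , m
    with br i (pl k p) in hbr
  ... | opn with br-opn⁻¹ i (pl k p) hbr
  ... | refl = subst₂ (Flip i) (sym (reverse-middle a (pl i p) b)) eqv'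
                 (flip (reverse b) p (reverse a)
                   (⟵ (pending≡0⇔ i (reverse b)) (subst (λ z → AllMatched 0 (map (swap ∘ br i) z)) (sym (Lₚ.reverse-involutive b)) m))
                   (⟵ (allMatched⇔ i (reverse a)) (trans (cong (λ z → pending 0 (map (swap ∘ br i) z)) (Lₚ.reverse-involutive a)) hp)))
    where
    eqv' : reverse b ++ pl (suc i) p ∷ reverse a ≡ v
    eqv' = trans (sym (reverse-middle a (pl (suc i) p) b))
                 (trans (cong reverse (sym eqv)) (Lₚ.reverse-involutive v))
  from : Flip i w v → eW i v ≡ just w
  from (flip a p b h m) = begin
    eW i (a ++ pl (suc i) p ∷ b)
      ≡⟨ eW≡scan i (a ++ pl (suc i) p ∷ b) ⟩
    Maybe.map reverse (scan 0 (reverse (a ++ pl (suc i) p ∷ b)))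
      ≡⟨ cong (Maybe.map reverse ∘ scan 0) (reverse-middle a _ b) ⟩
    Maybe.map reverse (scan 0 (reverse b ++ pl (suc i) p ∷ reverse a))
      ≡⟨ cong (Maybe.map reverse)
           (scan-just 0 (reverse b) (pl (suc i) p) (reverse a) (⟶ (allMatched⇔ i b) m)
             (cong swap (br-opn i p)) (⟶ (pending≡0⇔ i a) h)) ⟩
    just (reverse (reverse b ++ pl i p ∷ reverse a))
      ≡⟨ cong just (reverse-middle (reverse b) (pl i p) (reverse a)) ⟩
    just (reverse (reverse a) ++ pl i p ∷ reverse (reverse b))
      ≡⟨ cong just (cong₂ (λ a' b' → a' ++ pl i p ∷ b') (Lₚ.reverse-involutive a) (Lₚ.reverse-involutive b)) ⟩
    just (a ++ pl i p ∷ b) ∎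
    where open ≡-Reasoning

-- The operators e_0, f_0, e_1bar and f_1bar

No1 : Word → Set
No1 = All (λ x → num x ≢ 1)

-- Rep true false is the graph of e_0 and Rep false true that of f_0.
data Rep (p q : Bool) : Word → Word → Set where
  here : ∀ {w} → Rep p q (pl 1 p ∷ w) (pl 1 q ∷ w)
  skip : ∀ {x w v} → num x ≢ 1 → Rep p q w v → Rep p q (x ∷ w) (x ∷ v)

Rep-sym : ∀ {p q w v} → Rep p q w v → Rep q p v w
Rep-sym here       = here
Rep-sym (skip h r) = skip h (Rep-sym r)

Outside12 : PLetter → Set
Outside12 x = num x ≢ 1 × num x ≢ 2

-- Bar w v: f_1bar w = v, where pair exchanges the prime statuses p and q of the
-- first two letters in {1', 1}.
data Bar : Word → Word → Set where
  lone : ∀ {p w} → No1 w → Bar (pl 1 p ∷ w) (pl 2 p ∷ w)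
  pair : ∀ {p q w v} → Rep q p w v → Bar (pl 1 p ∷ w) (pl 2 q ∷ v)
  skip : ∀ {x w v} → Outside12 x → Bar w v → Bar (x ∷ w) (x ∷ v)

map-∷-just : ∀ {x} (m : Maybe Word) {v : Word} → Maybe.map (x ∷_) m ≡ just v → Σ Word λ u → m ≡ just u × v ≡ x ∷ u
map-∷-just (just u) refl = u , refl , refl

replaceFirst1-nothing : ∀ p {w} → No1 w → replaceFirst1 (pl 1 p) w ≡ nothing
replaceFirst1-nothing p [] = refl
replaceFirst1-nothing p {x ∷ w} (h ∷ hs)
  rewrite ≢⇒≡ᵇ-false (num x) 1 h | replaceFirst1-nothing p hs = refl

replaceFirst1-just : ∀ {p q w v} → Rep q p w v → replaceFirst1 (pl 1 p) w ≡ just (pl 1 q , v)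
replaceFirst1-just here = refl
replaceFirst1-just (skip {x} h r) rewrite ≢⇒≡ᵇ-false (num x) 1 h | replaceFirst1-just r = refl

first1? : ∀ p w → No1 w ⊎ ∃[ q ] ∃[ v ] Rep q p w v
first1? p [] = inj₁ []
first1? p (x@(pl k q) ∷ w) with k ≟ 1
... | yes refl = inj₂ (q , _ , here)
... | no h with first1? p w
... | inj₁ hs          = inj₁ (h ∷ hs)
... | inj₂ (q , v , r) = inj₂ (q , _ , skip h r)

fbarW-skip : ∀ x w → Outside12 x → fbarW (x ∷ w) ≡ Maybe.map (x ∷_) (fbarW w)
fbarW-skip (pl 0 p) w _ = refl
fbarW-skip (pl 1 p) w (h , _) = contradiction refl h
fbarW-skip (pl 2 p) w (_ , h) = contradiction refl h
fbarW-skip (pl (suc (suc (suc k))) p) w _ = refl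

ebarW-skip : ∀ x w → Outside12 x → ebarW (x ∷ w) ≡ Maybe.map (x ∷_) (ebarW w)
ebarW-skip (pl 0 p) w _ = refl
ebarW-skip (pl 1 p) w (h , _) = contradiction refl h
ebarW-skip (pl 2 p) w (_ , h) = contradiction refl h
ebarW-skip (pl (suc (suc (suc k))) p) w _ = refl

data View12 : PLetter → Set where
  one     : ∀ p → View12 (pl 1 p)
  two     : ∀ p → View12 (pl 2 p)
  outside : ∀ {x} → Outside12 x → View12 x

view12 : ∀ x → View12 x
view12 (pl 0 p) = outside ((λ ()) , λ ())
view12 (pl 1 p) = one p
view12 (pl 2 p) = two p
view12 (pl (suc (suc (suc k))) p) = outside ((λ ()) , λ ())

fbarW⇔Bar : ∀ w v → fbarW w ≡ just v ⇔ Bar w v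
fbarW⇔Bar w v = mk⇔ (to w) from
  where
  to : ∀ w {v} → fbarW w ≡ just v → Bar w v
  to (x ∷ w) eq with view12 x
  ... | outside o with map-∷-just (fbarW w) (trans (sym (fbarW-skip x w o)) eq)
  ...   | u , eq' , refl = skip o (to w eq')
  to (x ∷ w) eq | one p with first1? p w
  ... | inj₁ hs rewrite replaceFirst1-nothing p hs with refl ← eq = lone hs
  ... | inj₂ (q , u , r) rewrite replaceFirst1-just r with refl ← eq = pair r
  from : ∀ {w v} → Bar w v → fbarW w ≡ just v
  from (lone {p} hs) rewrite replaceFirst1-nothing p hs = refl
  from (pair r) rewrite replaceFirst1-just r = refl
  from (skip {x} {w} o b) = trans (fbarW-skip x w o) (cong (Maybe.map (x ∷_)) (from b))

ebarW⇔Bar : ∀ w v → ebarW v ≡ just w ⇔ Bar w v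
ebarW⇔Bar w v = mk⇔ (to v) from
  where
  to : ∀ v {w} → ebarW v ≡ just w → Bar w v
  to (x ∷ v) eq with view12 x
  ... | outside o with map-∷-just (ebarW v) (trans (sym (ebarW-skip x v o)) eq)
  ...   | u , eq' , refl = skip o (to v eq')
  to (x ∷ v) eq | two q with first1? q v
  ... | inj₁ hs rewrite replaceFirst1-nothing q hs with refl ← eq = lone hs
  ... | inj₂ (p , u , r) rewrite replaceFirst1-just r with refl ← eq = pair (Rep-sym r)
  from : ∀ {w v} → Bar w v → ebarW v ≡ just w
  from (lone {p} hs) rewrite replaceFirst1-nothing p hs = refl
  from (pair r) rewrite replaceFirst1-just (Rep-sym r) = refl
  from (skip {x} {w} {v} o b) = trans (ebarW-skip x v o) (cong (Maybe.map (x ∷_)) (from b))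

e0W-skip : ∀ x w → num x ≢ 1 → e0W (x ∷ w) ≡ Maybe.map (x ∷_) (e0W w)
e0W-skip x w h rewrite ≢⇒≡ᵇ-false (num x) 1 h = refl

f0W-skip : ∀ x w → num x ≢ 1 → f0W (x ∷ w) ≡ Maybe.map (x ∷_) (f0W w)
f0W-skip x w h rewrite ≢⇒≡ᵇ-false (num x) 1 h = refl

e0W⇔Rep : ∀ w v → e0W w ≡ just v ⇔ Rep true false w v
e0W⇔Rep w v = mk⇔ (to w) from
  where
  to : ∀ w {v} → e0W w ≡ just v → Rep true false w v
  to (x@(pl k p) ∷ w) eq with k ≟ 1
  to (pl 1 true ∷ w) refl | yes refl = here
  ... | no h with map-∷-just (e0W w) (trans (sym (e0W-skip x w h)) eq)
  ...   | u , eq' , refl = skip h (to w eq')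
  from : ∀ {w v} → Rep true false w v → e0W w ≡ just v
  from here = refl
  from (skip {x} {w} h r) = trans (e0W-skip x w h) (cong (Maybe.map (x ∷_)) (from r))

f0W⇔Rep : ∀ w v → f0W w ≡ just v ⇔ Rep false true w v
f0W⇔Rep w v = mk⇔ (to w) from
  where
  to : ∀ w {v} → f0W w ≡ just v → Rep false true w v
  to (x@(pl k p) ∷ w) eq with k ≟ 1
  to (pl 1 false ∷ w) refl | yes refl = here
  ... | no h with map-∷-just (f0W w) (trans (sym (f0W-skip x w h)) eq)
  ...   | u , eq' , refl = skip h (to w eq')
  from : ∀ {w v} → Rep false true w v → f0W w ≡ just v
  from here = refl
  from (skip {x} {w} h r) = trans (f0W-skip x w h) (cong (Maybe.map (x ∷_)) (from r))

-- Weights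

occ : ℕ → List ℕ → ℕ
occ j []       = 0
occ j (k ∷ ks) = if k ≡ᵇ j then suc (occ j ks) else occ j ks

count≡occ : ∀ j w → count (inBlock j) w ≡ occ j (map num w)
count≡occ j []      = refl
count≡occ j (x ∷ w) with num x ≡ᵇ j
... | true  = cong suc (count≡occ j w)
... | false = count≡occ j w

occ-here : ∀ j ks → occ j (j ∷ ks) ≡ suc (occ j ks)
occ-here j ks rewrite ≡ᵇ-refl j = refl

occ-skip : ∀ {j k} ks → k ≢ j → occ j (k ∷ ks) ≡ occ j ks
occ-skip {j} {k} ks h rewrite ≢⇒≡ᵇ-false k j h = refl

occ-++ : ∀ j ks ls → occ j (ks ++ ls) ≡ occ j ks + occ j ls
occ-++ j []       ls = refl
occ-++ j (k ∷ ks) ls with k ≡ᵇ j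
... | true  = cong suc (occ-++ j ks ls)
... | false = occ-++ j ks ls

-- The trace of an operator on numbers, with primes forgotten. Although f_1bar may change two
-- letters, it changes only one number; `P` records which numbers cannot occur before it.
record Raise (P : ℕ → Set) (i : ℕ) (w v : Word) : Set where
  constructor raise
  field
    {before after} : List ℕ
    lower    : map num w ≡ before ++ i ∷ after
    upper    : map num v ≡ before ++ suc i ∷ after
    restrict : All P before

≡ᵇ-sym : ∀ k l → (k ≡ᵇ l) ≡ (l ≡ᵇ k)
≡ᵇ-sym zero    zero    = refl
≡ᵇ-sym zero    (suc l) = refl
≡ᵇ-sym (suc k) zero    = refl
≡ᵇ-sym (suc k) (suc l) = ≡ᵇ-sym k l

occ-δ : ∀ j ks k ls → + occ j (ks ++ k ∷ ls) ≡ + occ j (ks ++ ls) +ℤ δ j k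
occ-δ j ks k ls rewrite occ-++ j ks (k ∷ ls) | occ-++ j ks ls | ≡ᵇ-sym j k with k ≡ᵇ j
... | true  = cong +_ (trans (ℕₚ.+-suc (occ j ks) (occ j ls)) (ℕₚ.+-comm 1 _))
... | false = sym (ℤₚ.+-identityʳ _)

-- Unlike wtW, this gives words with the same numbers equal weights as functions,
-- as Preserves e0 wt demands.
numWt : (n : ℕ) → Word → Wt n
numWt n w j = + occ (suc (toℕ j)) (map num w)

wtW≡numWt : ∀ n w j → wtW n w j ≡ numWt n w j
wtW≡numWt n w j = cong +_ (count≡occ (suc (toℕ j)) w)

raise-wt : ∀ {P i w v} n → Raise P i w v → ∀ j → numWt n w j ≡ numWt n v j +ℤ simpleRoot n i j
raise-wt {P} {i} {w} {v} n (raise {ks} {ls} eqw eqv _) j = begin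
  + occ J (map num w)
    ≡⟨ cong (+_ ∘ occ J) eqw ⟩
  + occ J (ks ++ i ∷ ls)
    ≡⟨ occ-δ J ks i ls ⟩
  N +ℤ δ J i
    ≡⟨ cong (N +ℤ_) (ℤₚ.+-identityˡ (δ J i)) ⟨
  N +ℤ (+ 0 +ℤ δ J i)
    ≡⟨ cong (λ z → N +ℤ (z +ℤ δ J i)) (ℤₚ.+-inverseʳ (δ J (suc i))) ⟨
  N +ℤ ((δ J (suc i) +ℤ - δ J (suc i)) +ℤ δ J i)
    ≡⟨ cong (N +ℤ_) (trans (ℤₚ.+-assoc (δ J (suc i)) _ _)
         (cong (δ J (suc i) +ℤ_) (ℤₚ.+-comm (- δ J (suc i)) (δ J i)))) ⟩
  N +ℤ (δ J (suc i) +ℤ simpleRoot n i j)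
    ≡⟨ ℤₚ.+-assoc N (δ J (suc i)) _ ⟨
  (N +ℤ δ J (suc i)) +ℤ simpleRoot n i j
    ≡⟨ cong (_+ℤ simpleRoot n i j) (occ-δ J ks (suc i) ls) ⟨
  + occ J (ks ++ suc i ∷ ls) +ℤ simpleRoot n i j
    ≡⟨ cong (λ z → + occ J z +ℤ simpleRoot n i j) eqv ⟨
  + occ J (map num v) +ℤ simpleRoot n i j ∎
  where
  open ≡-Reasoning
  J = suc (toℕ j)
  N = + occ J (ks ++ ls)

flip-raise : ∀ {i w v} → Flip i w v → Raise (λ _ → ⊤) i w v
flip-raise (flip a p b _ _) = raise (Lₚ.map-++ num a _) (Lₚ.map-++ num a _) (All.universal (λ _ → tt) _)

rep-num : ∀ {p q w v} → Rep p q w v → map num w ≡ map num v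
rep-num here              = refl
rep-num (skip {x} _ r)    = cong (num x ∷_) (rep-num r)

bar-raise : ∀ {w v} → Bar w v → Raise (λ k → k ≢ 1 × k ≢ 2) 1 w v
bar-raise (lone _) = raise {before = []} refl refl []
bar-raise (pair r) = raise {before = []} refl (cong (2 ∷_) (sym (rep-num r))) []
bar-raise (skip {x} o b) with bar-raise b
... | raise eqw eqv rs = raise (cong (num x ∷_) eqw) (cong (num x ∷_) eqv) (o ∷ rs)

-- Operators that only see the letters of a block

Op : Set
Op = Word → Maybe Word

Block : ℕ → ℕ → Set
Block i k = k ≡ i ⊎ k ≡ suc i

-- A simulation condition. For symmetric `R` it makes `R` a bisimulation for `φ`, so related words
-- have the same string lengths.
Tracks : (Word → Word → Set) → Op → Set
Tracks R φ = ∀ {w w' v} → R w w' → φ w ≡ just v → ∃[ v' ] (φ w' ≡ just v' × R v v')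

tracks⇒sameString : ∀ {R φ} → Symmetric R → Tracks R φ → ∀ {w w'} → R w w' → SameString φ w w'
tracks⇒sameString {R} {φ} R-sym tr {w} {w'} r k = same (related k)
  where
  step : ∀ {m m'} → MP.Pointwise R m m' → MP.Pointwise R (m >>= φ) (m' >>= φ)
  step MP.nothing = MP.nothing
  step (MP.just {u} {u'} r) with φ u in h | φ u' in h'
  ... | nothing | nothing = MP.nothing
  ... | just v | z with tr r h
  ...   | v' , h'' , r' with trans (sym h') h''
  ...     | refl = MP.just r'
  step (MP.just {u} {u'} r) | nothing | just v' with tr (R-sym r) h'
  ...   | v , h'' , _ = contradiction (trans (sym h) h'') λ ()
  related : ∀ k → MP.Pointwise R (iter k φ w) (iter k φ w')
  related zero    = MP.just r
  related (suc k) = step (related k)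
  same : ∀ {m m'} → MP.Pointwise R m m' → is-just m ≡ is-just m'
  same MP.nothing  = refl
  same (MP.just _) = refl

-- What a relation on letters needs for operators of the block `C` to track it: `keep` makes both
-- words show the same brackets, `shift` lets the relation survive the change of a number inside the
-- block. The instance `SameNum` serves the axioms on e_0 and f_0, the instance `Agree` those on
-- distant indices.
record Compatible (C : ℕ → Set) (S : PLetter → PLetter → Set) : Set where
  field
    keep  : ∀ {x y} → S x y → C (num x) ⊎ C (num y) → num x ≡ num y
    shift : ∀ {k l p q} → C k → C l → S (pl k p) (pl k q) → S (pl l p) (pl l q)

SameNum : PLetter → PLetter → Set
SameNum x y = num x ≡ num y

sameNum-compatible : ∀ C → Compatible C SameNum
sameNum-compatible C = record { keep = λ h _ → h ; shift = λ _ _ _ → refl }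

Agree : (ℕ → Set) → PLetter → PLetter → Set
Agree C x y = x ≡ y ⊎ (¬ C (num x) × ¬ C (num y))

agree-compatible : ∀ C → Compatible C (Agree C)
agree-compatible C = record { keep = keep ; shift = shift }
  where
  keep : ∀ {x y} → Agree C x y → C (num x) ⊎ C (num y) → num x ≡ num y
  keep (inj₁ refl) _ = refl
  keep (inj₂ (h , _)) (inj₁ c) = contradiction c h
  keep (inj₂ (_ , h)) (inj₂ c) = contradiction c h
  shift : ∀ {k l p q} → C k → C l → Agree C (pl k p) (pl k q) → Agree C (pl l p) (pl l q)
  shift _ _ (inj₁ refl) = inj₁ refl
  shift c _ (inj₂ (h , _)) = contradiction c h

agree-sym : ∀ {C} → Symmetric (Pointwise (Agree C))
agree-sym = PW.symmetric λ { (inj₁ e) → inj₁ (sym e) ; (inj₂ (a , b)) → inj₂ (b , a) }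

sameNum-sym : Symmetric (Pointwise SameNum)
sameNum-sym = PW.symmetric sym

pointwise-split : ∀ {S : PLetter → PLetter → Set} a {x b w'} → Pointwise S (a ++ x ∷ b) w' →
  ∃[ a' ] ∃[ x' ] ∃[ b' ] (w' ≡ a' ++ x' ∷ b' × Pointwise S a a' × S x x' × Pointwise S b b')
pointwise-split []      (s ∷ ss) = [] , _ , _ , refl , [] , s , ss
pointwise-split (y ∷ a) (s ∷ ss) with pointwise-split a ss
... | a' , x' , b' , refl , sa , sx , sb = _ ∷ a' , x' , b' , refl , s ∷ sa , sx , sb

module _ {i S} (comp : Compatible (Block i) S) where
  open Compatible comp

  br-cong : ∀ {x y} → S x y → br i x ≡ br i y
  br-cong {pl k p} {pl l q} s with k ≟ i | k ≟ suc i
  ... | yes h | _ with refl ← keep s (inj₁ (inj₁ h)) = refl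
  ... | no _ | yes h with refl ← keep s (inj₁ (inj₂ h)) = refl
  br-cong {pl k p} {pl l q} s | no h | no h' with l ≟ i | l ≟ suc i
  ... | yes e | _ with refl ← keep s (inj₂ (inj₁ e)) = refl
  ... | no _ | yes e with refl ← keep s (inj₂ (inj₂ e)) = refl
  ... | no e | no e' = trans (br-nb i (pl k p) h h') (sym (br-nb i (pl l q) e e'))

  map-br-cong : ∀ {w w'} → Pointwise S w w' → map (br i) w ≡ map (br i) w'
  map-br-cong []       = refl
  map-br-cong (s ∷ ss) = cong₂ _∷_ (br-cong s) (map-br-cong ss)

  flip-transport : ∀ {k l a p b w'} → Block i k → Block i l →
    pending 0 (map (br i) a) ≡ 0 → AllMatched 0 (map (br i) b) → Pointwise S (a ++ pl k p ∷ b) w' →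
    ∃[ a' ] ∃[ p' ] ∃[ b' ] (w' ≡ a' ++ pl k p' ∷ b' × pending 0 (map (br i) a') ≡ 0
      × AllMatched 0 (map (br i) b') × Pointwise S (a ++ pl l p ∷ b) (a' ++ pl l p' ∷ b'))
  flip-transport {k} {l} {a} {p} {b} ck cl h m ss with pointwise-split a ss
  ... | a' , pl k' p' , b' , refl , sa , sx , sb with keep sx (inj₁ ck)
  ... | refl = a' , p' , b' , refl , trans (cong (pending 0) (sym (map-br-cong sa))) h
             , subst (AllMatched 0) (map-br-cong sb) m
             , PW.++⁺ sa (shift ck cl sx ∷ sb)

  fW-tracks : Tracks (Pointwise S) (fW i)
  fW-tracks {w} {w'} {v} ss eq with Equivalence.to (fW⇔Flip i w v) eq
  ... | flip a p b h m with flip-transport (inj₁ refl) (inj₂ refl) h m ss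
  ... | a' , p' , b' , refl , h' , m' , ss' =
    _ , Equivalence.from (fW⇔Flip i _ _) (flip a' p' b' h' m') , ss'

  eW-tracks : Tracks (Pointwise S) (eW i)
  eW-tracks {w} {w'} {v} ss eq with Equivalence.to (eW⇔Flip i v w) eq
  ... | flip a p b h m with flip-transport (inj₂ refl) (inj₁ refl) h m ss
  ... | a' , p' , b' , refl , h' , m' , ss' =
    _ , Equivalence.from (eW⇔Flip i _ _) (flip a' p' b' h' m') , ss'

module _ {S} (comp : Compatible (Block 1) S) where
  open Compatible comp

  no1-transport : ∀ {w w'} → Pointwise S w w' → No1 w → No1 w'
  no1-transport []       []       = []
  no1-transport (s ∷ ss) (h ∷ hs) =
    (λ e → h (trans (keep s (inj₂ (inj₁ e))) e)) ∷ no1-transport ss hs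

  outside12-transport : ∀ {x y} → S x y → Outside12 x → Outside12 y
  outside12-transport s (h , h') =
    (λ e → h (trans (keep s (inj₂ (inj₁ e))) e)) , (λ e → h' (trans (keep s (inj₂ (inj₂ e))) e))

  rep-transport : ∀ {p q q' w v w'} → S (pl 1 q) (pl 1 q') → Rep p q w v → Pointwise S w w' →
    ∃[ p' ] ∃[ v' ] (Rep p' q' w' v' × S (pl 1 p) (pl 1 p') × Pointwise S v v')
  rep-transport sq (here {w}) (_∷_ {y = pl k p'} s ss) with refl ← keep s (inj₁ (inj₁ refl)) =
    p' , _ , here , s , sq ∷ ss
  rep-transport sq (skip h r) (s ∷ ss) with rep-transport sq r ss
  ... | p' , v' , r' , sp , ss' =
    p' , _ , skip (λ e → h (trans (keep s (inj₂ (inj₁ e))) e)) r' , sp , s ∷ ss'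

  fbarW-tracks : Tracks (Pointwise S) fbarW
  fbarW-tracks {w} {w'} {v} ss eq =
    let v' , b , ss' = go (Equivalence.to (fbarW⇔Bar w v) eq) ss
    in v' , Equivalence.from (fbarW⇔Bar w' v') b , ss'
    where
    go : ∀ {w v w'} → Bar w v → Pointwise S w w' → ∃[ v' ] (Bar w' v' × Pointwise S v v')
    go (lone hs) (_∷_ {y = pl k p'} s ss) with refl ← keep s (inj₁ (inj₁ refl)) =
      _ , lone (no1-transport ss hs) , shift (inj₁ refl) (inj₂ refl) s ∷ ss
    go (pair r) (_∷_ {y = pl k p'} s ss) with refl ← keep s (inj₁ (inj₁ refl)) =
      let q' , v' , r' , sq , ss' = rep-transport s r ss
      in _ , pair r' , shift (inj₁ refl) (inj₂ refl) sq ∷ ss'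
    go (skip o b) (s ∷ ss) =
      let v' , b' , ss' = go b ss in _ , skip (outside12-transport s o) b' , s ∷ ss'

  ebarW-tracks : Tracks (Pointwise S) ebarW
  ebarW-tracks {v} {v'} {w} ss eq =
    let w' , b , ss' = go (Equivalence.to (ebarW⇔Bar w v) eq) ss
    in w' , Equivalence.from (ebarW⇔Bar w' v') b , ss'
    where
    go : ∀ {w v v'} → Bar w v → Pointwise S v v' → ∃[ w' ] (Bar w' v' × Pointwise S w w')
    go (lone hs) (_∷_ {y = pl k p'} s ss) with refl ← keep s (inj₁ (inj₂ refl)) =
      _ , lone (no1-transport ss hs) , shift (inj₂ refl) (inj₁ refl) s ∷ ss
    go (pair r) (_∷_ {y = pl k q'} s ss) with refl ← keep s (inj₁ (inj₂ refl)) =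
      let p' , w' , r' , sp , ss' = rep-transport (shift (inj₂ refl) (inj₁ refl) s) (Rep-sym r) ss
      in _ , pair (Rep-sym r') , sp ∷ ss'
    go (skip o b) (s ∷ ss) =
      let w' , b' , ss' = go b ss in _ , skip (outside12-transport s o) b' , s ∷ ss'

-- e_0 and f_0 read primes and do not track `SameNum`; they do track agreement on the letters with
-- number 1, primes included.
rep-agree : ∀ {p q w v w'} → Rep p q w v → Pointwise (Agree (_≡ 1)) w w' →
            ∃[ v' ] (Rep p q w' v' × Pointwise (Agree (_≡ 1)) v v')
rep-agree here (inj₁ refl ∷ ss) = _ , here , inj₁ refl ∷ ss
rep-agree here (inj₂ (h , _) ∷ ss) = contradiction refl h
rep-agree (skip h r) (s ∷ ss) =
  let v' , r' , ss' = rep-agree r ss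
  in _ , skip (λ e → h (trans (Compatible.keep (agree-compatible (_≡ 1)) s (inj₂ e)) e)) r' , s ∷ ss'

e0W-tracks : Tracks (Pointwise (Agree (_≡ 1))) e0W
e0W-tracks {w} {w'} {v} ss eq =
  let v' , r , ss' = rep-agree (Equivalence.to (e0W⇔Rep w v) eq) ss
  in v' , Equivalence.from (e0W⇔Rep w' v') r , ss'

f0W-tracks : Tracks (Pointwise (Agree (_≡ 1))) f0W
f0W-tracks {w} {w'} {v} ss eq =
  let v' , r , ss' = rep-agree (Equivalence.to (f0W⇔Rep w v) eq) ss
  in v' , Equivalence.from (f0W⇔Rep w' v') r , ss'

-- Locality, and commutation of operators with disjoint supports

Touch : (ℕ → Set) → PLetter → PLetter → Set
Touch C x y = x ≡ y ⊎ (C (num x) × C (num y))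

touch-refl : ∀ {C} w → Pointwise (Touch C) w w
touch-refl w = PW.refl (inj₁ refl)

touch-sym : ∀ {C} → Symmetric (Pointwise (Touch C))
touch-sym = PW.symmetric λ { (inj₁ e) → inj₁ (sym e) ; (inj₂ (a , b)) → inj₂ (b , a) }

flip-touch : ∀ {i w v} → Flip i w v → Pointwise (Touch (Block i)) w v
flip-touch (flip a p b _ _) = PW.++⁺ (touch-refl a) (inj₂ (inj₁ refl , inj₂ refl) ∷ touch-refl b)

rep-touch : ∀ {C p q w v} → C 1 → Rep p q w v → Pointwise (Touch C) w v
rep-touch c here       = inj₂ (c , c) ∷ touch-refl _
rep-touch c (skip _ r) = inj₁ refl ∷ rep-touch c r

bar-touch : ∀ {w v} → Bar w v → Pointwise (Touch (Block 1)) w v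
bar-touch (lone _)   = inj₂ (inj₁ refl , inj₂ refl) ∷ touch-refl _
bar-touch (pair r)   = inj₂ (inj₁ refl , inj₂ refl) ∷ rep-touch (inj₁ refl) r
bar-touch (skip _ b) = inj₁ refl ∷ bar-touch b

-- Two separate kinds of locality: `touches` says that only letters of `C` are written, `tracks`
-- that only letters of `C` are read.
record Local (C : ℕ → Set) (φ : Op) : Set where
  field
    touches : ∀ {w v} → φ w ≡ just v → Pointwise (Touch C) w v
    tracks  : Tracks (Pointwise (Agree C)) φ

eW-local : ∀ i → Local (Block i) (eW i)
eW-local i = record
  { touches = λ {w} {v} eq → touch-sym (flip-touch (Equivalence.to (eW⇔Flip i v w) eq))
  ; tracks  = eW-tracks (agree-compatible (Block i)) }

fW-local : ∀ i → Local (Block i) (fW i)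
fW-local i = record
  { touches = λ {w} {v} eq → flip-touch (Equivalence.to (fW⇔Flip i w v) eq)
  ; tracks  = fW-tracks (agree-compatible (Block i)) }

ebarW-local : Local (Block 1) ebarW
ebarW-local = record
  { touches = λ {w} {v} eq → touch-sym (bar-touch (Equivalence.to (ebarW⇔Bar v w) eq))
  ; tracks  = ebarW-tracks (agree-compatible (Block 1)) }

fbarW-local : Local (Block 1) fbarW
fbarW-local = record
  { touches = λ {w} {v} eq → bar-touch (Equivalence.to (fbarW⇔Bar w v) eq)
  ; tracks  = fbarW-tracks (agree-compatible (Block 1)) }

e0W-local : Local (_≡ 1) e0W
e0W-local = record
  { touches = λ {w} {v} eq → rep-touch refl (Equivalence.to (e0W⇔Rep w v) eq)
  ; tracks  = e0W-tracks }

f0W-local : Local (_≡ 1) f0W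
f0W-local = record
  { touches = λ {w} {v} eq → rep-touch refl (Equivalence.to (f0W⇔Rep w v) eq)
  ; tracks  = f0W-tracks }

Disjoint : (ℕ → Set) → (ℕ → Set) → Set
Disjoint C D = ∀ {k} → C k → ¬ D k

touch⇒agree : ∀ {C D} → Disjoint C D → ∀ {w v} → Pointwise (Touch C) w v → Pointwise (Agree D) w v
touch⇒agree dis = PW.map λ { (inj₁ e) → inj₁ e ; (inj₂ (c , c')) → inj₂ (dis c , dis c') }

-- The corners are w, v, u (first the operator on `D`, then the one on `C`) and w, t, u' (the other
-- order). Since the supports are disjoint, at each place at most one operator acts, and the two
-- `Agree` hypotheses say that it acts alike before and after the other.
square : ∀ {C D} → Disjoint C D → ∀ {w v u t u'} →
  Pointwise (Touch D) w v → Pointwise (Touch C) v u → Pointwise (Touch C) w t → Pointwise (Touch D) t u' →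
  Pointwise (Agree C) u t → Pointwise (Agree D) v u' → u ≡ u'
square dis [] [] [] [] [] [] = refl
square {C} {D} dis (wv ∷ a) (vu ∷ b) (wt ∷ c) (tu' ∷ d) (ut ∷ e) (vu' ∷ f) =
  cong₂ _∷_ (letter wv vu wt tu' ut vu') (square dis a b c d e f)
  where
  letter : ∀ {w v u t u'} → Touch D w v → Touch C v u → Touch C w t → Touch D t u' →
           Agree C u t → Agree D v u' → u ≡ u'
  letter wv vu wt (inj₁ refl) (inj₁ refl) vu' = refl
  letter wv vu wt (inj₂ (t∈ , u'∈)) (inj₁ refl) (inj₂ (_ , u'∉)) = contradiction u'∈ u'∉
  letter wv (inj₁ refl) wt (inj₂ _) (inj₁ refl) (inj₁ refl) = refl
  letter wv (inj₂ (_ , u∈)) wt (inj₂ (t∈ , _)) (inj₁ refl) (inj₁ refl) = contradiction t∈ (dis u∈)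
  letter wv (inj₂ (_ , u∈)) wt tu' (inj₂ (u∉ , _)) vu' = contradiction u∈ u∉
  letter wv (inj₁ refl) wt tu' (inj₂ _) (inj₁ refl) = refl
  letter wv (inj₁ refl) wt (inj₂ (_ , u'∈)) (inj₂ _) (inj₂ (_ , u'∉)) = contradiction u'∈ u'∉
  letter (inj₁ refl) (inj₁ refl) (inj₁ refl) (inj₁ refl) (inj₂ _) (inj₂ _) = refl
  letter (inj₂ (_ , v∈)) (inj₁ refl) wt (inj₁ refl) (inj₂ _) (inj₂ (v∉ , _)) = contradiction v∈ v∉
  letter wv (inj₁ refl) (inj₂ (_ , t∈)) (inj₁ refl) (inj₂ (_ , t∉)) (inj₂ _) = contradiction t∈ t∉

maybe-ext : ∀ {A : Set} {m m' : Maybe A} → (∀ {a} → m ≡ just a → m' ≡ just a) →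
            (∀ {a} → m' ≡ just a → m ≡ just a) → m ≡ m'
maybe-ext {m = just a}                   f g = sym (f refl)
maybe-ext {m = nothing} {m' = just a}    f g = g refl
maybe-ext {m = nothing} {m' = nothing}   f g = refl

local-commute : ∀ {C D φ ψ} → Disjoint C D → Local C φ → Local D ψ → Commute φ ψ
local-commute dis φ-local ψ-local b =
  maybe-ext (half dis φ-local ψ-local b) (half (λ d c → dis c d) ψ-local φ-local b)
  where
  half : ∀ {C D φ ψ} → Disjoint C D → Local C φ → Local D ψ → ∀ w {u} →
         (ψ w >>= φ) ≡ just u → (φ w >>= ψ) ≡ just u
  half {φ = φ} {ψ} dis Lφ Lψ w eq with ψ w in hv
  -- `ψ` writes only letters of `D`, so `w` and `v` look the same to `φ`; as `φ` is defined at `v`,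
  -- it is defined at `w`. The next line does the same for `ψ` at `t`.
  ... | just v with Local.tracks Lφ (agree-sym (touch⇒agree (λ d c → dis c d) (Local.touches Lψ hv))) eq
  ... | t , ht , ut with Local.tracks Lψ (touch⇒agree dis (Local.touches Lφ ht)) hv
  ... | u' , hu' , vu' = trans (cong (_>>= ψ) ht) (trans hu' (cong just (sym u≡u')))
    where
    u≡u' = square dis (Local.touches Lψ hv) (Local.touches Lφ eq) (Local.touches Lφ ht)
                  (Local.touches Lψ hu') ut vu'

local-preservesStr : ∀ {C D φ ψ} → Disjoint C D → Local C φ → Local D ψ → PreservesStr φ ψ
local-preservesStr dis Lφ Lψ b c eq =
  tracks⇒sameString agree-sym (Local.tracks Lψ) (agree-sym (touch⇒agree dis (Local.touches Lφ eq)))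

block-disjoint : ∀ {i j} → suc i < j → Disjoint (Block i) (Block j)
block-disjoint lt (inj₁ refl) (inj₁ refl) = ℕₚ.<-irrefl refl (ℕₚ.<-trans (ℕₚ.n<1+n _) lt)
block-disjoint lt (inj₁ refl) (inj₂ refl) = ℕₚ.<-irrefl refl (ℕₚ.<-trans (ℕₚ.n<1+n _) (ℕₚ.<-trans (ℕₚ.n<1+n _) lt))
block-disjoint lt (inj₂ refl) (inj₁ refl) = ℕₚ.<-irrefl refl lt
block-disjoint lt (inj₂ refl) (inj₂ refl) = ℕₚ.<-irrefl refl (ℕₚ.<-trans (ℕₚ.n<1+n _) lt)

one-disjoint : ∀ {i} → 2 ≤ i → Disjoint (_≡ 1) (Block i)
one-disjoint (s≤s ()) refl (inj₁ refl)

rep-sameNum : ∀ {p q w v} → Rep p q w v → Pointwise SameNum w v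
rep-sameNum here       = refl ∷ PW.refl refl
rep-sameNum (skip _ r) = refl ∷ rep-sameNum r

-- The crystal of words

wordQ : (n : ℕ) → QStr n Word
wordQ n = record { wt = numWt n ; e = eW ; f = fW ; ebar = ebarW ; fbar = fbarW }

wordQPlus : (n : ℕ) → QPlusStr n Word
wordQPlus n = record { q = wordQ n ; e0 = e0W ; f0 = f0W }

wordQ-isQCrystal : ∀ n → IsQCrystal (wordQ n)
wordQ-isQCrystal n = gl , far , bar-inverse , bar-shift
  where
  open Equivalence
  gl : IsGlCrystal (wordQ n)
  gl i _ = (λ b c → (λ eq → from (fW⇔Flip i c b) (to (eW⇔Flip i c b) eq))
                  , (λ eq → from (eW⇔Flip i c b) (to (fW⇔Flip i c b) eq)))
         , (λ b c eq → raise-wt n (flip-raise (to (eW⇔Flip i c b) eq)))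
  far : ∀ i → 3 ≤ i → i < n → _
  far i 3≤i _ = local-commute dis ebarW-local (eW-local i) , local-commute dis ebarW-local (fW-local i)
              , local-commute dis fbarW-local (eW-local i) , local-commute dis fbarW-local (fW-local i)
              , local-preservesStr dis ebarW-local (eW-local i) , local-preservesStr dis ebarW-local (fW-local i)
              , local-preservesStr dis fbarW-local (eW-local i) , local-preservesStr dis fbarW-local (fW-local i)
    where dis = block-disjoint 3≤i
  bar-inverse : Inverse ebarW fbarW
  bar-inverse b c = (λ eq → from (fbarW⇔Bar c b) (to (ebarW⇔Bar c b) eq))
                  , (λ eq → from (ebarW⇔Bar c b) (to (fbarW⇔Bar c b) eq))
  bar-shift : WtShift (numWt n) ebarW (simpleRoot n 1)
  bar-shift b c eq = raise-wt n (bar-raise (to (ebarW⇔Bar c b) eq))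

-- Both derivations stop at the first letter with number 1, whose prime status they read. Hence e_0
-- and f_0 cannot both apply to a word, and neither applies twice.
rep-functional : ∀ {p q p' q' w v v'} → Rep p q w v → Rep p' q' w v' → p ≡ p'
rep-functional here       here       = refl
rep-functional here       (skip h _) = contradiction refl h
rep-functional (skip h _) here       = contradiction refl h
rep-functional (skip _ r) (skip _ s) = rep-functional r s

reaches-pred : ∀ {B : Set} {g : B → Maybe B} {b} k → Reaches g b (suc k) → Reaches g b k
reaches-pred {g = g} {b} k r with iter k g b
... | just _ = refl

reaches-1 : ∀ {B : Set} {g : B → Maybe B} {b} k → Reaches g b (suc k) → ∃[ c ] g b ≡ just c
reaches-1 {g = g} {b} zero r with g b
... | just c = c , refl
reaches-1 (suc k) r = reaches-1 k (reaches-pred (suc k) r)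

reaches-2 : ∀ {B : Set} {g : B → Maybe B} {b} k → Reaches g b (suc (suc k)) →
            ∃[ c ] ∃[ d ] (g b ≡ just c × g c ≡ just d)
reaches-2 {g = g} {b} zero r with g b
... | just c with g c in h
... | just d = c , d , refl , h
reaches-2 (suc k) r = reaches-2 k (reaches-pred (suc (suc k)) r)

wordQPlus-isQPlusCrystal : ∀ n → IsQPlusCrystal (wordQPlus n)
wordQPlus-isQPlusCrystal n =
  wordQ-isQCrystal n , commute , e0-wt , f0-wt , (λ i _ → e0-blind (eW-tracks (sameNum-compatible _))
      , e0-blind (fW-tracks (sameNum-compatible _)) , f0-blind (eW-tracks (sameNum-compatible _))
      , f0-blind (fW-tracks (sameNum-compatible _)))
  , e0-blind (ebarW-tracks (sameNum-compatible _)) , e0-blind (fbarW-tracks (sameNum-compatible _))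
  , f0-blind (ebarW-tracks (sameNum-compatible _)) , f0-blind (fbarW-tracks (sameNum-compatible _))
  , inverse , sum1 , sum0
  where
  open Equivalence
  commute : ∀ i → 2 ≤ i → i < n → _
  commute i 2≤i _ = local-commute dis e0W-local (eW-local i) , local-commute dis e0W-local (fW-local i)
                  , local-commute dis f0W-local (eW-local i) , local-commute dis f0W-local (fW-local i)
    where dis = one-disjoint 2≤i
  rep-wt : ∀ {p q w v} → Rep p q w v → numWt n v ≡ numWt n w
  rep-wt r = cong (λ ks j → + occ (suc (toℕ j)) ks) (sym (rep-num r))
  e0-wt : Preserves e0W (numWt n)
  e0-wt b c eq = rep-wt (to (e0W⇔Rep b c) eq)
  f0-wt : Preserves f0W (numWt n)
  f0-wt b c eq = rep-wt (to (f0W⇔Rep b c) eq)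
  e0-blind : ∀ {ψ} → Tracks (Pointwise SameNum) ψ → PreservesStr e0W ψ
  e0-blind tr b c eq = tracks⇒sameString sameNum-sym tr (sameNum-sym (rep-sameNum (to (e0W⇔Rep b c) eq)))
  f0-blind : ∀ {ψ} → Tracks (Pointwise SameNum) ψ → PreservesStr f0W ψ
  f0-blind tr b c eq = tracks⇒sameString sameNum-sym tr (sameNum-sym (rep-sameNum (to (f0W⇔Rep b c) eq)))
  inverse : Inverse e0W f0W
  inverse b c = (λ eq → from (f0W⇔Rep c b) (Rep-sym (to (e0W⇔Rep b c) eq)))
              , (λ eq → from (e0W⇔Rep b c) (Rep-sym (to (f0W⇔Rep c b) eq)))
  sum1 : ∀ b → SumLe e0W f0W b 1
  sum1 b zero          zero          _ _ = z≤n
  sum1 b (suc zero)    zero          _ _ = s≤s z≤n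
  sum1 b zero          (suc zero)    _ _ = s≤s z≤n
  sum1 b (suc (suc k)) l             r _ with reaches-2 {g = e0W} k r
  ... | c , d , h , h' = contradiction
    (rep-functional (to (e0W⇔Rep c d) h') (Rep-sym (to (e0W⇔Rep b c) h))) λ ()
  sum1 b k             (suc (suc l)) _ r with reaches-2 {g = f0W} l r
  ... | c , d , h , h' = contradiction
    (rep-functional (to (f0W⇔Rep c d) h') (Rep-sym (to (f0W⇔Rep b c) h))) λ ()
  sum1 b (suc zero)    (suc zero)    r s with reaches-1 {g = e0W} {b} 0 r | reaches-1 {g = f0W} {b} 0 s
  ... | c , h | d , h' = contradiction (rep-functional (to (e0W⇔Rep b c) h) (to (f0W⇔Rep b d) h')) λ ()
  -- The first letter with number 1 or 2 decides: a 1 lets f_1bar act and a 2 lets e_1bar act. If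
  -- neither acts, there is no such letter.
  bar-idle : ∀ w → SumLe ebarW fbarW w 0 → No1 w
  bar-idle w h = go w (λ b → absurd 1 0 (cong is-just (from (ebarW⇔Bar _ w) b)) refl)
                      (λ b → absurd 0 1 refl (cong is-just (from (fbarW⇔Bar w _) b)))
    where
    absurd : ∀ k l → Reaches ebarW w k → Reaches fbarW w l → k + l ≤ 0
    absurd = h
    go : ∀ w → (∀ {u} → Bar u w → 1 ≤ 0) → (∀ {u} → Bar w u → 1 ≤ 0) → No1 w
    go [] _ _ = []
    go (x ∷ w) he hf with view12 x
    ... | outside o@(x≢1 , _) = x≢1 ∷ go w (he ∘ skip o) (hf ∘ skip o)
    ... | one p with first1? p w
    ...   | inj₁ hs = contradiction (hf (lone hs)) λ ()
    ...   | inj₂ (_ , _ , r) = contradiction (hf (pair r)) λ ()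
    go (x ∷ w) he hf | two p with first1? p w
    ...   | inj₁ hs = contradiction (he (lone hs)) λ ()
    ...   | inj₂ (_ , _ , r) = contradiction (he (pair (Rep-sym r))) λ ()
  no1⇒¬rep : ∀ {p q w v} → No1 w → ¬ Rep p q w v
  no1⇒¬rep (h ∷ _)  here       = h refl
  no1⇒¬rep (_ ∷ hs) (skip _ r) = no1⇒¬rep hs r
  sum0 : ∀ b → SumLe ebarW fbarW b 0 → SumLe e0W f0W b 0
  sum0 b h zero    zero    _ _ = z≤n
  sum0 b h (suc k) l       r _ with reaches-1 {g = e0W} {b} k r
  ... | c , eq = contradiction (to (e0W⇔Rep b c) eq) (no1⇒¬rep (bar-idle b h))
  sum0 b h zero    (suc l) _ r with reaches-1 {g = f0W} {b} l r
  ... | c , eq = contradiction (to (f0W⇔Rep b c) eq) (no1⇒¬rep (bar-idle b h))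

-- Hook words

data Hook : List ℕ → Set where
  rise : ∀ {m v} → Linked _<_ (m ∷ v) → Hook (m ∷ v)
  fall : ∀ {x y l} → x ≥ y → Hook (y ∷ l) → Hook (x ∷ y ∷ l)

isHook⇒hook : ∀ {w} → IsHook w → Hook w
isHook⇒hook (u , m , v , refl , dec , inc) = go u dec
  where
  go : ∀ u → Linked _≥_ (u ∷ʳ m) → Hook (u ++ m ∷ v)
  go [] _ = rise inc
  go (x ∷ []) (p ∷ _) = fall p (rise inc)
  go (x ∷ u@(_ ∷ _)) (p ∷ ps) = fall p (go u ps)

hook⇒isHook : ∀ {w} → Hook w → IsHook w
hook⇒isHook (rise {m} {v} inc) = [] , m , v , refl , [-] , inc
hook⇒isHook (fall p h) with hook⇒isHook h
... | [] , m , v , refl , dec , inc = _ ∷ [] , m , v , refl , p ∷ dec , inc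
... | y ∷ u , m , v , refl , dec , inc = _ ∷ y ∷ u , m , v , refl , p ∷ dec , inc

fall-++ : ∀ u {x l} → Linked _≥_ (u ∷ʳ x) → Hook (x ∷ l) → Hook (u ++ x ∷ l)
fall-++ []              _        h = h
fall-++ (y ∷ [])        (p ∷ _)  h = fall p h
fall-++ (y ∷ u@(_ ∷ _)) (p ∷ ps) h = fall p (fall-++ u ps h)

rise-++ : ∀ u {z l} → Hook (u ∷ʳ z) → Linked _<_ (z ∷ l) → Hook (u ++ z ∷ l)
rise-++ [] _ inc = rise inc
rise-++ (y ∷ []) (rise (p ∷ _)) inc = rise (p ∷ inc)
rise-++ (y ∷ []) (fall p _) inc = fall p (rise inc)
rise-++ (y ∷ u@(_ ∷ _)) (fall p h) inc = fall p (rise-++ u h inc)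
rise-++ (y ∷ u@(_ ∷ _)) (rise (p ∷ ps)) inc = rise (p ∷ linked-++ u ps inc)
  where
  linked-++ : ∀ u {z l} → Linked _<_ (u ∷ʳ z) → Linked _<_ (z ∷ l) → Linked _<_ (u ++ z ∷ l)
  linked-++ [] _ inc = inc
  linked-++ (y ∷ []) (p ∷ _) inc = p ∷ inc
  linked-++ (y ∷ u@(_ ∷ _)) (p ∷ ps) inc = p ∷ linked-++ u ps inc

-- The middle element counts as `falling`. In the case `rising` the predecessor `z` is exposed, so
-- that after a change of `x` only the comparison with `z` and the one with the next letter have to
-- be redone.
data Position (u : List ℕ) (x : ℕ) (l : List ℕ) : Set where
  falling : Linked _≥_ (u ∷ʳ x) → Hook (x ∷ l) → Position u x l
  rising  : ∀ u' z → u ≡ u' ∷ʳ z → Hook (u' ∷ʳ z) → z < x → Linked _<_ (x ∷ l) → Position u x l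

rising-position : ∀ y u {x l} → Linked _<_ (y ∷ u ++ x ∷ l) → ∃[ u' ] ∃[ z ]
  (y ∷ u ≡ u' ∷ʳ z × Linked _<_ (u' ∷ʳ z) × z < x × Linked _<_ (x ∷ l))
rising-position y [] (p ∷ inc) = [] , y , refl , [-] , p , inc
rising-position y (a ∷ u) (p ∷ ps) with rising-position a u ps
... | []      , z , refl , inc' , lt , inc = y ∷ [] , z , refl , p ∷ inc' , lt , inc
... | .a ∷ u' , z , refl , inc' , lt , inc = y ∷ a ∷ u' , z , refl , p ∷ inc' , lt , inc

rise-∷ʳ : ∀ u {z} → Linked _<_ (u ∷ʳ z) → Hook (u ∷ʳ z)
rise-∷ʳ []      inc = rise inc
rise-∷ʳ (_ ∷ _) inc = rise inc

position : ∀ u {x l} → Hook (u ++ x ∷ l) → Position u x l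
position [] h = falling [-] h
position (y ∷ []) (fall p h) = falling (p ∷ [-]) h
position (y ∷ u@(_ ∷ _)) (fall p h) with position u h
... | falling dec h' = falling (p ∷ dec) h'
... | rising [] z refl h' lt inc = rising (y ∷ []) z refl (fall p h') lt inc
... | rising (a ∷ u') z refl h' lt inc = rising (y ∷ a ∷ u') z refl (fall p h') lt inc
position (y ∷ u) (rise inc) with rising-position y u inc
... | u' , z , eq , inc' , lt , inc'' = rising u' z eq (rise-∷ʳ u' inc') lt inc''

-- Domination of one letter by another in all suffixes or prefixes

-- The ballot conditions of lattice words, the form in which bracket matching is used on rows.
SuffixDom PrefixDom : ℕ → ℕ → List ℕ → Set
SuffixDom i j w = ∀ s t → w ≡ s ++ t → occ i t ≤ occ j t
PrefixDom i j w = ∀ s t → w ≡ s ++ t → occ i s ≤ occ j s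

replicate-⊆⇒occ : ∀ {c i w} → replicate c i ⊆ w → c ≤ occ i w
replicate-⊆⇒occ {zero} _ = z≤n
replicate-⊆⇒occ {suc c} {i} (_∷ˢ_ {ys = w} k τ) with k ≡ᵇ i
... | true  = ℕₚ.m≤n⇒m≤1+n (replicate-⊆⇒occ τ)
... | false = replicate-⊆⇒occ τ
replicate-⊆⇒occ {suc c} {i} (_∷_ {ys = w} refl τ) rewrite occ-here i w = s≤s (replicate-⊆⇒occ τ)

occ⇒replicate-⊆ : ∀ c i w → c ≤ occ i w → replicate c i ⊆ w
occ⇒replicate-⊆ zero i w _ = minimum w
occ⇒replicate-⊆ (suc c) i (k ∷ w) le with k ≟ i
... | yes refl rewrite occ-here i w = refl ∷ occ⇒replicate-⊆ c i w (ℕₚ.≤-pred le)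
... | no k≢i rewrite occ-skip w k≢i = k ∷ˢ occ⇒replicate-⊆ (suc c) i w le

⊆-++⁻ : ∀ u {v w : List ℕ} → u ++ v ⊆ w → ∃[ w₁ ] ∃[ w₂ ] (w ≡ w₁ ++ w₂ × u ⊆ w₁ × v ⊆ w₂)
⊆-++⁻ [] {w = w} τ = [] , w , refl , [] , τ
⊆-++⁻ (x ∷ u) (y ∷ˢ τ) with ⊆-++⁻ (x ∷ u) τ
... | w₁ , w₂ , refl , τ₁ , τ₂ = y ∷ w₁ , w₂ , refl , y ∷ˢ τ₁ , τ₂
⊆-++⁻ (x ∷ u) (refl ∷ τ) with ⊆-++⁻ u τ
... | w₁ , w₂ , refl , τ₁ , τ₂ = x ∷ w₁ , w₂ , refl , refl ∷ τ₁ , τ₂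

data Through (A : List ℕ) (x : ℕ) (B : List ℕ) : List ℕ → Set where
  avoid : ∀ {u₁ u₂} → u₁ ⊆ A → u₂ ⊆ B → Through A x B (u₁ ++ u₂)
  use   : ∀ {u₁ u₂} → u₁ ⊆ A → u₂ ⊆ B → Through A x B (u₁ ++ x ∷ u₂)

through : ∀ A {x B u} → u ⊆ A ++ x ∷ B → Through A x B u
through [] (_ ∷ˢ τ)    = avoid [] τ
through [] (refl ∷ τ)  = use [] τ
through (a ∷ A) (_ ∷ˢ τ) with through A τ
... | avoid τ₁ τ₂ = avoid (a ∷ˢ τ₁) τ₂
... | use τ₁ τ₂   = use (a ∷ˢ τ₁) τ₂
through (a ∷ A) (refl ∷ τ) with through A τ
... | avoid τ₁ τ₂ = avoid (refl ∷ τ₁) τ₂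
... | use τ₁ τ₂   = use (refl ∷ τ₁) τ₂

-- The suffix of `A` that starts at the chosen letter i contains an i, hence a j, and this j comes
-- strictly later.
insert-after : ∀ {i j} → i ≢ j → ∀ {A} u → SuffixDom i j A → u ∷ʳ i ⊆ A → u ++ i ∷ j ∷ [] ⊆ A
insert-after {i} {j} i≢j u dom τ with ⊆-++⁻ u τ
... | A₁ , A₂ , refl , τ₁ , τ₂ = Subₚ.++⁺ τ₁ (go A₁ A₂ dom τ₂)
  where
  go : ∀ A₁ A₂ → SuffixDom i j (A₁ ++ A₂) → i ∷ [] ⊆ A₂ → i ∷ j ∷ [] ⊆ A₂
  go A₁ (k ∷ A₂) dom (_ ∷ˢ τ) =
    k ∷ˢ go (A₁ ∷ʳ k) A₂ (subst (SuffixDom i j) (sym (Lₚ.∷ʳ-++ A₁ k A₂)) dom) τ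
  go A₁ (k ∷ A₂) dom (refl ∷ _) with dom A₁ (i ∷ A₂) refl
  ... | le rewrite occ-here i A₂ | occ-skip A₂ i≢j =
    refl ∷ occ⇒replicate-⊆ 1 j A₂ (ℕₚ.≤-trans (s≤s z≤n) le)

⊆-∷⁻ : ∀ {j u} {B : List ℕ} → j ∷ u ⊆ B → ∃[ P ] ∃[ Q ] (B ≡ P ++ j ∷ Q × u ⊆ Q)
⊆-∷⁻ (b ∷ˢ τ) with ⊆-∷⁻ τ
... | P , Q , refl , τ' = b ∷ P , Q , refl , τ'
⊆-∷⁻ (refl ∷ τ) = [] , _ , refl , τ

insert-before : ∀ {i j} → i ≢ j → ∀ {B u} → PrefixDom j i B → j ∷ u ⊆ B → i ∷ j ∷ u ⊆ B
insert-before {i} {j} i≢j dom τ with ⊆-∷⁻ τ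
... | P , Q , refl , τ' with dom (P ∷ʳ j) Q (sym (Lₚ.∷ʳ-++ P j Q))
... | le rewrite occ-++ j P (j ∷ []) | occ-++ i P (j ∷ []) | occ-here j [] | occ-skip {i} [] (i≢j ∘ sym)
               | ℕₚ.+-identityʳ (occ i P)
  = Subₚ.++⁺ (occ⇒replicate-⊆ 1 i P (ℕₚ.≤-trans (ℕₚ.m≤n+m 1 (occ j P)) le)) (refl ∷ τ')

-- Hook subwords survive a move of e_i or f_i

HookExtends : List ℕ → List ℕ → Set
HookExtends w v = ∀ u → u ⊆ w → Hook u → ∃[ u' ] (u' ⊆ v × Hook u' × length u ≤ length u')

suffixDom-tail : ∀ {i j k w} → SuffixDom i j (k ∷ w) → SuffixDom i j w
suffixDom-tail {k = k} dom s t eq = dom (k ∷ s) t (cong (k ∷_) eq)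

falling-≥ : ∀ u {x} → Linked _≥_ (u ∷ʳ x) → All (_≥ x) u
falling-≥ [] _ = []
falling-≥ (y ∷ []) (p ∷ _) = p ∷ []
falling-≥ (y ∷ u@(z ∷ _)) (p ∷ ps) with falling-≥ u ps
... | q ∷ qs = ℕₚ.≤-trans q p ∷ q ∷ qs

falling-∷ʳ⁻ : ∀ {y} u {x} → Linked _≥_ (y ∷ u ∷ʳ x) → Linked _≥_ (u ∷ʳ x)
falling-∷ʳ⁻ []      (_ ∷ ps) = ps
falling-∷ʳ⁻ (_ ∷ _) (_ ∷ ps) = ps

constant-falling : ∀ {i} u → Linked _≥_ (i ∷ u ∷ʳ i) → u ≡ replicate (length u) i
constant-falling [] _ = refl
constant-falling {i} (y ∷ u) (p ∷ ps) with ℕₚ.≤-antisym p (All.head (falling-≥ (y ∷ u) ps))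
... | refl = cong (i ∷_) (constant-falling u ps)

map-⊔-replicate : ∀ i c → map (_⊔ suc i) (replicate c i) ≡ replicate c (suc i)
map-⊔-replicate i c =
  trans (Lₚ.map-replicate (_⊔ suc i) c i) (cong (replicate c) (ℕₚ.m≤n⇒m⊔n≡n (ℕₚ.n≤1+n i)))

-- All letters of `u` are at least i, so the maximum with i + 1 changes only its letters i, which
-- form a final run. The suffix of `A` starting at the first letter of that run has enough letters i
-- + 1 to replace the whole run, and the earlier letters keep their places.
raise-falling : ∀ i u {A} → SuffixDom i (suc i) A → u ⊆ A → Linked _≥_ (u ∷ʳ i) → map (_⊔ suc i) u ⊆ A
raise-falling i [] {A} _ _ _ = minimum A
raise-falling i (y ∷ u) dom (a ∷ˢ τ) dec = a ∷ˢ raise-falling i (y ∷ u) (suffixDom-tail dom) τ dec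
raise-falling i (y ∷ u) {A} dom τ@(refl ∷ τ') dec with y ≟ i
... | yes refl = subst (_⊆ A) (sym (trans (cong (map (_⊔ suc i)) const) (map-⊔-replicate i c)))
  (occ⇒replicate-⊆ c (suc i) A (ℕₚ.≤-trans (replicate-⊆⇒occ (subst (_⊆ A) const τ)) (dom [] A refl)))
  where
  c = suc (length u)
  const : i ∷ u ≡ replicate c i
  const = cong (i ∷_) (constant-falling u dec)
... | no y≢i = ℕₚ.m≥n⇒m⊔n≡m (ℕₚ.≤∧≢⇒< (All.head (falling-≥ (y ∷ u) dec)) (y≢i ∘ sym))
             ∷ raise-falling i u (suffixDom-tail dom) τ' (falling-∷ʳ⁻ u dec)

linked-map : ∀ f → (∀ {x y} → x ≥ y → f x ≥ f y) → ∀ {w} → Linked _≥_ w → Linked _≥_ (map f w)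
linked-map f mono = Linkedₚ.map⁺ ∘ Linked.map mono

-- If i + 1 follows, the ascent i < i + 1 turns into a weak descent, and the middle element moves
-- one place to the right.
hook-raise : ∀ {i l} → Hook (i ∷ l) → Hook (suc i ∷ l)
hook-raise (fall p h) = fall (ℕₚ.m≤n⇒m≤1+n p) h
hook-raise (rise [-]) = rise [-]
hook-raise {i} (rise {v = y ∷ v} (p ∷ ps)) with y ≟ suc i
... | yes refl = fall ℕₚ.≤-refl (rise ps)
... | no y≢ = rise (ℕₚ.≤∧≢⇒< p (y≢ ∘ sym) ∷ ps)

drop-middle : ∀ {u₁ u₂ A B : List ℕ} {y} → u₁ ⊆ A → u₂ ⊆ B → u₁ ++ u₂ ⊆ A ++ y ∷ B
drop-middle τ₁ τ₂ = Subₚ.++⁺ τ₁ (_ ∷ˢ τ₂)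

-- Raising the letter i used by a hook can do harm in two ways: letters i before it in the
-- decreasing part become too small, and a letter i + 1 right after it in the increasing part
-- becomes a repetition. The first is repaired inside `A`, the second inside `B`.
hook-up : ∀ i A B → SuffixDom i (suc i) A → PrefixDom (suc i) i B →
          HookExtends (A ++ i ∷ B) (A ++ suc i ∷ B)
hook-up i A B domA domB u τ h with through A τ
... | avoid τ₁ τ₂ = u , drop-middle τ₁ τ₂ , h , ℕₚ.≤-refl
... | use {u₁} {u₂} τ₁ τ₂ with position u₁ h
... | falling dec h' = map ρ u₁ ++ suc i ∷ u₂ , Subₚ.++⁺ (raise-falling i u₁ domA τ₁ dec) (refl ∷ τ₂)
                     , fall-++ (map ρ u₁) dec' (hook-raise h') , ℕₚ.≤-reflexive len
  where
  ρ = _⊔ suc i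
  dec' : Linked _≥_ (map ρ u₁ ∷ʳ suc i)
  dec' = subst (Linked _≥_)
    (trans (Lₚ.map-++ ρ u₁ (i ∷ [])) (cong (map ρ u₁ ∷ʳ_) (ℕₚ.m≤n⇒m⊔n≡n (ℕₚ.n≤1+n i))))
    (linked-map ρ (ℕₚ.⊔-monoˡ-≤ (suc i)) dec)
  len : length (u₁ ++ i ∷ u₂) ≡ length (map ρ u₁ ++ suc i ∷ u₂)
  len = trans (Lₚ.length-++ u₁) (trans (cong (_+ suc (length u₂)) (sym (Lₚ.length-map ρ u₁)))
                                       (sym (Lₚ.length-++ (map ρ u₁))))
... | rising u' z refl h' lt inc with inc
... | [-] = (u' ∷ʳ z) ++ suc i ∷ [] , Subₚ.++⁺ τ₁ (refl ∷ τ₂)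
          , subst Hook (sym (Lₚ.∷ʳ-++ u' z _)) (rise-++ u' h' (ℕₚ.m<n⇒m<1+n lt ∷ [-]))
          , ℕₚ.≤-reflexive (trans (Lₚ.length-++ (u' ∷ʳ z)) (sym (Lₚ.length-++ (u' ∷ʳ z))))
... | _∷_ {y = y} {xs = u₃} p ps with y ≟ suc i
-- The hook stays the same word but avoids the raised letter: by domination `B` has a letter i
-- before the letter i + 1 in use.
... | yes refl = u , Subₚ.++⁺ τ₁ (suc i ∷ˢ insert-before (λ ()) domB τ₂) , h , ℕₚ.≤-refl
... | no y≢ = (u' ∷ʳ z) ++ suc i ∷ y ∷ u₃ , Subₚ.++⁺ τ₁ (refl ∷ τ₂)
          , subst Hook (sym (Lₚ.∷ʳ-++ u' z _))
              (rise-++ u' h' (ℕₚ.m<n⇒m<1+n lt ∷ ℕₚ.≤∧≢⇒< p (y≢ ∘ sym) ∷ ps))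
          , ℕₚ.≤-reflexive (trans (Lₚ.length-++ (u' ∷ʳ z)) (sym (Lₚ.length-++ (u' ∷ʳ z))))

run : ∀ k u → ∃[ d ] ∃[ r ] (u ≡ replicate d k ++ r × (∀ {r'} → r ≢ k ∷ r'))
run k [] = 0 , [] , refl , λ ()
run k (y ∷ u) with y ≟ k
... | no y≢k = 0 , y ∷ u , refl , λ { refl → y≢k refl }
... | yes refl with run k u
... | d , r , refl , h = suc d , r , refl , h

hook-drop-run : ∀ d {k r} → Hook (k ∷ replicate d k ++ r) → Hook (k ∷ r)
hook-drop-run zero h = h
hook-drop-run (suc d) (fall _ h) = hook-drop-run d h
hook-drop-run (suc d) (rise (p ∷ _)) = contradiction p (ℕₚ.<-irrefl refl)

hook-add-run : ∀ d {k r} → Hook (k ∷ r) → Hook (k ∷ replicate d k ++ r)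
hook-add-run zero h = h
hook-add-run (suc d) h = fall ℕₚ.≤-refl (hook-add-run d h)

hook-lower : ∀ {i r} → (∀ {r'} → r ≢ suc i ∷ r') → Hook (suc i ∷ r) → Hook (i ∷ r)
hook-lower ne (fall p h) = fall (ℕₚ.≤-pred (ℕₚ.≤∧≢⇒< p λ { refl → ne refl })) h
hook-lower ne (rise [-]) = rise [-]
hook-lower ne (rise (p ∷ ps)) = rise (ℕₚ.<-trans (ℕₚ.n<1+n _) p ∷ ps)

lower-last : ∀ u {x y} → y ≤ x → Linked _≥_ (u ∷ʳ x) → Linked _≥_ (u ∷ʳ y)
lower-last [] _ _ = [-]
lower-last (z ∷ []) le (p ∷ _) = ℕₚ.≤-trans le p ∷ [-]
lower-last (z ∷ u@(_ ∷ _)) le (p ∷ ps) = p ∷ lower-last u le ps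

-- The mirror image of `hook-up`. In the decreasing case the letters i + 1 that directly follow the
-- changed letter must be lowered with it; the prefix of `B` holding that run has enough letters i.
hook-down : ∀ i A B → SuffixDom i (suc i) A → PrefixDom (suc i) i B →
            HookExtends (A ++ suc i ∷ B) (A ++ i ∷ B)
hook-down i A B domA domB u τ h with through A τ
... | avoid τ₁ τ₂ = u , drop-middle τ₁ τ₂ , h , ℕₚ.≤-refl
... | use {u₁} {u₂} τ₁ τ₂ with position u₁ h
... | falling dec h' with run (suc i) u₂
... | d , r , refl , ne with ⊆-++⁻ (replicate d (suc i)) τ₂
... | B₁ , B₂ , refl , σ₁ , σ₂ =
    u₁ ++ i ∷ replicate d i ++ r
  , Subₚ.++⁺ τ₁ (refl ∷ Subₚ.++⁺ (occ⇒replicate-⊆ d i B₁ (ℕₚ.≤-trans (replicate-⊆⇒occ σ₁) (domB B₁ B₂ refl))) σ₂)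
  , fall-++ u₁ (lower-last u₁ (ℕₚ.n≤1+n i) dec) (hook-add-run d (hook-lower ne (hook-drop-run d h')))
  , ℕₚ.≤-reflexive (trans (Lₚ.length-++ u₁)
      (trans (cong (λ z → length u₁ + suc z) len) (sym (Lₚ.length-++ u₁))))
  where
  len : length (replicate d (suc i) ++ r) ≡ length (replicate d i ++ r)
  len = trans (Lₚ.length-++ (replicate d (suc i)))
          (trans (cong (_+ length r) (trans (Lₚ.length-replicate d) (sym (Lₚ.length-replicate d))))
                 (sym (Lₚ.length-++ (replicate d i))))
hook-down i A B domA domB u τ h | use {u₁} {u₂} τ₁ τ₂ | rising u' z refl h' lt inc with z ≟ i
-- The predecessor is i, so lowering would repeat it. The same hook is kept, with its i + 1 now
-- taken from `A`, after an i.
... | yes refl = u , subst (_⊆ A ++ i ∷ B) eq (Subₚ.++⁺ (insert-after (λ ()) u' domA τ₁) (i ∷ˢ τ₂)) , h , ℕₚ.≤-refl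
  where
  eq : (u' ++ i ∷ suc i ∷ []) ++ u₂ ≡ (u' ∷ʳ i) ++ suc i ∷ u₂
  eq = trans (Lₚ.++-assoc u' _ u₂) (sym (Lₚ.∷ʳ-++ u' i (suc i ∷ u₂)))
... | no z≢i = (u' ∷ʳ z) ++ i ∷ u₂ , Subₚ.++⁺ τ₁ (refl ∷ τ₂)
             , subst Hook (sym (Lₚ.∷ʳ-++ u' z _)) (rise-++ u' h' (z<i ∷ lower-head inc))
             , ℕₚ.≤-reflexive (trans (Lₚ.length-++ (u' ∷ʳ z)) (sym (Lₚ.length-++ (u' ∷ʳ z))))
  where
  z<i = ℕₚ.≤∧≢⇒< (ℕₚ.≤-pred lt) z≢i
  lower-head : ∀ {l} → Linked _<_ (suc i ∷ l) → Linked _<_ (i ∷ l)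
  lower-head [-] = [-]
  lower-head (p ∷ ps) = ℕₚ.<-trans (ℕₚ.n<1+n i) p ∷ ps

-- Hook subwords survive a move of e_1bar or f_1bar

hook-up-bar : ∀ A B → All (1 ≤_) A → All (3 ≤_) B → HookExtends (A ++ 1 ∷ B) (A ++ 2 ∷ B)
hook-up-bar A B hA hB u τ h with through A τ
... | avoid τ₁ τ₂ = u , drop-middle τ₁ τ₂ , h , ℕₚ.≤-refl
... | use {u₁} {u₂} τ₁ τ₂ with position u₁ h
... | rising u' z refl _ (s≤s z≤n) _ = contradiction (proj₂ (Allₚ.∷ʳ⁻ (Subₚ.All-resp-⊆ τ₁ hA))) λ ()
... | falling dec h' = u₁ ++ 2 ∷ u₂ , Subₚ.++⁺ τ₁ (refl ∷ τ₂) , go u₁ (Subₚ.All-resp-⊆ τ₁ hA) dec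
                     , ℕₚ.≤-reflexive (trans (Lₚ.length-++ u₁) (sym (Lₚ.length-++ u₁)))
  where
  inc : ∀ {l} → All (3 ≤_) l → Hook (1 ∷ l) → Linked _<_ (2 ∷ l)
  inc [] _ = [-]
  inc (p ∷ _) (fall q _) = contradiction (ℕₚ.≤-trans p q) λ { (s≤s ()) }
  inc (p ∷ _) (rise (_ ∷ ps)) = p ∷ ps
  inc₂ : Linked _<_ (2 ∷ u₂)
  inc₂ = inc (Subₚ.All-resp-⊆ τ₂ hB) h'
  go : ∀ u → All (1 ≤_) u → Linked _≥_ (u ∷ʳ 1) → Hook (u ++ 2 ∷ u₂)
  go [] _ _ = rise inc₂
  -- A last 1 of the decreasing part takes over as middle element, and the new 2 joins the
  -- increasing part.
  go (1 ∷ []) _ _ = rise (s≤s (s≤s z≤n) ∷ inc₂)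
  go (suc (suc y) ∷ []) _ _ = fall (s≤s (s≤s z≤n)) (rise inc₂)
  go (y ∷ u@(_ ∷ _)) (_ ∷ hs) (p ∷ ps) = fall p (go u hs ps)

hook-down-bar : ∀ A B → All (1 ≤_) A → All (3 ≤_) B → HookExtends (A ++ 2 ∷ B) (A ++ 1 ∷ B)
hook-down-bar A B hA hB u τ h with through A τ
... | avoid τ₁ τ₂ = u , drop-middle τ₁ τ₂ , h , ℕₚ.≤-refl
... | use {u₁} {u₂} τ₁ τ₂ =
  u₁ ++ 1 ∷ u₂ , Subₚ.++⁺ τ₁ (refl ∷ τ₂) , fall-++ u₁ (dec (position u₁ h)) (rise (inc (position u₁ h)))
  , ℕₚ.≤-reflexive (trans (Lₚ.length-++ u₁) (sym (Lₚ.length-++ u₁)))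
  where
  h₁ = Subₚ.All-resp-⊆ τ₁ hA
  h₂ = Subₚ.All-resp-⊆ τ₂ hB
  dec : Position u₁ 2 u₂ → Linked _≥_ (u₁ ∷ʳ 1)
  dec (falling d _) = lower-last u₁ (s≤s z≤n) d
  dec (rising u' 0 refl _ _ _) = contradiction (proj₂ (Allₚ.∷ʳ⁻ h₁)) λ ()
  dec (rising u' 1 refl h' _ _) with position u' h'
  ... | falling d _ = double u' d
    where
    -- The 2 was preceded by a 1, necessarily the middle element; lowered, it lengthens the
    -- decreasing part by a second 1.
    double : ∀ u → Linked _≥_ (u ∷ʳ 1) → Linked _≥_ ((u ∷ʳ 1) ∷ʳ 1)
    double [] _ = ℕₚ.≤-refl ∷ [-]
    double (y ∷ []) (p ∷ _) = p ∷ ℕₚ.≤-refl ∷ [-]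
    double (y ∷ u@(_ ∷ _)) (p ∷ ps) = p ∷ double u ps
  ... | rising u'' z refl _ (s≤s z≤n) _ = contradiction (proj₂ (Allₚ.∷ʳ⁻ (proj₁ (Allₚ.∷ʳ⁻ h₁)))) λ ()
  dec (rising u' (suc (suc z)) refl _ (s≤s (s≤s ())) _)
  inc : Position u₁ 2 u₂ → Linked _<_ (1 ∷ u₂)
  inc p = go h₂ (hook-of p)
    where
    hook-of : Position u₁ 2 u₂ → Hook (2 ∷ u₂)
    hook-of (falling _ h') = h'
    hook-of (rising _ _ _ _ _ inc) = rise inc
    go : ∀ {l} → All (3 ≤_) l → Hook (2 ∷ l) → Linked _<_ (1 ∷ l)
    go [] _ = [-]
    go (p ∷ _) (fall q _) = contradiction (ℕₚ.≤-trans p q) λ { (s≤s (s≤s ())) }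
    go (p ∷ _) (rise (_ ∷ ps)) = ℕₚ.≤-trans (s≤s (s≤s z≤n)) p ∷ ps

hook-≥-< : ∀ {h l y z} → Hook (h ∷ l) → y ∷ z ∷ [] ⊆ l → h < y → y < z
hook-≥-< (rise inc) τ h<y = sorted (Linkedₚ.Linked⇒AllPairs ℕₚ.<-trans (Linked.tail inc)) τ
  where
  sorted : ∀ {l y z} → AllPairs _<_ l → y ∷ z ∷ [] ⊆ l → y < z
  sorted (_ ∷ ap) (_ ∷ˢ τ) = sorted ap τ
  sorted (px ∷ _) (refl ∷ τ) = All.head (Subₚ.All-resp-⊆ τ px)
hook-≥-< (fall p h) (_ ∷ˢ τ) h<y = hook-≥-< h τ (ℕₚ.≤-<-trans p h<y)
hook-≥-< (fall p h) (refl ∷ _) h<y = contradiction (ℕₚ.<-≤-trans h<y p) (ℕₚ.<-irrefl refl)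

-- A letter larger than some earlier one must lie in the increasing part, and so must everything
-- after it.
hook-ascent : ∀ {w x y z} → Hook w → x ∷ y ∷ z ∷ [] ⊆ w → x < y → y < z
hook-ascent h@(rise _) (refl ∷ τ) lt = hook-≥-< h τ lt
hook-ascent h@(fall _ _) (refl ∷ τ) lt = hook-≥-< h τ lt
hook-ascent (fall _ h) (_ ∷ˢ τ) lt = hook-ascent h τ lt
hook-ascent (rise {v = _ ∷ _} (_ ∷ inc)) (_ ∷ˢ τ) lt = hook-ascent (rise inc) τ lt

-- Domination from bracket matching

record Classifies (cl : PLetter → Br) (j k : ℕ) : Set where
  field
    isCls : ∀ x → cl x ≡ cls → num x ≡ j
    isOpn : ∀ x → cl x ≡ opn → num x ≡ k
    isNb  : ∀ x → cl x ≡ nb → num x ≢ j × num x ≢ k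
    j≢k   : j ≢ k

-- Each closing bracket of a prefix is matched by one of the `c` pending brackets or by an opening
-- bracket of that same prefix.
allMatched-dom : ∀ {cl j k} → Classifies cl j k → ∀ c w → AllMatched c (map cl w) →
                 ∀ s t → map num w ≡ s ++ t → occ j s ≤ c + occ k s
allMatched-dom C c w m [] t eq = z≤n
allMatched-dom {cl} {j} {k} C c (x ∷ w) m (y ∷ s) t eq = step c m (cl x) refl
  where
  open Classifies C
  x≡y = Lₚ.∷-injectiveˡ eq
  hit : ∀ {l} → num x ≡ l → occ l (y ∷ s) ≡ suc (occ l s)
  hit e = trans (cong (λ z → occ _ (z ∷ s)) (trans (sym x≡y) e)) (occ-here _ s)
  miss : ∀ {l} → num x ≢ l → occ l (y ∷ s) ≡ occ l s
  miss ne = occ-skip s (ne ∘ trans x≡y)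
  step : ∀ c → AllMatched c (cl x ∷ map cl w) → ∀ b → cl x ≡ b → occ j (y ∷ s) ≤ c + occ k (y ∷ s)
  step c m opn h rewrite miss (λ e → j≢k (trans (sym e) (isOpn x h))) | hit (isOpn x h) | h | ℕₚ.+-suc c (occ k s)
    = allMatched-dom C (suc c) w m s t (Lₚ.∷-injectiveʳ eq)
  step c m nb h rewrite miss (proj₁ (isNb x h)) | miss (proj₂ (isNb x h)) | h
    = allMatched-dom C c w m s t (Lₚ.∷-injectiveʳ eq)
  step zero m cls h rewrite h = ⊥-elim m
  step (suc c) m cls h rewrite hit (isCls x h) | miss (λ e → j≢k (trans (sym (isCls x h)) e)) | h
    = s≤s (allMatched-dom C c w m s t (Lₚ.∷-injectiveʳ eq))

br-nb⁻¹ : ∀ i x → br i x ≡ nb → num x ≢ i × num x ≢ suc i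
br-nb⁻¹ i (pl k p) h = (λ { refl → contradiction (trans (sym (br-cls i p)) h) λ () })
                     , (λ { refl → contradiction (trans (sym (br-opn i p)) h) λ () })

br-classifies : ∀ i → Classifies (br i) i (suc i)
br-classifies i = record { isCls = br-cls⁻¹ i ; isOpn = br-opn⁻¹ i ; isNb = br-nb⁻¹ i ; j≢k = λ () }

swap-br-classifies : ∀ i → Classifies (swap ∘ br i) (suc i) i
swap-br-classifies i = record { isCls = isCls ; isOpn = isOpn ; isNb = isNb ; j≢k = λ () }
  where
  isCls : ∀ x → swap (br i x) ≡ cls → num x ≡ suc i
  isCls x h with br i x in e
  ... | opn = br-opn⁻¹ i x e
  isOpn : ∀ x → swap (br i x) ≡ opn → num x ≡ i
  isOpn x h with br i x in e
  ... | cls = br-cls⁻¹ i x e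
  isNb : ∀ x → swap (br i x) ≡ nb → num x ≢ suc i × num x ≢ i
  isNb x h with br i x in e
  ... | nb = proj₂ (br-nb⁻¹ i x e) , proj₁ (br-nb⁻¹ i x e)

-- Hook words are read along the rows, in the direction opposite to revrow.
rowNums : Word → List ℕ
rowNums w = map num (reverse w)

rowNums-middle : ∀ a x b → rowNums (a ++ x ∷ b) ≡ rowNums b ++ num x ∷ rowNums a
rowNums-middle a x b = trans (cong (map num) (reverse-middle a x b)) (Lₚ.map-++ num (reverse b) _)

occ-reverse : ∀ j s → occ j (reverse s) ≡ occ j s
occ-reverse j [] = refl
occ-reverse j (k ∷ s) rewrite Lₚ.unfold-reverse k s | occ-++ j (reverse s) (k ∷ []) | occ-reverse j s
  = trans (ℕₚ.+-comm (occ j s) _) (sym (occ-++ j (k ∷ []) s))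

prefix⇒suffix : ∀ {i j w} → PrefixDom i j w → SuffixDom i j (reverse w)
prefix⇒suffix {i} {j} {w} dom s t eq =
  subst₂ _≤_ (occ-reverse i t) (occ-reverse j t) (dom (reverse t) (reverse s) eq')
  where
  eq' : w ≡ reverse t ++ reverse s
  eq' = trans (sym (Lₚ.reverse-involutive w)) (trans (cong reverse eq) (Lₚ.reverse-++ s t))

module _ {i a b} (hp : pending 0 (map (br i) a) ≡ 0) (hm : AllMatched 0 (map (br i) b)) where

  flip-suffixDom : SuffixDom i (suc i) (rowNums b)
  flip-suffixDom = subst (SuffixDom i (suc i)) (sym (Lₚ.reverse-map num b))
    (prefix⇒suffix (allMatched-dom (br-classifies i) 0 b hm))

  flip-prefixDom : PrefixDom (suc i) i (rowNums a)
  flip-prefixDom = allMatched-dom (swap-br-classifies i) 0 (reverse a) (Equivalence.to (pending≡0⇔ i a) hp)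

  flip-suffixDomʷ : SuffixDom (suc i) i (map num a)
  flip-suffixDomʷ = subst (SuffixDom (suc i) i)
    (trans (sym (Lₚ.reverse-map num (reverse a))) (cong (map num) (Lₚ.reverse-involutive a)))
    (prefix⇒suffix flip-prefixDom)

-- Admissible primes

-- For a row read from right to left: a primed letter is the first minimum.
PrimeOrder : PLetter → PLetter → Set
PrimeOrder x y = (primed x ≡ true → num x ≤ num y) × (primed y ≡ true → num y < num x)

PrimesOK : Word → Set
PrimesOK = AllPairs PrimeOrder

module _ {A : Set} {R : A → A → Set} where

  allPairs-middle⁻ : ∀ a {x b} → AllPairs R (a ++ x ∷ b) → All (λ z → R z x) a × All (R x) b
  allPairs-middle⁻ [] (h ∷ _) = [] , h
  allPairs-middle⁻ (y ∷ a) (h ∷ hs) with allPairs-middle⁻ a hs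
  ... | l , r = All.head (Allₚ.++⁻ʳ a h) ∷ l , r

  allPairs-replace : ∀ a {x y b} → AllPairs R (a ++ x ∷ b) → All (λ z → R z y) a → All (R y) b →
                     AllPairs R (a ++ y ∷ b)
  allPairs-replace [] (_ ∷ hs) _ r = r ∷ hs
  allPairs-replace (z ∷ a) (h ∷ hs) (l ∷ ls) r =
    Allₚ.++⁺ (Allₚ.++⁻ˡ a h) (l ∷ All.tail (Allₚ.++⁻ʳ a h)) ∷ allPairs-replace a hs ls r

  allPairs-++⁻ˡ : ∀ a {b} → AllPairs R (a ++ b) → AllPairs R a
  allPairs-++⁻ˡ [] _ = []
  allPairs-++⁻ˡ (x ∷ a) (h ∷ hs) = Allₚ.++⁻ˡ a h ∷ allPairs-++⁻ˡ a hs

absent⇒occ≡0 : ∀ {j} w → All (λ z → num z ≢ j) w → occ j (map num w) ≡ 0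
absent⇒occ≡0 [] [] = refl
absent⇒occ≡0 (x ∷ w) (h ∷ hs) = trans (occ-skip (map num w) h) (absent⇒occ≡0 w hs)

occ≡0⇒absent : ∀ {j} w → occ j (map num w) ≡ 0 → All (λ z → num z ≢ j) w
occ≡0⇒absent [] _ = []
occ≡0⇒absent {j} (x ∷ w) h with num x ≟ j
... | yes refl = contradiction (trans (sym h) (occ-here (num x) (map num w))) λ ()
... | no ne = ne ∷ occ≡0⇒absent w (trans (sym (occ-skip (map num w) ne)) h)

module _ {i a b} (hp : pending 0 (map (br i) a) ≡ 0) (hm : AllMatched 0 (map (br i) b)) where

  -- In the row, `b` comes before the changed letter. A letter i there would be followed in `b` by a
  -- letter i + 1, and after that ascent the hook could only continue above i + 1, contrary to
  -- `k ≤ suc i`.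
  flip-absent : ∀ {k p} → k ≤ suc i → Hook (rowNums (a ++ pl k p ∷ b)) → All (λ z → num z ≢ i) b
  flip-absent {k} {p} le h = occ≡0⇒absent b (trans (sym (occ-reverse i (map num b)))
    (trans (cong (occ i) (sym (Lₚ.reverse-map num b))) occ≡0))
    where
    h' : Hook (rowNums b ++ k ∷ rowNums a)
    h' = subst Hook (rowNums-middle a (pl k p) b) h
    occ≡0 : occ i (rowNums b) ≡ 0
    occ≡0 with occ i (rowNums b) in e
    ... | zero = refl
    ... | suc _ = contradiction
      (hook-ascent h' (Subₚ.++⁺ (insert-after {i} (λ ()) {rowNums b} [] (flip-suffixDom {a = a} {b} hp hm)
                         (occ⇒replicate-⊆ 1 i (rowNums b) (subst (1 ≤_) (sym e) (s≤s z≤n))))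
                       (refl ∷ minimum (rowNums a)))
                   (ℕₚ.n<1+n i))
      (ℕₚ.≤⇒≯ le)

  flip-primes-up : ∀ {p} → Hook (rowNums (a ++ pl i p ∷ b)) → PrimesOK (a ++ pl i p ∷ b) →
                   PrimesOK (a ++ pl (suc i) p ∷ b)
  flip-primes-up {p} h ok with allPairs-middle⁻ a ok
  ... | l , r = allPairs-replace a ok
    (All.zipWith (λ { ((h₁ , h₂) , h₃) → (ℕₚ.m≤n⇒m≤1+n ∘ h₁) , λ e → ℕₚ.≤∧≢⇒< (h₂ e) (h₃ e ∘ sym) })
       (l , absent p l))
    (All.zipWith (λ { ((h₁ , h₂) , h₃) → (λ e → ℕₚ.≤∧≢⇒< (h₁ e) (h₃ ∘ sym)) , ℕₚ.m<n⇒m<1+n ∘ h₂ })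
       (r , flip-absent (ℕₚ.n≤1+n i) h))
    where
    -- If the changed letter is primed, all of `a` exceeds i, so `a` has no i; by domination it has
    -- no i + 1 either.
    absent : ∀ p → All (λ z → PrimeOrder z (pl i p)) a → All (λ z → p ≡ true → num z ≢ suc i) a
    absent false l = All.map (λ _ ()) l
    absent true  l = All.map (λ ne _ → ne) (occ≡0⇒absent a (ℕₚ.n≤0⇒n≡0 (ℕₚ.≤-trans
      (flip-suffixDomʷ {a = a} {b} hp hm [] (map num a) refl)
      (ℕₚ.≤-reflexive (absent⇒occ≡0 a (All.map (λ h → ℕₚ.<⇒≢ (proj₂ h refl) ∘ sym) l))))))

  flip-primes-down : ∀ {p} → Hook (rowNums (a ++ pl (suc i) p ∷ b)) → PrimesOK (a ++ pl (suc i) p ∷ b) →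
                     PrimesOK (a ++ pl i p ∷ b)
  flip-primes-down {p} h ok with allPairs-middle⁻ a ok
  ... | l , r = allPairs-replace a ok
    (All.zipWith (λ { ((h₁ , h₂) , h₃) → (λ e → ℕₚ.≤-pred (ℕₚ.≤∧≢⇒< (h₁ e) (h₃ e))) , ℕₚ.<-trans (ℕₚ.n<1+n i) ∘ h₂ })
       (l , absent a (allPairs-++⁻ˡ a ok) (flip-suffixDomʷ {a = a} {b} hp hm)))
    (All.zipWith (λ { ((h₁ , h₂) , h₃) → ℕₚ.≤-trans (ℕₚ.n≤1+n i) ∘ h₁ , λ e → ℕₚ.≤∧≢⇒< (ℕₚ.≤-pred (h₂ e)) h₃ })
       (r , flip-absent ℕₚ.≤-refl h))
    where
    -- After a primed letter i + 1 nothing in `a` is smaller, so the suffix starting there has an i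
    -- + 1 but no i, against domination.
    absent : ∀ a → PrimesOK a → SuffixDom (suc i) i (map num a) → All (λ z → primed z ≡ true → num z ≢ suc i) a
    absent [] _ _ = []
    absent (z ∷ a) (hz ∷ ok) dom = head ∷ absent a ok (suffixDom-tail dom)
      where
      head : primed z ≡ true → num z ≢ suc i
      head e refl = contradiction (dom [] (map num (z ∷ a)) refl) (ℕₚ.<⇒≱ lt)
        where
        lt : occ i (map num (z ∷ a)) < occ (suc i) (map num (z ∷ a))
        lt rewrite occ-here (suc i) (map num a) | occ-skip {i} (map num a) (λ (e : suc i ≡ i) → ℕₚ.1+n≢n e)
                 | absent⇒occ≡0 a (All.map (λ h → ℕₚ.<⇒≢ (proj₁ h e) ∘ sym) hz) = s≤s z≤n

-- The part of a Bar seen by a factor with only the first of the two letters.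
data Half (p q : Bool) : Word → Word → Set where
  here : ∀ {w} → No1 w → Half p q (pl 1 p ∷ w) (pl 2 q ∷ w)
  skip : ∀ {x w v} → Outside12 x → Half p q w v → Half p q (x ∷ w) (x ∷ v)

half-touch : ∀ {p q w v} → Half p q w v → Pointwise (Touch (Block 1)) w v
half-touch (here _)   = inj₂ (inj₁ refl , inj₂ refl) ∷ touch-refl _
half-touch (skip _ h) = inj₁ refl ∷ half-touch h

Positive : Word → Set
Positive = All (λ x → 1 ≤ num x)

Low : ℕ → Word → Set
Low m = Any (λ y → num y ≤ m)

-- A later letter is smaller than `x`, so `x` cannot be primed; and rewritten letters stay below
-- `x`, so they may be primed as far as `x` is concerned.
order-touch : ∀ {C m x w v} → (∀ {k} → C k → k ≤ m) → m < num x → Low m w →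
              Pointwise (Touch C) w v → All (PrimeOrder x) w → All (PrimeOrder x) v
order-touch {C} {m} {x} bound lt low = λ ss hs → go ss hs (unprimed (All.lookupAny hs low))
  where
  unprimed : ∀ {y} → PrimeOrder x y × num y ≤ m → primed x ≢ true
  unprimed ((h , _) , le) e = contradiction (ℕₚ.≤-trans (h e) le) (ℕₚ.<⇒≱ lt)
  go : ∀ {w v} → Pointwise (Touch C) w v → All (PrimeOrder x) w → primed x ≢ true → All (PrimeOrder x) v
  go [] [] _ = []
  go (inj₁ refl ∷ ss) (h ∷ hs) np = h ∷ go ss hs np
  go (inj₂ (_ , c) ∷ ss) (_ ∷ hs) np =
    ((λ e → contradiction e np) , (λ _ → ℕₚ.≤-<-trans (bound c) lt)) ∷ go ss hs np

block1-≤2 : ∀ {k} → Block 1 k → k ≤ 2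
block1-≤2 (inj₁ refl) = s≤s z≤n
block1-≤2 (inj₂ refl) = s≤s (s≤s z≤n)

outside12->2 : ∀ {k} → 1 ≤ k → k ≢ 1 × k ≢ 2 → 2 < k
outside12->2 {1} _ (h , _) = contradiction refl h
outside12->2 {2} _ (_ , h) = contradiction refl h
outside12->2 {suc (suc (suc k))} _ _ = s≤s (s≤s (s≤s z≤n))

rep-low : ∀ {p q w v} → Rep p q w v → Low 1 w
rep-low here       = here (s≤s z≤n)
rep-low (skip _ r) = there (rep-low r)

half-low : ∀ {p q w v} → Half p q w v → Low 2 w × Low 2 v
half-low (here _)   = here (s≤s z≤n) , here (s≤s (s≤s z≤n))
half-low (skip _ h) = there (proj₁ (half-low h)) , there (proj₂ (half-low h))

bar-low : ∀ {w v} → Bar w v → Low 2 w × Low 2 v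
bar-low (lone _)   = here (s≤s z≤n) , here (s≤s (s≤s z≤n))
bar-low (pair _)   = here (s≤s z≤n) , here (s≤s (s≤s z≤n))
bar-low (skip _ h) = there (proj₁ (bar-low h)) , there (proj₂ (bar-low h))

-- The first letter with number 1 in a positive word is its first minimum, precisely where a prime
-- is allowed.
rep-primes : ∀ {p q w v} → Rep p q w v → Positive w → PrimesOK w → PrimesOK v
rep-primes here (_ ∷ pos) (h ∷ ok) =
  All.zipWith (λ { (le , _ , h₂) → (λ _ → le) , h₂ }) (pos , h) ∷ ok
rep-primes (skip ne r) (le ∷ pos) (h ∷ ok) =
  order-touch {C = _≡ 1} (λ { refl → ℕₚ.≤-refl }) (ℕₚ.≤∧≢⇒< le (ne ∘ sym)) (rep-low r) (rep-touch refl r) h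
  ∷ rep-primes r pos ok

after-1 : ∀ {p y} → 1 ≤ num y → PrimeOrder (pl 1 p) y → primed y ≢ true
after-1 le (_ , h) e = contradiction (ℕₚ.≤-trans (h e) le) (ℕₚ.<-irrefl refl)

after-1-order : ∀ {x p w} → 1 ≤ num x → Positive w → All (λ y → primed x ≡ true → num x ≤ num y) w →
                All (PrimeOrder (pl 1 p)) w → All (PrimeOrder x) w
after-1-order le [] [] [] = []
after-1-order le (py ∷ pos) (l ∷ ls) (h ∷ hs) =
  (l , λ e → contradiction e (after-1 py h)) ∷ after-1-order le pos ls hs

half-primes-up : ∀ {p q w v} → Half p q w v → Positive w → PrimesOK w → PrimesOK v
half-primes-up (here no1) (_ ∷ pos) (h ∷ ok) =
  after-1-order (s≤s z≤n) pos (All.zipWith (λ { (le , ne) _ → ℕₚ.≤∧≢⇒< le (ne ∘ sym) }) (pos , no1)) h ∷ ok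
half-primes-up (skip o b) (le ∷ pos) (h ∷ ok) =
  order-touch block1-≤2 (outside12->2 le o) (proj₁ (half-low b)) (half-touch b) h ∷ half-primes-up b pos ok

half-primes-down : ∀ {p q w v} → Half p q w v → Positive v → PrimesOK v → PrimesOK w
half-primes-down (here no1) (_ ∷ pos) (h ∷ ok) =
  All.zipWith (λ { ((le , ne) , _ , h₂) → (λ _ → le) , λ e → contradiction (ℕₚ.≤-antisym (ℕₚ.≤-pred (h₂ e)) le) ne })
    (All.zip (pos , no1) , h) ∷ ok
half-primes-down (skip o b) (le ∷ pos) (h ∷ ok) =
  order-touch block1-≤2 (outside12->2 le o) (proj₂ (half-low b)) (touch-sym (half-touch b)) h
  ∷ half-primes-down b pos ok

rep-All : ∀ {P : PLetter → Set} {p q w v} → Rep p q w v → All P w → P (pl 1 p)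
rep-All here       (h ∷ _)  = h
rep-All (skip _ r) (_ ∷ hs) = rep-All r hs

rep-replace : ∀ {P : PLetter → Set} {p q w v} → Rep p q w v → P (pl 1 q) → All P w → All P v
rep-replace here       h (_ ∷ hs) = h ∷ hs
rep-replace (skip _ r) h (x ∷ hs) = x ∷ rep-replace r h hs

-- Within one row the second 1 is never primed. So `pair` can only hand the prime of the first 1 to
-- the second, which becomes the first minimum when the first turns into a 2. This is why f_1bar
-- exchanges primes.
bar-primes-up : ∀ {w v} → Bar w v → Positive w → PrimesOK w → PrimesOK v
bar-primes-up (lone no1) pos ok = half-primes-up (here no1) pos ok
bar-primes-up (pair {q = true} r) _ (h ∷ _) = contradiction (proj₂ (rep-All r h) refl) (ℕₚ.<-irrefl refl)
bar-primes-up (pair {q = false} r) (_ ∷ pos) (h ∷ ok) =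
  rep-replace r ((λ ()) , λ _ → s≤s (s≤s z≤n))
    (All.zipWith (λ { (le , h) → (λ ()) , λ e → contradiction e (after-1 le h) }) (pos , h))
  ∷ rep-primes r pos ok
bar-primes-up (skip o b) (le ∷ pos) (h ∷ ok) =
  order-touch block1-≤2 (outside12->2 le o) (proj₁ (bar-low b)) (bar-touch b) h ∷ bar-primes-up b pos ok

bar-primes-down : ∀ {w v} → Bar w v → Positive v → PrimesOK v → PrimesOK w
bar-primes-down (lone no1) pos ok = half-primes-down (here no1) pos ok
bar-primes-down (pair {q = true} r) _ (h ∷ _) =
  contradiction (proj₁ (rep-All (Rep-sym r) h) refl) λ { (s≤s ()) }
bar-primes-down (pair {p} {false} r) (_ ∷ pos) (h ∷ ok) = go r pos h ok ∷ rep-primes (Rep-sym r) pos ok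
  where
  go : ∀ {w v} → Rep false p w v → Positive v → All (PrimeOrder (pl 2 false)) v → PrimesOK v →
       All (PrimeOrder (pl 1 p)) w
  go here (_ ∷ pos) _ (h ∷ _) = ((λ _ → ℕₚ.≤-refl) , λ ())
    ∷ All.zipWith (λ { (le , h) → (λ _ → le) , λ e → contradiction e (after-1 le h) }) (pos , h)
  go (skip ne r) (le ∷ pos) ((_ , h) ∷ hs) (_ ∷ ok) =
    ((λ _ → le) , λ e → contradiction (ℕₚ.≤-antisym (ℕₚ.≤-pred (h e)) le) ne) ∷ go r pos hs ok
bar-primes-down (skip o b) (le ∷ pos) (h ∷ ok) =
  order-touch block1-≤2 (outside12->2 le o) (proj₂ (bar-low b)) (touch-sym (bar-touch b)) h
  ∷ bar-primes-down b pos ok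

-- The effect of an operator on a factor of a word

-- Chosen to be closed under restriction to factors. When the two letters of `pair` fall into
-- different factors, the first factor sees a `half` and the second a `rep`.
data Move (n : ℕ) : Word → Word → Set where
  stay : ∀ {w} → Move n w w
  flip : ∀ {i w v} → ValidIdx n i → Flip i w v → Move n w v
  bar  : ∀ {w v} → Bar w v → Move n w v
  half : ∀ {p q w v} → Half p q w v → Move n w v
  rep  : ∀ {p q w v} → Rep p q w v → Move n w v

Letters : ℕ → Word → Set
Letters n = All (InRange n ∘ num)

letters⇒positive : ∀ {n w} → Letters n w → Positive w
letters⇒positive = All.map proj₁

-- The interface between words and tableaux, met by `Move` and by its converse, so that raising and
-- lowering operators share one argument. `extends` keeps rows hooks; `reflects` keeps them maximal.
record Admissible (n : ℕ) (G : Word → Word → Set) : Set where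
  field
    length-eq  : ∀ {w v} → G w v → length w ≡ length v
    factors    : ∀ a b a' b' → G (a ++ b) (a' ++ b') → length a ≡ length a' → G a a' × G b b'
    letters    : ∀ {w v} → G w v → Letters n w → Letters n v
    extends    : ∀ {w v} → G w v → Letters n w → HookExtends (rowNums w) (rowNums v)
    reflects   : ∀ {w v} → G w v → Letters n w → HookExtends (rowNums v) (rowNums w)
    primes     : ∀ {w v} → G w v → Letters n w → Hook (rowNums w) → PrimesOK w → PrimesOK v

move-length : ∀ {n w v} → Move n w v → length w ≡ length v
move-length stay       = refl
move-length (flip _ f) = PW.Pointwise-length (flip-touch f)
move-length (bar b)    = PW.Pointwise-length (bar-touch b)
move-length (half h)   = PW.Pointwise-length (half-touch h)
move-length (rep r)    = PW.Pointwise-length (rep-touch {_≡ 1} refl r)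

allMatched-++⁻ˡ : ∀ c bs {cs} → AllMatched c (bs ++ cs) → AllMatched c bs
allMatched-++⁻ˡ c [] _ = tt
allMatched-++⁻ˡ c (opn ∷ bs) m = allMatched-++⁻ˡ (suc c) bs m
allMatched-++⁻ˡ (suc c) (cls ∷ bs) m = allMatched-++⁻ˡ c bs m
allMatched-++⁻ˡ c (nb ∷ bs) m = allMatched-++⁻ˡ c bs m

next-mono : ∀ b {c d} → c ≤ d → next c b ≤ next d b
next-mono opn = s≤s
next-mono cls = ℕₚ.∸-monoˡ-≤ 1
next-mono nb  = λ le → le

pending-mono : ∀ bs {c d} → c ≤ d → pending c bs ≤ pending d bs
pending-mono []       le = le
pending-mono (b ∷ bs) le = pending-mono bs (next-mono b le)

-- The final count is monotone in the initial one, so forgetting what `bs` leaves pending cannot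
-- increase it. This lets a `Flip` be cut down to a right factor.
pending-++⁻ʳ : ∀ bs cs → pending 0 (bs ++ cs) ≡ 0 → pending 0 cs ≡ 0
pending-++⁻ʳ bs cs h =
  ℕₚ.n≤0⇒n≡0 (ℕₚ.≤-trans (pending-mono cs z≤n) (ℕₚ.≤-reflexive (trans (sym (Lₚ.foldl-++ next 0 bs cs)) h)))

data Locate {A : Set} (a b : List A) : List A → A → List A → Set where
  left  : ∀ {s x t} → a ≡ s ++ x ∷ t → Locate a b s x (t ++ b)
  right : ∀ {s x t} → b ≡ s ++ x ∷ t → Locate a b (a ++ s) x t

locate : ∀ {A : Set} (a b s : List A) {x t} → a ++ b ≡ s ++ x ∷ t → Locate a b s x t
locate []      b s  eq   = right eq
locate (y ∷ a) b [] refl = left refl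
locate (y ∷ a) b (z ∷ s) eq with Lₚ.∷-injective eq
... | refl , eq' with locate a b s eq'
... | left refl = left refl
... | right h   = right h

FactorMove : ℕ → Word → Word → Word → Set
FactorMove n a b v = ∃[ a' ] ∃[ b' ] (v ≡ a' ++ b' × Move n a a' × Move n b b')

flip-factors : ∀ {n i} → ValidIdx n i → ∀ a b {w v} → w ≡ a ++ b → Flip i w v → FactorMove n a b v
flip-factors {n} {i} valid a b eq (flip s p t hp hm) with locate a b s (sym eq)
... | left {t = t'} refl = _ , b , sym (Lₚ.++-assoc s _ b)
    , flip valid (flip s p t' hp (allMatched-++⁻ˡ 0 (map (br i) t') (subst (AllMatched 0) (Lₚ.map-++ (br i) t' b) hm))) , stay
... | right {s = s'} refl = a , _ , Lₚ.++-assoc a s' _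
    , stay , flip valid (flip s' p t (pending-++⁻ʳ (map (br i) a) _ (trans (cong (pending 0) (sym (Lₚ.map-++ (br i) a s'))) hp)) hm)

rep-++⁻ : ∀ {p q} a b {v} → Rep p q (a ++ b) v →
  (∃[ a' ] (v ≡ a' ++ b × Rep p q a a')) ⊎ (∃[ b' ] (v ≡ a ++ b' × No1 a × Rep p q b b'))
rep-++⁻ []      b r = inj₂ (_ , refl , [] , r)
rep-++⁻ (x ∷ a) b here = inj₁ (_ , refl , here)
rep-++⁻ (x ∷ a) b (skip h r) with rep-++⁻ a b r
... | inj₁ (a' , refl , r') = inj₁ (x ∷ a' , refl , skip h r')
... | inj₂ (b' , refl , hs , r') = inj₂ (b' , refl , h ∷ hs , r')

half-++⁻ : ∀ {p q} a b {v} → Half p q (a ++ b) v →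
  (∃[ a' ] (v ≡ a' ++ b × Half p q a a')) ⊎ (∃[ b' ] (v ≡ a ++ b' × Half p q b b'))
half-++⁻ []      b h = inj₂ (_ , refl , h)
half-++⁻ (x ∷ a) b (here no1) = inj₁ (_ , refl , here (Allₚ.++⁻ˡ a no1))
half-++⁻ (x ∷ a) b (skip o h) with half-++⁻ a b h
... | inj₁ (a' , refl , h') = inj₁ (x ∷ a' , refl , skip o h')
... | inj₂ (b' , refl , h') = inj₂ (b' , refl , h')

-- In the third case the two letters changed by f_1bar lie in different factors.
bar-++⁻ : ∀ a b {v} → Bar (a ++ b) v →
  (∃[ a' ] (v ≡ a' ++ b × Bar a a')) ⊎ (∃[ b' ] (v ≡ a ++ b' × Bar b b'))
  ⊎ ∃[ p ] ∃[ q ] ∃[ a' ] ∃[ b' ] (v ≡ a' ++ b' × Half p q a a' × Rep q p b b')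
bar-++⁻ [] b h = inj₂ (inj₁ (_ , refl , h))
bar-++⁻ (x ∷ a) b (lone no1) = inj₁ (_ , refl , lone (Allₚ.++⁻ˡ a no1))
bar-++⁻ (x ∷ a) b (pair r) with rep-++⁻ a b r
... | inj₁ (a' , refl , r') = inj₁ (_ ∷ a' , refl , pair r')
... | inj₂ (b' , refl , hs , r') = inj₂ (inj₂ (_ , _ , _ , b' , refl , here hs , r'))
bar-++⁻ (x ∷ a) b (skip o h) with bar-++⁻ a b h
... | inj₁ (a' , refl , h') = inj₁ (x ∷ a' , refl , skip o h')
... | inj₂ (inj₁ (b' , refl , h')) = inj₂ (inj₁ (b' , refl , h'))
... | inj₂ (inj₂ (p , q , a' , b' , refl , h' , r')) = inj₂ (inj₂ (p , q , x ∷ a' , b' , refl , skip o h' , r'))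

factorMove : ∀ {n} a b {v} → Move n (a ++ b) v → FactorMove n a b v
factorMove a b stay = a , b , refl , stay , stay
factorMove a b (flip valid f) = flip-factors valid a b refl f
factorMove a b (bar h) with bar-++⁻ a b h
... | inj₁ (a' , eq , h') = a' , b , eq , bar h' , stay
... | inj₂ (inj₁ (b' , eq , h')) = a , b' , eq , stay , bar h'
... | inj₂ (inj₂ (p , q , a' , b' , eq , h' , r')) = a' , b' , eq , half h' , rep r'
factorMove a b (half h) with half-++⁻ a b h
... | inj₁ (a' , eq , h') = a' , b , eq , half h' , stay
... | inj₂ (b' , eq , h') = a , b' , eq , stay , half h'
factorMove a b (rep r) with rep-++⁻ a b r
... | inj₁ (a' , eq , r') = a' , b , eq , rep r' , stay
... | inj₂ (b' , eq , _ , r') = a , b' , eq , stay , rep r'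

++-injective : ∀ {A : Set} (a a' : List A) {b b'} → length a ≡ length a' → a ++ b ≡ a' ++ b' → a ≡ a' × b ≡ b'
++-injective []      []        _   eq = refl , eq
++-injective (x ∷ a) (x' ∷ a') len eq with Lₚ.∷-injective eq
... | refl , eq' with ++-injective a a' (ℕₚ.suc-injective len) eq'
... | refl , eqb = refl , eqb

move-factors : ∀ {n} a b a' b' → Move n (a ++ b) (a' ++ b') → length a ≡ length a' → Move n a a' × Move n b b'
move-factors a b a' b' m len with factorMove a b m
... | a'' , b'' , eq , ma , mb with ++-injective a'' a' (trans (sym (move-length ma)) len) (sym eq)
... | refl , refl = ma , mb

module _ {n : ℕ} (2≤n : 2 ≤ n) where

  letter-touch : ∀ {i w v} → ValidIdx n i → Pointwise (Touch (Block i)) w v → Letters n w → Letters n v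
  letter-touch (1≤i , i<n) [] [] = []
  letter-touch valid (inj₁ refl ∷ ss) (h ∷ hs) = h ∷ letter-touch valid ss hs
  letter-touch valid@(1≤i , i<n) (inj₂ (_ , inj₁ refl) ∷ ss) (_ ∷ hs) = (1≤i , ℕₚ.<⇒≤ i<n) ∷ letter-touch valid ss hs
  letter-touch valid@(1≤i , i<n) (inj₂ (_ , inj₂ refl) ∷ ss) (_ ∷ hs) = (s≤s z≤n , i<n) ∷ letter-touch valid ss hs

  -- For the bar moves the block is that of 1 and 2, and 2 is in range because `2 ≤ n`.
  move-touch : ∀ {w v} → Move n w v → ∃[ i ] (ValidIdx n i × Pointwise (Touch (Block i)) w v)
  move-touch stay           = 1 , (s≤s z≤n , 2≤n) , touch-refl _
  move-touch (flip valid f) = _ , valid , flip-touch f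
  move-touch (bar b)        = 1 , (s≤s z≤n , 2≤n) , bar-touch b
  move-touch (half h)       = 1 , (s≤s z≤n , 2≤n) , half-touch h
  move-touch (rep r)        = 1 , (s≤s z≤n , 2≤n) , rep-touch (inj₁ refl) r

  move-letters : ∀ {w v} → Move n w v → Letters n w ⇔ Letters n v
  move-letters m = let _ , valid , t = move-touch m
                   in mk⇔ (letter-touch valid t) (letter-touch valid (touch-sym t))

half-raise : ∀ {p q w v} → Half p q w v → Raise (λ k → k ≢ 1 × k ≢ 2) 1 w v
half-raise (here _) = raise {before = []} refl refl []
half-raise (skip {x} o h) with half-raise h
... | raise eqw eqv rs = raise (cong (num x ∷_) eqw) (cong (num x ∷_) eqv) (o ∷ rs)

hookExtends-refl : ∀ {w} → HookExtends w w
hookExtends-refl u τ h = u , τ , h , ℕₚ.≤-refl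

flip-extends : ∀ {i w v} → Flip i w v →
               HookExtends (rowNums w) (rowNums v) × HookExtends (rowNums v) (rowNums w)
flip-extends {i} (flip a p b hp hm)
  rewrite rowNums-middle a (pl i p) b | rowNums-middle a (pl (suc i) p) b =
  hook-up i _ _ (flip-suffixDom {a = a} {b} hp hm) (flip-prefixDom {a = a} {b} hp hm) ,
  hook-down i _ _ (flip-suffixDom {a = a} {b} hp hm) (flip-prefixDom {a = a} {b} hp hm)

all-reverse : ∀ {A : Set} {P : A → Set} {w} → All P w → All P (reverse w)
all-reverse {w = w} = All-resp-↭ (↭-sym (↭-reverse w))

raise-extends : ∀ {w v} → Raise (λ k → k ≢ 1 × k ≢ 2) 1 w v → Positive w →
                HookExtends (rowNums w) (rowNums v) × HookExtends (rowNums v) (rowNums w)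
raise-extends {w} {v} (raise {ks} {ls} eqw eqv rs) pos
  rewrite Lₚ.reverse-map num w | Lₚ.reverse-map num v
        | eqw | eqv | reverse-middle ks 1 ls | reverse-middle ks 2 ls =
  hook-up-bar _ _ (all-reverse hls) (all-reverse hks) , hook-down-bar _ _ (all-reverse hls) (all-reverse hks)
  where
  pos' : All (1 ≤_) (ks ++ 1 ∷ ls)
  pos' = subst (All (1 ≤_)) eqw (Allₚ.map⁺ pos)
  hls : All (1 ≤_) ls
  hls = All.tail (Allₚ.++⁻ʳ ks pos')
  hks : All (3 ≤_) ks
  hks = All.zipWith (λ (le , o) → outside12->2 le o) (Allₚ.++⁻ˡ ks pos' , rs)

move-extends : ∀ {n w v} → Move n w v → Positive w →
               HookExtends (rowNums w) (rowNums v) × HookExtends (rowNums v) (rowNums w)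
move-extends stay _ = hookExtends-refl , hookExtends-refl
move-extends (flip _ f) _ = flip-extends f
move-extends (bar b) pos = raise-extends (bar-raise b) pos
move-extends (half h) pos = raise-extends (half-raise h) pos
move-extends {w = w} {v} (rep r) _
  rewrite Lₚ.reverse-map num w | Lₚ.reverse-map num v | rep-num r = hookExtends-refl , hookExtends-refl

move-primes-up : ∀ {n w v} → Move n w v → Positive w → Hook (rowNums w) → PrimesOK w → PrimesOK v
move-primes-up stay _ _ ok = ok
move-primes-up (flip _ (flip a p b hp hm)) _ h ok = flip-primes-up hp hm h ok
move-primes-up (bar b) pos _ ok = bar-primes-up b pos ok
move-primes-up (half h) pos _ ok = half-primes-up h pos ok
move-primes-up (rep r) pos _ ok = rep-primes r pos ok

move-primes-down : ∀ {n w v} → Move n w v → Positive v → Hook (rowNums v) → PrimesOK v → PrimesOK w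
move-primes-down stay _ _ ok = ok
move-primes-down (flip _ (flip a p b hp hm)) _ h ok = flip-primes-down hp hm h ok
move-primes-down (bar b) pos _ ok = bar-primes-down b pos ok
move-primes-down (half h) pos _ ok = half-primes-down h pos ok
move-primes-down (rep r) pos _ ok = rep-primes (Rep-sym r) pos ok

move-admissible : ∀ {n} → 2 ≤ n → Admissible n (Move n)
move-admissible 2≤n = record
  { length-eq = move-length
  ; factors   = move-factors
  ; letters   = λ m → Equivalence.to (move-letters 2≤n m)
  ; extends   = λ m ls → proj₁ (move-extends m (letters⇒positive ls))
  ; reflects  = λ m ls → proj₂ (move-extends m (letters⇒positive ls))
  ; primes    = λ m ls → move-primes-up m (letters⇒positive ls)
  }

move-admissible⁻¹ : ∀ {n} → 2 ≤ n → Admissible n (λ v w → Move n w v)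
move-admissible⁻¹ {n} 2≤n = record
  { length-eq = sym ∘ move-length
  ; factors   = λ a b a' b' m len → move-factors a' b' a b m (sym len)
  ; letters   = λ m → Equivalence.from (move-letters 2≤n m)
  ; extends   = λ m ls → proj₂ (move-extends m (back m ls))
  ; reflects  = λ m ls → proj₁ (move-extends m (back m ls))
  ; primes    = λ m ls → move-primes-down m (letters⇒positive ls)
  }
  where
  back : ∀ {w v} → Move n w v → Letters n v → Positive w
  back m ls = letters⇒positive (Equivalence.from (move-letters 2≤n m) ls)

-- Primed rows

Unprimed : Word → Set
Unprimed = All (λ x → primed x ≡ false)

unprimed⇒map-unp : ∀ r → Unprimed r → r ≡ map unp (map num r)
unprimed⇒map-unp [] [] = refl
unprimed⇒map-unp (pl k false ∷ r) (refl ∷ hs) = cong (pl k false ∷_) (unprimed⇒map-unp r hs)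

map-unp-unprimed : ∀ ρ → Unprimed (map unp ρ)
map-unp-unprimed []      = []
map-unp-unprimed (k ∷ ρ) = refl ∷ map-unp-unprimed ρ

num-unp : ∀ ρ → map num (map unp ρ) ≡ ρ
num-unp ρ = trans (sym (Lₚ.map-∘ ρ)) (Lₚ.map-id ρ)

unprimed-order : ∀ {x y} → primed x ≡ false → primed y ≡ false → PrimeOrder x y
unprimed-order h h' = (λ e → contradiction (trans (sym h) e) λ ()) , (λ e → contradiction (trans (sym h') e) λ ())

unprimed⇒primesOK : ∀ {w} → Unprimed w → PrimesOK w
unprimed⇒primesOK []       = []
unprimed⇒primesOK (h ∷ hs) = All.map (unprimed-order h) hs ∷ unprimed⇒primesOK hs

primeRow-num : ∀ {ρ r} → PrimeRow ρ r → map num r ≡ ρ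
primeRow-num {ρ} (inj₁ refl) = num-unp ρ
primeRow-num (inj₂ (u , m , v , (refl , _) , refl)) =
  trans (Lₚ.map-++ num (map unp u) _) (cong₂ (λ x y → x ++ m ∷ y) (num-unp u) (num-unp v))

primeRow⇒primesOK : ∀ {ρ r} → PrimeRow ρ r → PrimesOK (reverse r)
primeRow⇒primesOK {ρ} (inj₁ refl) = unprimed⇒primesOK (all-reverse (map-unp-unprimed ρ))
primeRow⇒primesOK (inj₂ (u , m , v , (_ , dec , inc) , refl))
  rewrite reverse-middle (map unp u) (pl m true) (map unp v) =
  -- The row without its prime satisfies the order trivially; only comparisons with the middle
  -- letter then have to be replaced.
  allPairs-replace (reverse (map unp v)) {x = pl m false}
    (unprimed⇒primesOK (Allₚ.++⁺ (all-reverse (map-unp-unprimed v)) (refl ∷ all-reverse (map-unp-unprimed u))))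
    (all-reverse (Allₚ.map⁺ (All.map (λ lt → (λ ()) , λ _ → lt) (rising-> inc))))
    (all-reverse (Allₚ.map⁺ (All.map (λ le → (λ _ → le) , λ ()) (falling-≥ u dec))))
  where
  rising-> : ∀ {m v} → Linked _<_ (m ∷ v) → All (m <_) v
  rising-> [-] = []
  rising-> (p ∷ ps) = p ∷ All.map (ℕₚ.<-trans p) (rising-> ps)

findPrime : ∀ r → Unprimed r ⊎ ∃[ a ] ∃[ m ] ∃[ b ] (r ≡ a ++ pl m true ∷ b)
findPrime [] = inj₁ []
findPrime (pl k true ∷ r) = inj₂ ([] , k , r , refl)
findPrime (pl k false ∷ r) with findPrime r
... | inj₁ hs = inj₁ (refl ∷ hs)
... | inj₂ (a , m , b , refl) = inj₂ (pl k false ∷ a , m , b , refl)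

¬true⇒false : ∀ {p : Bool} → p ≢ true → p ≡ false
¬true⇒false {true}  h = contradiction refl h
¬true⇒false {false} _ = refl

-- The letters left of the prime are at least `m`, so `m` is not in the increasing part; those right
-- of it exceed `m`, so the increasing part starts right after it. Hence `m` is the middle element.
primesOK⇒primeRow : ∀ r → Hook (map num r) → PrimesOK (reverse r) → PrimeRow (map num r) r
primesOK⇒primeRow r h ok with findPrime r
... | inj₁ hs = inj₁ (unprimed⇒map-unp r hs)
... | inj₂ (a , m , b , refl)
  rewrite reverse-middle a (pl m true) b | Lₚ.map-++ num a (pl m true ∷ b)
  with allPairs-middle⁻ (reverse b) ok
... | l , r' = inj₂ (map num a , m , map num b , split (position (map num a) h)
    , cong₂ (λ x y → x ++ pl m true ∷ y)
        (unprimed⇒map-unp a (All.map (λ (h₁ , h₂) → ¬true⇒false λ e → ℕₚ.<⇒≱ (h₂ e) (h₁ refl)) before))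
        (unprimed⇒map-unp b (All.map (λ (h₁ , h₂) → ¬true⇒false λ e → ℕₚ.<⇒≱ (h₂ refl) (h₁ e)) after)))
  where
  unreverse : ∀ {P : PLetter → Set} w → All P (reverse w) → All P w
  unreverse {P} w hs = subst (All P) (Lₚ.reverse-involutive w) (all-reverse hs)
  before : All (PrimeOrder (pl m true)) a
  before = unreverse a r'
  after : All (λ z → PrimeOrder z (pl m true)) b
  after = unreverse b l
  inc : ∀ {v} → All (m <_) v → Hook (m ∷ v) → Linked _<_ (m ∷ v)
  inc [] _ = [-]
  inc (p ∷ _) (fall q _) = contradiction q (ℕₚ.<⇒≱ p)
  inc _ (rise i) = i
  split : Position (map num a) m (map num b) → IsHookSplit (map num a ++ m ∷ map num b) (map num a) m (map num b)
  split (falling dec h') = refl , dec , inc (Allₚ.map⁺ (All.map (λ h → proj₂ h refl) after)) h'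
  split (rising u' z eq _ lt _) = contradiction (proj₂ (Allₚ.∷ʳ⁻ (subst (All (m ≤_)) eq
    (Allₚ.map⁺ (All.map (λ h → proj₁ h refl) before))))) (ℕₚ.<⇒≱ lt)

-- Decomposition tableaux are preserved by admissible changes

word : List (List PLetter) → Word
word rows = concat (map reverse rows)

record Tab (n : ℕ) (rows : List (List PLetter)) : Set where
  constructor tab
  field
    range  : All (Letters n) rows
    hooks  : All (Hook ∘ map num) rows
    conds  : Linked RowCond (map (map num) rows)
    primes : All (PrimesOK ∘ reverse) rows

isDecTabPlus⇒tab : ∀ {n la rows} → IsDecTabPlus n la rows → map length rows ≡ la × Tab n rows
isDecTabPlus⇒tab {n} {la} {rows} (D , (len , rng , hks , cds) , pw) with nums pw
  where
  nums : ∀ {D rows} → Pointwise PrimeRow D rows → D ≡ map (map num) rows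
  nums [] = refl
  nums (p ∷ ps) = cong₂ _∷_ (sym (primeRow-num p)) (nums ps)
... | refl = trans lens len
           , tab (All.map Allₚ.map⁻ (Allₚ.map⁻ rng)) (Allₚ.map⁻ (All.map isHook⇒hook hks)) cds (primes pw)
  where
  lens : map length rows ≡ map length (map (map num) rows)
  lens = trans (Lₚ.map-cong (λ r → sym (Lₚ.length-map num r)) rows) (Lₚ.map-∘ rows)
  primes : ∀ {D rows} → Pointwise PrimeRow D rows → All (PrimesOK ∘ reverse) rows
  primes [] = []
  primes (p ∷ ps) = primeRow⇒primesOK p ∷ primes ps

tab⇒isDecTab : ∀ {n la rows} → map length rows ≡ la → Tab n rows → IsDecTab n la (map (map num) rows)
tab⇒isDecTab {rows = rows} len (tab rng hks cds _) =
  trans (sym (trans (Lₚ.map-cong (λ r → sym (Lₚ.length-map num r)) rows) (Lₚ.map-∘ rows))) len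
  , Allₚ.map⁺ (All.map Allₚ.map⁺ rng) , All.map hook⇒isHook (Allₚ.map⁺ hks) , cds

tab⇒isDecTabPlus : ∀ {n la rows} → map length rows ≡ la → Tab n rows → IsDecTabPlus n la rows
tab⇒isDecTabPlus {rows = rows} len t@(tab _ hks _ ps) =
  map (map num) rows , tab⇒isDecTab len t , go rows hks ps
  where
  go : ∀ rows → All (Hook ∘ map num) rows → All (PrimesOK ∘ reverse) rows →
       Pointwise PrimeRow (map (map num) rows) rows
  go [] [] [] = []
  go (r ∷ rows) (h ∷ hs) (p ∷ ps) = primesOK⇒primeRow r h p ∷ go rows hs ps

rowNums-reverse : ∀ r → rowNums (reverse r) ≡ map num r
rowNums-reverse r = cong (map num) (Lₚ.reverse-involutive r)

module _ {n G} (adm : Admissible n G) where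
  open Admissible adm

  -- A hook subword of the new row that is as long as the whole row is the whole row.
  hook-moved : ∀ {c c'} → G c c' → Letters n c → Hook (rowNums c) → Hook (rowNums c')
  hook-moved {c} {c'} g ls h with extends g ls (rowNums c) ⊆-refl h
  ... | u , τ , h' , le = subst Hook (PW.Pointwise-≡⇒≡ (HSubₚ.toPointwise len τ)) h'
    where
    rowNums-length : ∀ w → length (rowNums w) ≡ length w
    rowNums-length w = trans (Lₚ.length-map num (reverse w)) (Lₚ.length-reverse w)
    same : length (rowNums c) ≡ length (rowNums c')
    same = trans (rowNums-length c) (trans (length-eq g) (sym (rowNums-length c')))
    len : length u ≡ length (rowNums c')
    len = ℕₚ.≤-antisym (HSubₚ.length-mono-≤ τ) (subst (_≤ length u) same le)

  RowMoved : List PLetter → List PLetter → Set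
  RowMoved r r' = G (reverse r) (reverse r')

  reverse-length : ∀ (r r' : List PLetter) → length r ≡ length r' → length (reverse r) ≡ length (reverse r')
  reverse-length r r' e = trans (Lₚ.length-reverse r) (trans e (sym (Lₚ.length-reverse r')))

  rows-moved : ∀ rows rows' → map length rows ≡ map length rows' → G (word rows) (word rows') →
               Pointwise RowMoved rows rows'
  rows-moved [] [] _ _ = []
  rows-moved (r ∷ rs) (r' ∷ rs') len g with Lₚ.∷-injective len
  ... | e , es with factors (reverse r) (word rs) (reverse r') (word rs') g (reverse-length r r' e)
  ... | g₁ , g₂ = g₁ ∷ rows-moved rs rs' es g₂

  -- The upper row is visibly a subword; maximality is the point. A hook subword of the new pair is
  -- pulled back to the old pair, where its length is bounded by that of `r₁`.
  rowCond-moved : ∀ {r₁ r₂ r₁' r₂'} → Letters n r₁ → Letters n r₂ → length r₁ ≡ length r₁' →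
    G (reverse r₁ ++ reverse r₂) (reverse r₁' ++ reverse r₂') → Hook (map num r₁') →
    RowCond (map num r₁) (map num r₂) → RowCond (map num r₁') (map num r₂')
  rowCond-moved {r₁} {r₂} {r₁'} {r₂'} l₁ l₂ e g h (_ , _ , max) =
    Subₚ.++⁺ˡ (map num r₂') ⊆-refl , hook⇒isHook h , λ u τ hu →
      let u' , τ' , hu' , le = reflects g (Allₚ.++⁺ (all-reverse l₁) (all-reverse l₂)) u
                                 (subst (u ⊆_) (sym (pair-nums r₁' r₂')) τ) (isHook⇒hook hu)
      in ℕₚ.≤-trans le (ℕₚ.≤-trans (max u' (subst (u' ⊆_) (pair-nums r₁ r₂) τ') (hook⇒isHook hu'))
           (ℕₚ.≤-reflexive (trans (Lₚ.length-map num r₁) (trans e (sym (Lₚ.length-map num r₁'))))))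
    where
    pair-nums : ∀ r₁ r₂ → rowNums (reverse r₁ ++ reverse r₂) ≡ map num r₂ ++ map num r₁
    pair-nums r₁ r₂ = trans (cong (map num) (trans (Lₚ.reverse-++ (reverse r₁) (reverse r₂))
        (cong₂ _++_ (Lₚ.reverse-involutive r₂) (Lₚ.reverse-involutive r₁)))) (Lₚ.map-++ num r₂ r₁)

  conds-moved : ∀ rows rows' → map length rows ≡ map length rows' → G (word rows) (word rows') →
    All (Letters n) rows → All (Hook ∘ map num) rows' →
    Linked RowCond (map (map num) rows) → Linked RowCond (map (map num) rows')
  conds-moved [] [] _ _ _ _ _ = []
  conds-moved (r ∷ []) (r' ∷ []) _ _ _ _ _ = [-]
  conds-moved (r ∷ s ∷ rs) (r' ∷ s' ∷ rs') len g (lr ∷ ls ∷ lrs) (hr ∷ hs) (c ∷ cs)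
    with Lₚ.∷-injective len
  ... | e , es with Lₚ.∷-injective es
  ... | e' , es' =
    rowCond-moved lr ls e (proj₁ (factors (reverse r ++ reverse s) (word rs) (reverse r' ++ reverse s') (word rs')
        (subst₂ G (sym (Lₚ.++-assoc (reverse r) (reverse s) (word rs)))
                  (sym (Lₚ.++-assoc (reverse r') (reverse s') (word rs'))) g)
        (trans (Lₚ.length-++ (reverse r)) (trans (cong₂ _+_ (reverse-length r r' e) (reverse-length s s' e'))
               (sym (Lₚ.length-++ (reverse r'))))))) hr c
    ∷ conds-moved (s ∷ rs) (s' ∷ rs') es
        (proj₂ (factors (reverse r) _ (reverse r') _ g (reverse-length r r' e))) (ls ∷ lrs) hs cs

  tab-moved : ∀ rows rows' → map length rows ≡ map length rows' → G (word rows) (word rows') →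
              Tab n rows → Tab n rows'
  tab-moved rows rows' len g (tab rng hks cds ps) =
    tab (ranges pw rng) hks' (conds-moved rows rows' len g rng hks' cds) (primess pw rng hks ps)
    where
    pw = rows-moved rows rows' len g
    ranges : ∀ {rs rs'} → Pointwise RowMoved rs rs' → All (Letters n) rs → All (Letters n) rs'
    ranges [] [] = []
    ranges {r ∷ _} {r' ∷ _} (g ∷ gs) (l ∷ ls) =
      subst (Letters n) (Lₚ.reverse-involutive r') (all-reverse (letters g (all-reverse l))) ∷ ranges gs ls
    hooksʳ : ∀ {rs rs'} → Pointwise RowMoved rs rs' → All (Letters n) rs →
             All (Hook ∘ map num) rs → All (Hook ∘ map num) rs'
    hooksʳ [] [] [] = []
    hooksʳ {r ∷ _} {r' ∷ _} (g ∷ gs) (l ∷ ls) (h ∷ hs) =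
      subst Hook (rowNums-reverse r') (hook-moved g (all-reverse l) (subst Hook (sym (rowNums-reverse r)) h))
      ∷ hooksʳ gs ls hs
    hks' = hooksʳ pw rng hks
    primess : ∀ {rs rs'} → Pointwise RowMoved rs rs' → All (Letters n) rs → All (Hook ∘ map num) rs →
              All (PrimesOK ∘ reverse) rs → All (PrimesOK ∘ reverse) rs'
    primess [] [] [] [] = []
    primess {r ∷ _} (g ∷ gs) (l ∷ ls) (h ∷ hs) (p ∷ ps) =
      primes g (all-reverse l) (subst Hook (sym (rowNums-reverse r)) h) p ∷ primess gs ls hs ps

-- Cutting a word into rows

splitRows : List ℕ → Word → List (List PLetter)
splitRows []       w = []
splitRows (k ∷ la) w = reverse (take k w) ∷ splitRows la (drop k w)

take-drop-length : ∀ {A : Set} (a b : List A) → take (length a) (a ++ b) ≡ a × drop (length a) (a ++ b) ≡ b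
take-drop-length []      b = refl , refl
take-drop-length (x ∷ a) b = let t , d = take-drop-length a b in cong (x ∷_) t , d

splitRows-word : ∀ rows → splitRows (map length rows) (word rows) ≡ rows
splitRows-word [] = refl
splitRows-word (r ∷ rows)
  rewrite sym (Lₚ.length-reverse r)
        | proj₁ (take-drop-length (reverse r) (word rows)) | proj₂ (take-drop-length (reverse r) (word rows))
  = cong₂ _∷_ (Lₚ.reverse-involutive r) (splitRows-word rows)

drop-sum : ∀ k la (w : Word) → length w ≡ k + sum la → length (drop k w) ≡ sum la
drop-sum k la w e = trans (Lₚ.length-drop k w) (trans (cong (_∸ k) e) (ℕₚ.m+n∸m≡n k (sum la)))

word-splitRows : ∀ la w → length w ≡ sum la → word (splitRows la w) ≡ w
word-splitRows [] [] _ = refl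
word-splitRows (k ∷ la) w e =
  trans (cong₂ _++_ (Lₚ.reverse-involutive (take k w)) (word-splitRows la (drop k w) (drop-sum k la w e)))
        (Lₚ.take++drop≡id k w)

lengths-splitRows : ∀ la w → length w ≡ sum la → map length (splitRows la w) ≡ la
lengths-splitRows [] w _ = refl
lengths-splitRows (k ∷ la) w e = cong₂ _∷_
  (trans (Lₚ.length-reverse (take k w)) (trans (Lₚ.length-take k w)
    (ℕₚ.m≤n⇒m⊓n≡m (subst (k ≤_) (sym e) (ℕₚ.m≤m+n k (sum la))))))
  (lengths-splitRows la (drop k w) (drop-sum k la w e))

length-word : ∀ rows → length (word rows) ≡ sum (map length rows)
length-word [] = refl
length-word (r ∷ rows) = trans (Lₚ.length-++ (reverse r)) (cong₂ _+_ (Lₚ.length-reverse r) (length-word rows))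

-- Crystals embedded in the crystal of words

module _ {B : Set} {φ : B → Word} (φ-inj : Injective φ) where

  -- A record rather than the bare equation, so that `g` and `h` can be read off the type of an
  -- argument.
  record Intertwines (g : B → Maybe B) (h : Op) : Set where
    constructor intertwine
    field commutes : ∀ b → Maybe.map φ (g b) ≡ h (φ b)
  open Intertwines

  map-φ-injective : ∀ {m m'} → Maybe.map φ m ≡ Maybe.map φ m' → m ≡ m'
  map-φ-injective {just b}  {just c}  e = cong just (φ-inj b c (Maybeₚ.just-injective e))
  map-φ-injective {nothing} {nothing} _ = refl

  push : ∀ {g h} → Intertwines g h → ∀ {b c} → g b ≡ just c → h (φ b) ≡ just (φ c)
  push t {b} e = trans (sym (commutes t b)) (cong (Maybe.map φ) e)

  pull : ∀ {g h} → Intertwines g h → ∀ {b c} → h (φ b) ≡ just (φ c) → g b ≡ just c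
  pull t {b} e = map-φ-injective (trans (commutes t b) e)

  map->>= : ∀ {g h} → Intertwines g h → ∀ m → Maybe.map φ (m >>= g) ≡ (Maybe.map φ m >>= h)
  map->>= t (just b) = commutes t b
  map->>= t nothing  = refl

  map-iter : ∀ {g h} → Intertwines g h → ∀ k b → Maybe.map φ (iter k g b) ≡ iter k h (φ b)
  map-iter t zero b = refl
  map-iter {g} {h} t (suc k) b = trans (map->>= t (iter k g b)) (cong (_>>= h) (map-iter t k b))

  is-just-iter : ∀ {g h} → Intertwines g h → ∀ k b → is-just (iter k g b) ≡ is-just (iter k h (φ b))
  is-just-iter {g} t k b = trans (sym (is-just-map (iter k g b))) (cong is-just (map-iter t k b))
    where
    is-just-map : ∀ m → is-just (Maybe.map φ m) ≡ is-just m
    is-just-map (just _) = refl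
    is-just-map nothing  = refl

  pull-inverse : ∀ {g g' h h'} → Intertwines g h → Intertwines g' h' → Inverse h h' → Inverse g g'
  pull-inverse t t' inv b c = (λ e → pull t' (proj₁ (inv (φ b) (φ c)) (push t e)))
                            , (λ e → pull t (proj₂ (inv (φ b) (φ c)) (push t' e)))

  pull-commute : ∀ {g g' h h'} → Intertwines g h → Intertwines g' h' → Commute h h' → Commute g g'
  pull-commute {g} {g'} {h} {h'} t t' com b = map-φ-injective (begin
    Maybe.map φ (g' b >>= g)   ≡⟨ map->>= t (g' b) ⟩
    (Maybe.map φ (g' b) >>= h) ≡⟨ cong (_>>= h) (commutes t' b) ⟩
    (h' (φ b) >>= h)           ≡⟨ com (φ b) ⟩
    (h (φ b) >>= h')           ≡⟨ cong (_>>= h') (commutes t b) ⟨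
    (Maybe.map φ (g b) >>= h') ≡⟨ map->>= t' (g b) ⟨
    Maybe.map φ (g b >>= g')   ∎)
    where open ≡-Reasoning

  pull-preservesStr : ∀ {g g' h h'} → Intertwines g h → Intertwines g' h' → PreservesStr h h' → PreservesStr g g'
  pull-preservesStr t t' pres b c e k =
    trans (is-just-iter t' k c) (trans (pres (φ b) (φ c) (push t e) k) (sym (is-just-iter t' k b)))

  pull-reaches : ∀ {g h} → Intertwines g h → ∀ b k → Reaches g b k → Reaches h (φ b) k
  pull-reaches t b k = trans (sym (is-just-iter t k b))

  push-reaches : ∀ {g h} → Intertwines g h → ∀ b k → Reaches h (φ b) k → Reaches g b k
  push-reaches t b k = trans (is-just-iter t k b)

  pull-sumLe : ∀ {g g' h h'} → Intertwines g h → Intertwines g' h' → ∀ b N → SumLe h h' (φ b) N → SumLe g g' b N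
  pull-sumLe t t' b N le k l r r' = le k l (pull-reaches t b k r) (pull-reaches t' b l r')

  push-sumLe : ∀ {g g' h h'} → Intertwines g h → Intertwines g' h' → ∀ b N → SumLe g g' b N → SumLe h h' (φ b) N
  push-sumLe t t' b N le k l r r' = le k l (push-reaches t b k r) (push-reaches t' b l r')

embedded⇒isQCrystal : ∀ {n B} (S : QStr n B) (φ : B → Word) → (∀ b → QStr.wt S b ≡ numWt n (φ b)) →
                      IsQEmbedding S φ → IsQCrystal S
embedded⇒isQCrystal {n} S φ wt≡ (_ , inj , ef , ebar≡ , fbar≡) with wordQ-isQCrystal n
... | gl , far , inv , shift = gl' , far' , pull-inverse inj te tf inv , pull-shift te shift
  where
  open QStr S
  te : Intertwines inj ebar ebarW
  te = intertwine ebar≡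
  tf : Intertwines inj fbar fbarW
  tf = intertwine fbar≡
  pull-shift : ∀ {g h α} → Intertwines inj g h → WtShift (numWt n) h α → WtShift wt g α
  pull-shift {α = α} t sh b c eq j = trans (cong (λ f → f j) (wt≡ c))
    (trans (sh (φ b) (φ c) (push inj t eq) j) (cong (λ f → f j +ℤ α j) (sym (wt≡ b))))

  gl' : IsGlCrystal S
  gl' i v = pull-inverse inj (intertwine (proj₁ ∘ ef i v)) (intertwine (proj₂ ∘ ef i v)) (proj₁ (gl i v))
          , pull-shift (intertwine (proj₁ ∘ ef i v)) (proj₂ (gl i v))
  far' : ∀ i → 3 ≤ i → i < n → _
  far' i 3≤i i<n with far i 3≤i i<n
  ... | c₁ , c₂ , c₃ , c₄ , s₁ , s₂ , s₃ , s₄ =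
    pull-commute inj te ti c₁ , pull-commute inj te ti' c₂ , pull-commute inj tf ti c₃ , pull-commute inj tf ti' c₄
    , pull-preservesStr inj te ti s₁ , pull-preservesStr inj te ti' s₂
    , pull-preservesStr inj tf ti s₃ , pull-preservesStr inj tf ti' s₄
    where
    v : ValidIdx n i
    v = ℕₚ.≤-trans (s≤s z≤n) 3≤i , i<n
    ti : Intertwines inj (e i) (eW i)
    ti = intertwine (proj₁ ∘ ef i v)
    ti' : Intertwines inj (f i) (fW i)
    ti' = intertwine (proj₂ ∘ ef i v)

-- An embedding compares weights coordinate by coordinate, whereas `Preserves e0 wt` equates
-- functions; hence the separate hypothesis on weights.
embedded⇒isQPlusCrystal : ∀ {n B} (S : QPlusStr n B) (φ : B → Word) → (∀ b → QPlusStr.wt S b ≡ numWt n (φ b)) →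
                          IsQPlusEmbedding S φ → IsQPlusCrystal S
embedded⇒isQPlusCrystal {n} S φ wt≡ (emb@(_ , inj , ef , ebar≡ , fbar≡) , e0≡ , f0≡) with wordQPlus-isQPlusCrystal n
... | _ , com , w₁ , w₂ , str , s₁ , s₂ , s₃ , s₄ , inv , sum1 , sum0 =
  embedded⇒isQCrystal q φ wt≡ emb , com' , pull-wt t0 w₁ , pull-wt t0' w₂ , str'
  , pull-preservesStr inj t0 te s₁ , pull-preservesStr inj t0 tf s₂
  , pull-preservesStr inj t0' te s₃ , pull-preservesStr inj t0' tf s₄
  , pull-inverse inj t0 t0' inv
  , (λ b → pull-sumLe inj t0 t0' b 1 (sum1 (φ b)))
  , (λ b le → pull-sumLe inj t0 t0' b 0 (sum0 (φ b) (push-sumLe inj te tf b 0 le)))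
  where
  open QPlusStr S
  te : Intertwines inj ebar ebarW
  te = intertwine ebar≡
  tf : Intertwines inj fbar fbarW
  tf = intertwine fbar≡
  t0 : Intertwines inj e0 e0W
  t0 = intertwine e0≡
  t0' : Intertwines inj f0 f0W
  t0' = intertwine f0≡
  pull-wt : ∀ {g h} → Intertwines inj g h → Preserves h (numWt n) → Preserves g wt
  pull-wt t pres b c eq = trans (wt≡ c) (trans (pres (φ b) (φ c) (push inj t eq)) (sym (wt≡ b)))
  com' : ∀ i → 2 ≤ i → i < n → _
  com' i 2≤i i<n with com i 2≤i i<n
  ... | c₁ , c₂ , c₃ , c₄ =
    pull-commute inj t0 ti c₁ , pull-commute inj t0 ti' c₂ , pull-commute inj t0' ti c₃ , pull-commute inj t0' ti' c₄
    where
    v : ValidIdx n i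
    v = ℕₚ.≤-trans (s≤s z≤n) 2≤i , i<n
    ti : Intertwines inj (e i) (eW i)
    ti = intertwine (proj₁ ∘ ef i v)
    ti' : Intertwines inj (f i) (fW i)
    ti' = intertwine (proj₂ ∘ ef i v)
  str' : ∀ i → ValidIdx n i → _
  str' i v with str i v
  ... | p₁ , p₂ , p₃ , p₄ =
    pull-preservesStr inj t0 ti p₁ , pull-preservesStr inj t0 ti' p₂
    , pull-preservesStr inj t0' ti p₃ , pull-preservesStr inj t0' ti' p₄
    where
    ti : Intertwines inj (e i) (eW i)
    ti = intertwine (proj₁ ∘ ef i v)
    ti' : Intertwines inj (f i) (fW i)
    ti' = intertwine (proj₂ ∘ ef i v)

-- Operators on unprimed words

flip-unprimed : ∀ {i w v} → Flip i w v → Unprimed w ⇔ Unprimed v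
flip-unprimed (flip a p b _ _) = mk⇔ (go a) (go a)
  where
  go : ∀ a {k l p b} → Unprimed (a ++ pl k p ∷ b) → Unprimed (a ++ pl l p ∷ b)
  go []      (h ∷ hs) = h ∷ hs
  go (x ∷ a) (h ∷ hs) = h ∷ go a hs

bar-unprimed : ∀ {w v} → Bar w v → Unprimed w ⇔ Unprimed v
bar-unprimed b = mk⇔ (fwd b) (bwd b)
  where
  fwd : ∀ {w v} → Bar w v → Unprimed w → Unprimed v
  fwd (lone _)   (h ∷ hs) = h ∷ hs
  fwd (pair r)   (h ∷ hs) = rep-All r hs ∷ rep-replace r h hs
  fwd (skip _ b) (h ∷ hs) = h ∷ fwd b hs
  bwd : ∀ {w v} → Bar w v → Unprimed v → Unprimed w
  bwd (lone _)   (h ∷ hs) = h ∷ hs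
  bwd (pair r)   (h ∷ hs) = rep-All (Rep-sym r) hs ∷ rep-replace (Rep-sym r) h hs
  bwd (skip _ b) (h ∷ hs) = h ∷ bwd b hs

-- Lifting operators from words to tableaux

module DecTabCrystals {n : ℕ} (2≤n : 2 ≤ n) (la : List ℕ) where

  Valid : Word → Set
  Valid w = IsDecTabPlus n la (splitRows la w) × length w ≡ sum la

  Closed : Op → Set
  Closed g = ∀ rows → IsDecTabPlus n la rows → ∀ {w} → g (word rows) ≡ just w → Valid w

  closed : ∀ {G g} → Admissible n G → (∀ {w v} → g w ≡ just v → G w v) → Closed g
  closed {G} adm sound rows dec {w} eq with isDecTabPlus⇒tab dec
  ... | refl , t = tab⇒isDecTabPlus (lengths-splitRows la w len)
      (tab-moved adm rows (splitRows la w) (sym (lengths-splitRows la w len))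
        (subst (G (word rows)) (sym (word-splitRows la w len)) (sound eq)) t)
    , len
    where
    len : length w ≡ sum (map length rows)
    len = trans (sym (Admissible.length-eq adm (sound eq))) (length-word rows)

  -- The validity of a tableau is irrelevant, so the proof passed on must be irrelevant too; the
  -- rows are computed from the word and the shape alone.
  toTableau : (m : Maybe Word) → .(∀ {w} → m ≡ just w → Valid w) → Maybe (DecTabPlus n la)
  toTableau nothing  _ = nothing
  toTableau (just w) h = just (dtp (splitRows la w) (proj₁ (h refl)))

  revrow-toTableau : ∀ m .(h : ∀ {w} → m ≡ just w → Valid w) → Maybe.map (revrow {n} {la}) (toTableau m h) ≡ m
  revrow-toTableau nothing  _ = refl
  -- The length equation is needed relevantly; being decidable, it can be recomputed from its
  -- irrelevant proof.
  revrow-toTableau (just w) h = cong just (word-splitRows la w (recompute (length w ≟ sum la) (proj₂ (h refl))))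

  lift : (g : Op) → .(Closed g) → DecTabPlus n la → Maybe (DecTabPlus n la)
  lift g c (dtp rows valid) = toTableau (g (word rows)) (c rows valid)

  revrow-lift : (g : Op) .(c : Closed g) → ∀ T → Maybe.map (revrow {n} {la}) (lift g c T) ≡ g (revrow T)
  revrow-lift g c (dtp rows valid) = revrow-toTableau (g (word rows)) (c rows valid)

  revrow-injective : Injective (revrow {n} {la})
  revrow-injective (dtp rows valid) (dtp rows' valid') eq = same rows≡
    where
    lengths : ∀ {rows} → .(IsDecTabPlus n la rows) → map length rows ≡ la
    lengths {rows} v = recompute (Lₚ.≡-dec _≟_ (map length rows) la) (proj₁ (isDecTabPlus⇒tab v))
    cut : ∀ {rows} → map length rows ≡ la → splitRows la (word rows) ≡ rows
    cut {rows} refl = splitRows-word rows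
    rows≡ : rows ≡ rows'
    rows≡ = trans (sym (cut (lengths valid))) (trans (cong (splitRows la) eq) (cut (lengths valid')))
    same : rows ≡ rows' → dtp rows valid ≡ dtp rows' valid'
    same refl = refl

  validIdx? : ∀ i → Dec (ValidIdx n i)
  validIdx? i = (1 ≤? i) ×-dec (i <? n)

  up = move-admissible 2≤n
  down = move-admissible⁻¹ 2≤n

  open Equivalence using (to; from)

  eW-closed : ∀ {i} → ValidIdx n i → Closed (eW i)
  eW-closed {i} v = closed down λ {w} {u} eq → flip v (to (eW⇔Flip i u w) eq)

  fW-closed : ∀ {i} → ValidIdx n i → Closed (fW i)
  fW-closed {i} v = closed up λ {w} {u} eq → flip v (to (fW⇔Flip i w u) eq)

  ebarW-closed : Closed ebarW
  ebarW-closed = closed down λ {w} {u} eq → bar (to (ebarW⇔Bar u w) eq)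

  fbarW-closed : Closed fbarW
  fbarW-closed = closed up λ {w} {u} eq → bar (to (fbarW⇔Bar w u) eq)

  e0W-closed : Closed e0W
  e0W-closed = closed up λ {w} {u} eq → rep (to (e0W⇔Rep w u) eq)

  f0W-closed : Closed f0W
  f0W-closed = closed up λ {w} {u} eq → rep (to (f0W⇔Rep w u) eq)

  -- The fields `e` and `f` take every natural number, but closure can fail outside the valid
  -- indices (`fW n` turns n into n + 1); there the value is set to `nothing`.
  liftAt : ∀ i → (g : Op) → .(ValidIdx n i → Closed g) → DecTabPlus n la → Maybe (DecTabPlus n la)
  liftAt i g c T with validIdx? i
  ... | yes v = lift g (c v) T
  ... | no _  = nothing

  revrow-liftAt : ∀ {i} → ValidIdx n i → (g : Op) .(c : ValidIdx n i → Closed g) → ∀ T →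
                  Maybe.map (revrow {n} {la}) (liftAt i g c T) ≡ g (revrow T)
  revrow-liftAt {i} v g c T with validIdx? i
  ... | yes v' = revrow-lift g (c v') T
  ... | no ¬v  = contradiction v ¬v

  crystal⁺ : QPlusStr n (DecTabPlus n la)
  crystal⁺ = record
    { q = record
      { wt   = numWt n ∘ revrow
      ; e    = λ i → liftAt i (eW i) eW-closed
      ; f    = λ i → liftAt i (fW i) fW-closed
      ; ebar = lift ebarW ebarW-closed
      ; fbar = lift fbarW fbarW-closed }
    ; e0 = lift e0W e0W-closed
    ; f0 = lift f0W f0W-closed }

  module Q⁺ = QPlusStr crystal⁺

  crystal⁺-embedding : IsQPlusEmbedding crystal⁺ revrow
  crystal⁺-embedding =
    ( (λ T j → wtW≡numWt n (revrow T) j)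
    , revrow-injective
    , (λ i v T → revrow-liftAt v (eW i) eW-closed T , revrow-liftAt v (fW i) fW-closed T)
    , revrow-lift ebarW ebarW-closed
    , revrow-lift fbarW fbarW-closed )
    , revrow-lift e0W e0W-closed
    , revrow-lift f0W f0W-closed

  -- An embedding prescribes the image under `revrow` of every value of every operator, and `revrow`
  -- is injective.
  crystal⁺-unique : ∀ S' → IsQPlusEmbedding S' (revrow {n} {la}) → SameQPlus S' crystal⁺
  crystal⁺-unique S' ((wt' , _ , ef' , te' , tf') , t0 , t0') with crystal⁺-embedding
  ... | (wt , inj , ef , te , tf) , s0 , s0' =
      (λ b j → trans (sym (wt' b j)) (wt b j))
    , (λ i v b → agree (proj₁ (ef' i v b)) (proj₁ (ef i v b)) , agree (proj₂ (ef' i v b)) (proj₂ (ef i v b)))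
    , (λ b → agree (te' b) (te b)) , (λ b → agree (tf' b) (tf b))
    , (λ b → agree (t0 b) (s0 b)) , (λ b → agree (t0' b) (s0' b))
    where
    agree : ∀ {m m' : Maybe (DecTabPlus n la)} {u} → Maybe.map revrow m ≡ u → Maybe.map revrow m' ≡ u → m ≡ m'
    agree p q = map-φ-injective inj (trans p (sym q))

  -- The unprimed tableaux

  strip : DecTabPlus n la → DecTab n la
  strip (dtp rows valid) = dt (map (map num) rows)
    (let len , t = isDecTabPlus⇒tab valid in tab⇒isDecTab len t)

  incl-strip : ∀ T → Unprimed (revrow T) → inclDT (strip T) ≡ T
  incl-strip (dtp rows valid) h = same (rows≡ rows h)
    where
    rows≡ : ∀ rows → Unprimed (word rows) → map (map unp) (map (map num) rows) ≡ rows
    rows≡ [] _ = refl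
    rows≡ (r ∷ rows) h = cong₂ _∷_
      (sym (unprimed⇒map-unp r (subst Unprimed (Lₚ.reverse-involutive r) (all-reverse (Allₚ.++⁻ˡ (reverse r) h)))))
      (rows≡ rows (Allₚ.++⁻ʳ (reverse r) h))
    same : map (map unp) (map (map num) rows) ≡ rows →
           inclDT (strip (dtp rows valid)) ≡ dtp {n} {la} rows valid
    same e = subst-rows e
      where
      subst-rows : ∀ {rs} .{v : IsDecTabPlus n la rs} → rs ≡ rows → dtp {n} {la} rs v ≡ dtp rows valid
      subst-rows refl = refl

  incl-unprimed : ∀ (a : DecTab n la) → Unprimed (revrow (inclDT a))
  incl-unprimed (dt rows _) = go rows
    where
    go : ∀ rows → Unprimed (word (map (map unp) rows))
    go [] = []
    go (r ∷ rows) = Allₚ.++⁺ (all-reverse (map-unp-unprimed r)) (go rows)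

  incl-injective : Injective (inclDT {n} {la})
  incl-injective (dt rows v) (dt rows' v') eq = same (unp-injective (cong DecTabPlus.rows eq))
    where
    unp-injective : map (map unp) rows ≡ map (map unp) rows' → rows ≡ rows'
    unp-injective = Lₚ.map-injective (Lₚ.map-injective λ e → cong num e)
    same : rows ≡ rows' → dt rows v ≡ dt rows' v'
    same refl = refl

  PreservesUnprimed : Op → Set
  PreservesUnprimed g = ∀ {w v} → g w ≡ just v → Unprimed w → Unprimed v

  -- `strip` is defined on all primed tableaux, which makes this total; that nothing is lost for the
  -- operators in question is `incl-restrict`.
  restrict : (DecTabPlus n la → Maybe (DecTabPlus n la)) → DecTab n la → Maybe (DecTab n la)
  restrict g a = Maybe.map strip (g (inclDT a))

  incl-restrict : ∀ {g h} → PreservesUnprimed h → (∀ T → Maybe.map revrow (g T) ≡ h (revrow T)) →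
                  ∀ a → Maybe.map inclDT (restrict g a) ≡ g (inclDT a)
  incl-restrict {g} {h} pu t a with g (inclDT a) in eq
  ... | nothing = refl
  ... | just T = cong just (incl-strip T (pu (trans (sym (t (inclDT a))) (cong (Maybe.map revrow) eq)) (incl-unprimed a)))

  eW-unprimed : ∀ i → PreservesUnprimed (eW i)
  eW-unprimed i {w} {v} eq = from (flip-unprimed (to (eW⇔Flip i v w) eq))

  fW-unprimed : ∀ i → PreservesUnprimed (fW i)
  fW-unprimed i {w} {v} eq = to (flip-unprimed (to (fW⇔Flip i w v) eq))

  ebarW-unprimed : PreservesUnprimed ebarW
  ebarW-unprimed {w} {v} eq = from (bar-unprimed (to (ebarW⇔Bar v w) eq))

  fbarW-unprimed : PreservesUnprimed fbarW
  fbarW-unprimed {w} {v} eq = to (bar-unprimed (to (fbarW⇔Bar w v) eq))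

  crystal : QStr n (DecTab n la)
  crystal = record
    { wt   = Q⁺.wt ∘ inclDT
    ; e    = λ i → restrict (Q⁺.e i)
    ; f    = λ i → restrict (Q⁺.f i)
    ; ebar = restrict Q⁺.ebar
    ; fbar = restrict Q⁺.fbar }

  crystal-restricts : Restricts crystal⁺ inclDT crystal
  crystal-restricts =
      (λ a j → refl)
    , (λ i v a → incl-restrict {Q⁺.e i} (eW-unprimed i) (revrow-liftAt v (eW i) eW-closed) a
               , incl-restrict {Q⁺.f i} (fW-unprimed i) (revrow-liftAt v (fW i) fW-closed) a)
    , incl-restrict {Q⁺.ebar} ebarW-unprimed (revrow-lift ebarW ebarW-closed)
    , incl-restrict {Q⁺.fbar} fbarW-unprimed (revrow-lift fbarW fbarW-closed)

  revrow-restrict : ∀ {g h} → PreservesUnprimed h → (∀ T → Maybe.map revrow (g T) ≡ h (revrow T)) →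
                    ∀ a → Maybe.map (revrow ∘ inclDT) (restrict g a) ≡ h (revrow (inclDT a))
  revrow-restrict {g} pu t a = trans (Maybeₚ.map-∘ (restrict g a))
    (trans (cong (Maybe.map revrow) (incl-restrict {g} pu t a)) (t (inclDT a)))

  crystal-embedding : IsQEmbedding crystal (revrow ∘ inclDT)
  crystal-embedding =
      (λ a j → wtW≡numWt n (revrow (inclDT a)) j)
    , (λ a b eq → incl-injective a b (revrow-injective (inclDT a) (inclDT b) eq))
    , (λ i v a → revrow-restrict {Q⁺.e i} (eW-unprimed i) (revrow-liftAt v (eW i) eW-closed) a
               , revrow-restrict {Q⁺.f i} (fW-unprimed i) (revrow-liftAt v (fW i) fW-closed) a)
    , revrow-restrict {Q⁺.ebar} ebarW-unprimed (revrow-lift ebarW ebarW-closed)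
    , revrow-restrict {Q⁺.fbar} fbarW-unprimed (revrow-lift fbarW fbarW-closed)

mainTheorem1 : (n : ℕ) → 2 ≤ n → (la : List ℕ) → StrictPartition la → length la ≤ n →
    Σ (QPlusStr n (DecTabPlus n la)) (λ S →
    (IsQPlusCrystal S × IsQPlusEmbedding S (revrow {n} {la}))
    × (∀ (S' : QPlusStr n (DecTabPlus n la)) →
    IsQPlusCrystal S' → IsQPlusEmbedding S' (revrow {n} {la}) → SameQPlus S' S)
    × Σ (QStr n (DecTab n la)) (λ S₀ →
    Restricts S (inclDT {n} {la}) S₀
    × IsQCrystal S₀
    × IsQEmbedding S₀ (revrow {n} {la} ∘ inclDT {n} {la})))
mainTheorem1 n 2≤n la _ _ =
    crystal⁺ , (embedded⇒isQPlusCrystal crystal⁺ revrow (λ _ → refl) crystal⁺-embedding , crystal⁺-embedding)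
  , (λ S' _ → crystal⁺-unique S')
  , crystal , crystal-restricts , embedded⇒isQCrystal crystal (revrow ∘ inclDT) (λ _ → refl) crystal-embedding , crystal-embedding
  where
  open DecTabCrystals 2≤n la
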